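{- Let $n,\Delta$ be positive integers with $\Delta\le n$. The number of $n$-dimensional empty $\Delta$-modular simplices, counted modulo integer-equivalence, is bounded by $O\!\left(\frac n\Delta\right)^{\Delta-1}\cdot\Delta^{\log_2(\Delta)+2}$; in particular, for fixed $\Delta$ it is bounded by a polynomial in $n$ of degree $\Delta-1$.
   Context: An $n$-dimensional simplex $\mathcal{S}\subseteq\mathbb{R}^n$ is $\Delta$-modular if $\mathcal{S}=\{x: Ax\le b\}$ for some $A\in\mathbb{Z}^{(n+1)\times n}$ with $\operatorname{rank}(A)=n$ and $b\in\mathbb{Z}^{n+1}$, where $\Delta=\Delta(A)$ is the maximum absolute value of $n\times n$ minors of $A$. A simplex is empty if $\mathcal{S}\cap\mathbb{Z}^n=\emptyset$. Two simplices $\mathcal{S},\mathcal{S}'$ are integer-equivalent if $\mathcal{S}'=T(\mathcal{S})$ for an affine map $T(x)=Qx+q$ with $Q$ an integer unimodular $n\times n$ matrix and $q\in\mathbb{Z}^n$. -}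

module Defs where

open import Data.Nat as ℕ using (ℕ; zero; suc)
open import Data.Integer as ℤ using (ℤ; +_; ∣_∣)
open import Data.Rational as ℚ using (ℚ)
open import Data.Fin using (Fin; zero; suc; punchIn)
open import Data.List using (List; length)
open import Data.List.Membership.Propositional using (_∈_)
open import Data.Product using (Σ; ∃; ∃-syntax; _×_; _,_)
open import Relation.Binary.PropositionalEquality using (_≡_; _≢_)
open import Relation.Nullary using (¬_)
open import Function.Bundles using (_⇔_)

Mat : Set → ℕ → ℕ → Set
Mat A m n = Fin m → Fin n → A

Vect : Set → ℕ → Set
Vect A n = Fin n → A

sumℤ : ∀ {n} → (Fin n → ℤ) → ℤ
sumℤ {zero}  f = + 0
sumℤ {suc n} f = f zero ℤ.+ sumℤ (λ i → f (suc i))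

sumℚ : ∀ {n} → (Fin n → ℚ) → ℚ
sumℚ {zero}  f = ℚ.0ℚ
sumℚ {suc n} f = f zero ℚ.+ sumℚ (λ i → f (suc i))

sign : ℕ → ℤ
sign zero          = + 1
sign (suc zero)    = ℤ.- (+ 1)
sign (suc (suc k)) = sign k

det : ∀ n → Mat ℤ n n → ℤ
det zero    M = + 1
det (suc n) M = sumℤ {suc n} (λ j →
  sign (Data.Fin.toℕ j) ℤ.* (M zero j ℤ.* det n (λ r c → M (suc r) (punchIn j c))))

delRow : ∀ {n} → Mat ℤ (suc n) n → Fin (suc n) → Mat ℤ n n
delRow A i r c = A (punchIn i r) c

FullRank : ∀ {n} → Mat ℤ (suc n) n → Set
FullRank {n} A = ∃[ i ] det n (delRow A i) ≢ + 0

MaxMinor : ∀ {n} → Mat ℤ (suc n) n → ℕ → Set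
MaxMinor {n} A Δ =
  (∀ i → ∣ det n (delRow A i) ∣ ℕ.≤ Δ) × (∃[ i ] ∣ det n (delRow A i) ∣ ≡ Δ)

toℚ : ℤ → ℚ
toℚ z = z ℚ./ 1

rowDot : ∀ {m n} → Mat ℤ m n → Vect ℚ n → Fin m → ℚ
rowDot A x i = sumℚ (λ j → toℚ (A i j) ℚ.* x j)

InP : ∀ {m n} → Mat ℤ m n → Vect ℤ m → Vect ℚ n → Set
InP A b x = ∀ i → rowDot A x i ℚ.≤ toℚ (b i)

InInt : ∀ {m n} → Mat ℤ m n → Vect ℤ m → Vect ℚ n → Set
InInt A b x = ∀ i → rowDot A x i ℚ.< toℚ (b i)

-- The polyhedron {x : Ax ≤ b} is an n-dimensional simplex:
-- it is bounded and has nonempty interior (with exactly n+1 inequalities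
-- and rank A = n this means it is an n-simplex).
IsSimplex : ∀ {n} → Mat ℤ (suc n) n → Vect ℤ (suc n) → Set
IsSimplex {n} A b =
  (∃[ x ] InInt {suc n} {n} A b x) ×
  (∃[ R ] ∀ (x : Vect ℚ n) → InP A b x → ∀ j → ℚ.∣ x j ∣ ℚ.≤ R)

IsEmptyS : ∀ {n} → Mat ℤ (suc n) n → Vect ℤ (suc n) → Set
IsEmptyS {n} A b = ¬ (Σ (Vect ℤ n) λ z → InP A b (λ j → toℚ (z j)))

EmptyΔModSimplex : ∀ n → ℕ → Mat ℤ (suc n) n → Vect ℤ (suc n) → Set
EmptyΔModSimplex n Δ A b =
  FullRank A × MaxMinor A Δ × IsSimplex A b × IsEmptyS A b

Unimodular : ∀ {n} → Mat ℤ n n → Set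
Unimodular {n} Q = (det n Q ≡ + 1) ⊎' (det n Q ≡ ℤ.- (+ 1))
  where open import Data.Sum renaming (_⊎_ to _⊎'_)

applyAff : ∀ {n} → Mat ℤ n n → Vect ℤ n → Vect ℚ n → Vect ℚ n
applyAff Q q x i = rowDot Q x i ℚ.+ toℚ (q i)

IntEquiv : ∀ {n} → (Mat ℤ (suc n) n × Vect ℤ (suc n)) →
           (Mat ℤ (suc n) n × Vect ℤ (suc n)) → Set
IntEquiv {n} (A , b) (A' , b') =
  ∃[ Q ] ∃[ q ] Unimodular {n} Q ×
    (∀ y → InP A' b' y ⇔ (∃[ x ] InP A b x × (∀ i → applyAff Q q x i ≡ y i)))

-- M ≤ K · D^(log₂ D) for naturals M, K and D ≥ 1, stated without reals:
-- for all naturals a, b > 0: if a/b < log₂(M/K) (i.e. 2^a K^b < M^b)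
-- then a/b < (log₂ D)², witnessed by a rational u/v with u/v < log₂ D
-- (i.e. 2^u < D^v) and (u/v)² > a/b.
LeMulPowLog2 : ℕ → ℕ → ℕ → Set
LeMulPowLog2 M K D =
  ∀ a b → 0 ℕ.< b → (2 ℕ.^ a) ℕ.* (K ℕ.^ b) ℕ.< M ℕ.^ b →
    ∃[ u ] ∃[ v ] (0 ℕ.< v) × (a ℕ.* v ℕ.* v ℕ.< u ℕ.* u ℕ.* b) × (2 ℕ.^ u ℕ.< D ℕ.^ v)

ClassCountLe : ℕ → ℕ → (ℕ → Set) → Set
ClassCountLe n Δ Bound =
  ∃[ reps ] Bound (length reps) ×
    (∀ {p} → p ∈ reps → EmptyΔModSimplex n Δ (Data.Product.proj₁ p) (Data.Product.proj₂ p)) ×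
    (∀ A b → EmptyΔModSimplex n Δ A b →
       ∃[ p ] p ∈ reps × IntEquiv {n} (A , b) p)
  where open import Data.Product using (proj₁; proj₂)

-- Move the rows around so that the minor of maximal absolute value Δ belongs to the matrix B of all rows but
-- the first, c. A unimodular substitution puts B in Hermite normal form; its diagonal has product Δ, so with
-- K = ⌊log₂ Δ⌋ all but at most K of the rows are unit vectors. After a simultaneous permutation of rows and columns
-- the first m = n - K rows of B are unit vectors, and the remaining K rows consist of a K × K block, bounded
-- by Δ, and of m columns that take at most ∏ᵣ dᵣ = Δ values, where dᵣ are the last K diagonal entries. A further
-- permutation sorts these columns, which leaves at most C(m + Δ - 1, Δ - 1) = O(n/Δ)^(Δ-1) choices.
-- The simplex being bounded, Δ c = - Σ τᵢ Bᵢ with τᵢ > 0, and τᵢ ≤ Δ by Cramer's rule because the τᵢ are minors.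
-- Hence the τᵢ of the unit rows are determined modulo Δ, and so completely, by the other K. An integer translation
-- reduces the right-hand sides modulo the diagonal; then the origin satisfies all the inequalities of B, so
-- emptiness makes the right-hand side of c negative, and nonempty interior makes it larger than - K Δ.
-- All numbers of choices besides that of the sorted columns multiply to at most Δ² (Δ + 1)^(K² + 2K), and the
-- second factor is at most 2^(13 (Δ - 1)), so the constant C absorbs it and Δ^(log₂ Δ) is not needed.
module Submission where

open import Defs
open import Algebra.Bundles using (CommutativeSemiring; CommutativeRing)
import Algebra.Properties.CommutativeMonoid.Sum as MonoidSum
import Algebra.Properties.Semiring.Sum as SemiringSum
open import Data.Empty using (⊥-elim)
open import Data.Fin as Fin using (Fin; zero; suc; punchIn; inject₁; toℕ; _↑ˡ_; _↑ʳ_)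
open import Data.Fin.Permutation as Perm using (Permutation′; _⟨$⟩ʳ_; _⟨$⟩ˡ_)
import Data.Fin.Properties as Finₚ
open import Data.Integer as ℤ using (ℤ; +_; ∣_∣)
import Data.Integer.DivMod as ℤD
import Data.Integer.Properties as ℤₚ
import Data.Integer.Tactic.RingSolver as ℤS
open import Data.List as List using (List; length)
open import Data.List.Membership.Propositional using (_∈_)
import Data.List.Membership.Propositional.Properties as ∈ₚ
import Data.List.Properties as Listₚ
import Data.List.Relation.Unary.Any as Any
open import Data.Nat as ℕ using (ℕ; zero; suc; _!)
open import Data.Nat.Divisibility using (divides)
import Data.Nat.DivMod as ℕD
open import Data.Nat.Induction using (<-wellFounded)
import Data.Nat.Properties as ℕₚ
import Data.Nat.Tactic.RingSolver as ℕS
open import Data.Product using (Σ; ∃-syntax; _×_; _,_; proj₁; proj₂)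
open import Data.Rational as ℚ using (ℚ)
import Data.Rational.Properties as ℚₚ
open import Data.Rational.Solver using (module +-*-Solver)
open import Data.Rational.Unnormalised as ℚᵘ using (mkℚᵘ)
import Data.Rational.Unnormalised.Properties as ℚᵘₚ
open import Data.Sum as Sum using (_⊎_; inj₁; inj₂)
open import Data.Unit using (⊤; tt)
open import Data.Vec as Vec using (Vec)
open import Data.Vec.Functional using (_∷_)
import Data.Vec.Properties as Vecₚ
open import Function using (_∘_)
open import Function.Bundles using (mk⇔)
open import Induction.WellFounded using (Acc; acc)
import Relation.Binary.Reasoning.Setoid as SetoidReasoning
open import Relation.Binary.PropositionalEquality using (_≡_; _≢_; refl; sym; trans; cong; cong₂; subst; subst₂; module ≡-Reasoning)
open import Relation.Nullary using (¬_; Dec; yes; no)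
open import Relation.Nullary.Decidable using (map′; _×-dec_; ¬?)

open +-*-Solver using (solve; _:=_; _:+_; _:*_; :-_; _:-_; con)

-- The representatives must themselves be empty simplices, so every candidate has to be tested.
-- Interior, boundedness and emptiness quantify over infinitely many points; the test rests on the
-- identity that the slacks of any point, weighted with Δ for the first row and with τᵢ for the
-- others, add up to the constant `gap`. It turns being a simplex into the signs of the τᵢ and of
-- `gap`, and it bounds the simplex explicitly, so that emptiness becomes a finite search.
-- Candidates that fail are filtered out. Two survivors may be equivalent, which is harmless for an
-- upper bound.
--
-- Conjugating by a permutation destroys triangularity, so the normal form keeps only what survives
-- it: residues modulo the diagonal entry of the row, and the product of the diagonal. Functions are
-- compared pointwise only, which is why alternating maps, searches and candidates come with
-- congruence lemmas.
--
-- The base 2^16 of the final constant is 2^13 times 4 times 2: the 4 comes from (r + 1)^r ≤ 4^r r!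
-- with r = Δ - 1, the 2 from m + r ≤ 2 n.

module Product = MonoidSum ℕₚ.*-1-commutativeMonoid

-- Finite sums

module FinSum {c ℓ} (R : CommutativeSemiring c ℓ) where
  open CommutativeSemiring R hiding (zero) renaming (refl to ≈-refl; sym to ≈-sym; trans to ≈-trans)

  -- The sums of the statement, `sumℤ` and `sumℚ`, are separate recursions. Taking a sum to be
  -- anything that satisfies the two recursion equations lets the library's lemmas about `sum` serve
  -- both.
  module Over (S : ∀ {n} → (Fin n → Carrier) → Carrier)
    (S-zero : ∀ f → S {zero} f ≈ 0#)
    (S-suc : ∀ {n} f → S {suc n} f ≈ f zero + S (λ i → f (suc i))) where

    open SemiringSum semiring
      using (sum; sum-cong-≋; ∑-distrib-+; ∑-comm; *-distribˡ-sum; *-distribʳ-sum; sum-remove)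
    open SetoidReasoning setoid

    S≈sum : ∀ {n} (f : Fin n → Carrier) → S f ≈ sum f
    S≈sum {zero}  f = S-zero f
    S≈sum {suc n} f = ≈-trans (S-suc f) (+-congˡ (S≈sum (λ i → f (suc i))))

    sum≈S : ∀ {n} (f : Fin n → Carrier) → sum f ≈ S f
    sum≈S f = ≈-sym (S≈sum f)

    S-cong : ∀ {n} {f g : Fin n → Carrier} → (∀ i → f i ≈ g i) → S f ≈ S g
    S-cong {f = f} {g} e = ≈-trans (S≈sum f) (≈-trans (sum-cong-≋ e) (sum≈S g))

    S-+ : ∀ {n} (f g : Fin n → Carrier) → S (λ i → f i + g i) ≈ S f + S g
    S-+ f g = ≈-trans (S≈sum _) (≈-trans (∑-distrib-+ f g) (+-cong (sum≈S f) (sum≈S g)))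

    S-*ˡ : ∀ {n} x (f : Fin n → Carrier) → x * S f ≈ S (λ i → x * f i)
    S-*ˡ x f = ≈-trans (*-congˡ (S≈sum f)) (≈-trans (*-distribˡ-sum x f) (sum≈S _))

    S-*ʳ : ∀ {n} x (f : Fin n → Carrier) → S f * x ≈ S (λ i → f i * x)
    S-*ʳ x f = ≈-trans (*-congʳ (S≈sum f)) (≈-trans (*-distribʳ-sum x f) (sum≈S _))

    S-comm : ∀ {m n} (f : Fin m → Fin n → Carrier) →
             S (λ i → S (λ j → f i j)) ≈ S (λ j → S (λ i → f i j))
    S-comm f = begin
      S (λ i → S (f i))             ≈⟨ S-cong (λ i → S≈sum (f i)) ⟩
      S (λ i → sum (f i))           ≈⟨ S≈sum _ ⟩
      sum (λ i → sum (f i))         ≈⟨ ∑-comm f ⟩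
      sum (λ j → sum (λ i → f i j)) ≈⟨ sum≈S _ ⟩
      S (λ j → sum (λ i → f i j))   ≈⟨ S-cong (λ j → sum≈S (λ i → f i j)) ⟩
      S (λ j → S (λ i → f i j))     ∎

    S-remove : ∀ {n} i (f : Fin (suc n) → Carrier) → S f ≈ f i + S (λ j → f (punchIn i j))
    S-remove i f = ≈-trans (S≈sum f) (≈-trans (sum-remove {i = i} f) (+-congˡ (sum≈S _)))

    S-0 : ∀ {n} (f : Fin n → Carrier) → (∀ i → f i ≈ 0#) → S f ≈ 0#
    S-0 {zero}  f e = S-zero f
    S-0 {suc n} f e = begin
      S f                          ≈⟨ S-suc f ⟩
      f zero + S (λ i → f (suc i)) ≈⟨ +-cong (e zero) (S-0 _ (λ i → e (suc i))) ⟩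
      0# + 0#                      ≈⟨ +-identityˡ 0# ⟩
      0#                           ∎

    S-single : ∀ {n} i (f : Fin n → Carrier) → (∀ j → j ≢ i → f j ≈ 0#) → S f ≈ f i
    S-single {suc n} i f e = begin
      S f                            ≈⟨ S-remove i f ⟩
      f i + S (λ j → f (punchIn i j)) ≈⟨ +-congˡ (S-0 _ (λ j → e _ (Finₚ.punchInᵢ≢i i j))) ⟩
      f i + 0#                       ≈⟨ +-identityʳ _ ⟩
      f i                            ∎

    S-split : ∀ m {k} (f : Fin (m ℕ.+ k) → Carrier) →
              S f ≈ S (λ i → f (i ↑ˡ k)) + S (λ i → f (m ↑ʳ i))
    S-split zero {k} f = begin
      S f                             ≈⟨ +-identityˡ _ ⟨
      0# + S f                        ≈⟨ +-congʳ (S-zero _) ⟨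
      S (λ i → f (i ↑ˡ k)) + S f      ∎
    S-split (suc m) {k} f = begin
      S f                              ≈⟨ S-suc f ⟩
      f zero + S (λ i → f (suc i))     ≈⟨ +-congˡ (S-split m (λ i → f (suc i))) ⟩
      f zero + (S (λ i → f (suc (i ↑ˡ k))) + S (λ i → f (suc (m ↑ʳ i)))) ≈⟨ +-assoc _ _ _ ⟨
      f zero + S (λ i → f (suc (i ↑ˡ k))) + S (λ i → f (suc (m ↑ʳ i)))   ≈⟨ +-congʳ (S-suc _) ⟨
      S (λ i → f (i ↑ˡ k)) + S (λ i → f (suc m ↑ʳ i))                    ∎

    -- Exchange of the order of summation. This one identity yields associativity of matrix products
    -- and their action on row vectors, column vectors and rational points.
    S-assoc : ∀ {m n} (a : Fin m → Carrier) (w : Fin m → Fin n → Carrier) (y : Fin n → Carrier) →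
              S (λ l → a l * S (λ j → w l j * y j)) ≈ S (λ j → S (λ l → a l * w l j) * y j)
    S-assoc a w y = begin
      S (λ l → a l * S (λ j → w l j * y j))   ≈⟨ S-cong (λ l → S-*ˡ (a l) _) ⟩
      S (λ l → S (λ j → a l * (w l j * y j))) ≈⟨ S-comm _ ⟩
      S (λ j → S (λ l → a l * (w l j * y j))) ≈⟨ S-cong (λ j → S-cong (λ l → ≈-sym (*-assoc _ _ _))) ⟩
      S (λ j → S (λ l → a l * w l j * y j))   ≈⟨ S-cong (λ j → S-*ʳ (y j) _) ⟨
      S (λ j → S (λ l → a l * w l j) * y j)   ∎

module Zs = FinSum.Over ℤₚ.+-*-commutativeSemiring sumℤ (λ _ → refl) (λ _ → refl)

-- Determinants

Ext : ∀ {m n} → (Mat ℤ n m → ℤ) → Set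
Ext f = ∀ {v w} → (∀ i j → v i j ≡ w i j) → f v ≡ f w

-- Multilinear alternating functions of n rows, by recursion on n: only the first row is
-- required to be linear and only the first two to be alternating, but for every fixing of the preceding rows.
isAlt : ∀ {m} n → (Mat ℤ n m → ℤ) → Set
AltHead : ∀ {m} n → (Mat ℤ (suc n) m → ℤ) → Set
LinHead : ∀ {m n} → (Mat ℤ (suc n) m → ℤ) → Set

LinHead f = ∀ a x y t → f ((λ j → a ℤ.* x j ℤ.+ y j) ∷ t) ≡ a ℤ.* f (x ∷ t) ℤ.+ f (y ∷ t)
AltHead zero    f = ⊤
AltHead (suc n) f = ∀ x t → f (x ∷ x ∷ t) ≡ + 0
isAlt zero    f = Ext f
isAlt (suc n) f = Ext f × LinHead f × (∀ x → isAlt n (λ t → f (x ∷ t))) × AltHead n f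

∷-cong : ∀ {m n} {x y : Fin m → ℤ} {s t : Mat ℤ n m} → (∀ j → x j ≡ y j) → (∀ i j → s i j ≡ t i j) →
         ∀ i j → (x ∷ s) i j ≡ (y ∷ t) i j
∷-cong e e' zero    = e
∷-cong e e' (suc i) = e' i

∷-η : ∀ {m n} (M : Mat ℤ (suc n) m) → ∀ i j → (M zero ∷ (M ∘ suc)) i j ≡ M i j
∷-η M zero    j = refl
∷-η M (suc i) j = refl

alt-ext : ∀ {m} n {f : Mat ℤ n m → ℤ} → isAlt n f → Ext f
alt-ext zero    a = a
alt-ext (suc n) a = proj₁ a

alt-resp : ∀ {m} n {f g : Mat ℤ n m → ℤ} → (∀ t → f t ≡ g t) → isAlt n f → isAlt n g
alt-resp zero e a p = trans (sym (e _)) (trans (a p) (e _))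
alt-resp (suc n) {f} {g} e (ext , lin , tl , alt) =
  (λ p → trans (sym (e _)) (trans (ext p) (e _))) ,
  (λ a x y t → trans (sym (e _)) (trans (lin a x y t) (cong₂ (λ u v → a ℤ.* u ℤ.+ v) (e _) (e _)))) ,
  (λ x → alt-resp n (λ t → e (x ∷ t)) (tl x)) ,
  hd n e alt
  where
  hd : ∀ n {f g : Mat ℤ (suc n) _ → ℤ} → (∀ t → f t ≡ g t) → AltHead n f → AltHead n g
  hd zero    e a     = tt
  hd (suc n) e a x t = trans (sym (e _)) (a x t)

alt-sum : ∀ {m} n {p} (c : Fin p → ℤ) (f : Fin p → Mat ℤ n m → ℤ) → (∀ j → isAlt n (f j)) →
          isAlt n (λ t → sumℤ (λ j → c j ℤ.* f j t))
alt-sum zero c f a e = Zs.S-cong (λ j → cong (c j ℤ.*_) (a j e))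
alt-sum (suc n) c f a =
  (λ e → Zs.S-cong (λ j → cong (c j ℤ.*_) (proj₁ (a j) e))) ,
  (λ b x y t → trans (Zs.S-cong (λ j → trans (cong (c j ℤ.*_) (proj₁ (proj₂ (a j)) b x y t))
                                            (rearrange (c j) b _ _)))
               (trans (Zs.S-+ (λ j → b ℤ.* (c j ℤ.* f j (x ∷ t))) (λ j → c j ℤ.* f j (y ∷ t)))
                      (cong (ℤ._+ _) (sym (Zs.S-*ˡ b (λ j → c j ℤ.* f j (x ∷ t))))))) ,
  (λ x → alt-sum n c (λ j t → f j (x ∷ t)) (λ j → proj₁ (proj₂ (proj₂ (a j))) x)) ,
  hd n f (λ j → proj₂ (proj₂ (proj₂ (a j))))
  where
  rearrange : ∀ c b u v → c ℤ.* (b ℤ.* u ℤ.+ v) ≡ b ℤ.* (c ℤ.* u) ℤ.+ c ℤ.* v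
  rearrange = ℤS.solve-∀
  hd : ∀ n (f : Fin _ → Mat ℤ (suc n) _ → ℤ) → (∀ j → AltHead n (f j)) →
       AltHead n (λ t → sumℤ (λ j → c j ℤ.* f j t))
  hd zero    f a     = tt
  hd (suc n) f a x t = Zs.S-0 _ (λ j → trans (cong (c j ℤ.*_) (a j x t)) (ℤₚ.*-zeroʳ (c j)))

alt-columns : ∀ {m m'} n (ρ : Fin m' → Fin m) (f : Mat ℤ n m' → ℤ) → isAlt n f →
              isAlt n (λ t → f (λ r c → t r (ρ c)))
alt-columns zero ρ f a e = a (λ i j → e i (ρ j))
alt-columns (suc n) ρ f (ext , lin , tl , alt) =
  (λ e → ext (λ i j → e i (ρ j))) ,
  (λ a x y t → trans (ext (λ { zero j → refl ; (suc i) j → refl }))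
    (trans (lin a (x ∘ ρ) (y ∘ ρ) (λ r c → t r (ρ c)))
      (cong₂ (λ u v → a ℤ.* u ℤ.+ v) (ext (λ { zero j → refl ; (suc i) j → refl }))
                                      (ext (λ { zero j → refl ; (suc i) j → refl }))))) ,
  (λ x → alt-resp n (λ t → ext (λ { zero j → refl ; (suc i) j → refl }))
                    (alt-columns n ρ (λ t → f ((x ∘ ρ) ∷ t)) (tl (x ∘ ρ)))) ,
  hd n f ext alt
  where
  hd : ∀ n (f : Mat ℤ (suc n) _ → ℤ) → Ext f → AltHead n f → AltHead n (λ t → f (λ r c → t r (ρ c)))
  hd zero f ext a = tt
  hd (suc n) f ext a x t =
    trans (ext (λ { zero j → refl ; (suc zero) j → refl ; (suc (suc i)) j → refl })) (a (x ∘ ρ) (λ r c → t r (ρ c)))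

sign-suc : ∀ k → sign (suc k) ≡ ℤ.- sign k
sign-suc zero          = refl
sign-suc (suc zero)    = refl
sign-suc (suc (suc k)) = sign-suc k

-- For a ≤ b the columns a and b + 1 can be deleted in two orders: `inject₁ a` and then `b`, or
-- `suc b` and then `a`. This lemma and the next two say that both orders meet the same pair of
-- columns and leave the same rest.
punchIn-≤ : ∀ {n} {a b : Fin (suc n)} → toℕ a ℕ.≤ toℕ b → punchIn (inject₁ a) b ≡ suc b
punchIn-≤ {_}     {zero}  {b}     _          = refl
punchIn-≤ {suc n} {suc a} {suc b} (ℕ.s≤s le) = cong suc (punchIn-≤ {n} le)

punchIn-> : ∀ {n} {a b : Fin (suc n)} → toℕ a ℕ.≤ toℕ b → punchIn (suc b) a ≡ inject₁ a
punchIn-> {_}     {zero}  {b}     _          = refl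
punchIn-> {suc n} {suc a} {suc b} (ℕ.s≤s le) = cong suc (punchIn-> {n} le)

punchIn-comm : ∀ {n} {a b : Fin (suc n)} → toℕ a ℕ.≤ toℕ b → ∀ c →
               punchIn (inject₁ a) (punchIn b c) ≡ punchIn (suc b) (punchIn a c)
punchIn-comm {_}     {zero}  {b}     _          c       = refl
punchIn-comm {suc n} {suc a} {suc b} (ℕ.s≤s le) zero    = refl
punchIn-comm {suc n} {suc a} {suc b} (ℕ.s≤s le) (suc c) = cong suc (punchIn-comm {n} le c)

-- The index pairs are ordered pairs of distinct columns, and the hypothesis is antisymmetry under
-- exchanging the two. Row `zero` of `G` cancels column `zero` of the remaining rows, and what is
-- left is an instance of smaller size.
antisym-sum : ∀ n (G : Fin (suc (suc n)) → Fin (suc n) → ℤ) →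
  (∀ a b → toℕ a ℕ.≤ toℕ b → G (inject₁ a) b ≡ ℤ.- G (suc b) a) →
  sumℤ (λ j → sumℤ (G j)) ≡ + 0
antisym-sum n G e = begin
  sumℤ (G zero) ℤ.+ sumℤ (λ j → sumℤ (G (suc j)))
    ≡⟨ cong₂ ℤ._+_ (trans (Zs.S-cong (λ b → trans (e zero b ℕ.z≤n) (sym (ℤₚ.-1*i≡-i _)))) (sym (Zs.S-*ˡ (ℤ.- + 1) (λ j → G (suc j) zero))))
                   (Zs.S-+ (λ j → G (suc j) zero) (λ j → sumℤ (λ k → G (suc j) (suc k)))) ⟩
  ℤ.- + 1 ℤ.* X ℤ.+ (X ℤ.+ sumℤ (λ j → sumℤ (λ k → G (suc j) (suc k))))
    ≡⟨ cong (λ z → ℤ.- + 1 ℤ.* X ℤ.+ (X ℤ.+ z)) (rest n G e) ⟩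
  ℤ.- + 1 ℤ.* X ℤ.+ (X ℤ.+ + 0)
    ≡⟨ cancel X ⟩
  + 0 ∎
  where
  open ≡-Reasoning
  X = sumℤ (λ j → G (suc j) zero)
  cancel : ∀ x → ℤ.- + 1 ℤ.* x ℤ.+ (x ℤ.+ + 0) ≡ + 0
  cancel = ℤS.solve-∀
  rest : ∀ n (G : Fin (suc (suc n)) → Fin (suc n) → ℤ) →
    (∀ a b → toℕ a ℕ.≤ toℕ b → G (inject₁ a) b ≡ ℤ.- G (suc b) a) →
    sumℤ (λ j → sumℤ (λ k → G (suc j) (suc k))) ≡ + 0
  rest zero    G e = refl
  rest (suc n) G e = antisym-sum n (λ j k → G (suc j) (suc k)) (λ a b le → e (suc a) (suc b) (ℕ.s≤s le))

-- Alternation is the only point beyond linearity of the expansion: expand along both of the two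
-- equal first rows; the same two columns taken in opposite order give the same minor with opposite
-- sign.
det-alt : ∀ n → isAlt n (det n)
det-alt zero e = refl
det-alt (suc n) = ext , lin , tl , hd n
  where
  minor : ∀ n → Fin (suc n) → Mat ℤ n (suc n) → ℤ
  minor n j t = det n (λ r c → t r (punchIn j c))
  minor-alt : ∀ j → isAlt n (minor n j)
  minor-alt j = alt-columns n (punchIn j) (det n) (det-alt n)
  ext : Ext (det (suc n))
  ext e = Zs.S-cong (λ j → cong₂ (λ u v → sign (toℕ j) ℤ.* (u ℤ.* v)) (e zero j)
                                 (alt-ext n (minor-alt j) (λ r c → e (suc r) c)))
  rearrange : ∀ s a x y d → s ℤ.* ((a ℤ.* x ℤ.+ y) ℤ.* d) ≡ a ℤ.* (s ℤ.* (x ℤ.* d)) ℤ.+ s ℤ.* (y ℤ.* d)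
  rearrange = ℤS.solve-∀
  lin : LinHead (det (suc n))
  lin a x y t = trans (Zs.S-cong (λ j → rearrange (sign (toℕ j)) a (x j) (y j) (minor n j t)))
                (trans (Zs.S-+ (λ j → a ℤ.* (sign (toℕ j) ℤ.* (x j ℤ.* minor n j t))) (λ j → sign (toℕ j) ℤ.* (y j ℤ.* minor n j t)))
                       (cong (ℤ._+ det (suc n) (y ∷ t)) (sym (Zs.S-*ˡ a (λ j → sign (toℕ j) ℤ.* (x j ℤ.* minor n j t))))))
  tl : ∀ x → isAlt n (λ t → det (suc n) (x ∷ t))
  tl x = alt-resp n (λ t → Zs.S-cong (λ j → ℤₚ.*-assoc (sign (toℕ j)) (x j) (minor n j t)))
           (alt-sum n (λ j → sign (toℕ j) ℤ.* x j) (minor n) minor-alt)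
  hd : ∀ n → AltHead n (det (suc n))
  hd zero = tt
  hd (suc n) x t = trans
    (Zs.S-cong (λ j → trans (sym (ℤₚ.*-assoc (sign (toℕ j)) (x j) (det (suc n) (λ r c → (x ∷ t) r (punchIn j c)))))
                            (Zs.S-*ˡ (sign (toℕ j) ℤ.* x j) (λ k → sign (toℕ k) ℤ.* (x (punchIn j k) ℤ.* D j k)))))
    (antisym-sum n G flip)
    where
    D : Fin (suc (suc n)) → Fin (suc n) → ℤ
    D j k = det n (λ r c → t r (punchIn j (punchIn k c)))
    G : Fin (suc (suc n)) → Fin (suc n) → ℤ
    G j k = sign (toℕ j) ℤ.* x j ℤ.* (sign (toℕ k) ℤ.* (x (punchIn j k) ℤ.* D j k))
    swap : ∀ s s' u v d → s ℤ.* u ℤ.* (s' ℤ.* (v ℤ.* d)) ≡ ℤ.- (ℤ.- s' ℤ.* v ℤ.* (s ℤ.* (u ℤ.* d)))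
    swap = ℤS.solve-∀
    flip : ∀ a b → toℕ a ℕ.≤ toℕ b → G (inject₁ a) b ≡ ℤ.- G (suc b) a
    flip a b le = begin
      sign (toℕ (inject₁ a)) ℤ.* x (inject₁ a) ℤ.* (sign (toℕ b) ℤ.* (x (punchIn (inject₁ a) b) ℤ.* D (inject₁ a) b))
        ≡⟨ cong₂ (λ i j → sign i ℤ.* x (inject₁ a) ℤ.* (sign (toℕ b) ℤ.* (x j ℤ.* D (inject₁ a) b)))
                 (Finₚ.toℕ-inject₁ a) (punchIn-≤ le) ⟩
      sign (toℕ a) ℤ.* x (inject₁ a) ℤ.* (sign (toℕ b) ℤ.* (x (suc b) ℤ.* D (inject₁ a) b))
        ≡⟨ swap (sign (toℕ a)) (sign (toℕ b)) (x (inject₁ a)) (x (suc b)) (D (inject₁ a) b) ⟩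
      ℤ.- (ℤ.- sign (toℕ b) ℤ.* x (suc b) ℤ.* (sign (toℕ a) ℤ.* (x (inject₁ a) ℤ.* D (inject₁ a) b)))
        ≡⟨ cong ℤ.-_ (cong₂ ℤ._*_ (cong (ℤ._* x (suc b)) (sym (sign-suc (toℕ b))))
             (cong (sign (toℕ a) ℤ.*_) (cong₂ ℤ._*_ (cong x (sym (punchIn-> le)))
               (alt-ext n (det-alt n) (λ r c → cong (t r) (punchIn-comm le c)))))) ⟩
      ℤ.- G (suc b) a ∎
      where open ≡-Reasoning

-- Matrix products and multiplicativity of the determinant

infixl 7 _⊗_
_⊗_ : ∀ {m n p} → Mat ℤ m n → Mat ℤ n p → Mat ℤ m p
(A ⊗ B) i j = sumℤ (λ k → A i k ℤ.* B k j)

alt-zero : ∀ {m n} {f : Mat ℤ (suc n) m → ℤ} → isAlt (suc n) f → ∀ t → f ((λ _ → + 0) ∷ t) ≡ + 0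
alt-zero {f = f} (ext , lin , _) t = trans (lin (ℤ.- + 1) (λ _ → + 0) (λ _ → + 0) t) (cancel (f ((λ _ → + 0) ∷ t)))
  where
  cancel : ∀ x → ℤ.- + 1 ℤ.* x ℤ.+ x ≡ + 0
  cancel = ℤS.solve-∀

alt-lincomb : ∀ {m n} {f : Mat ℤ (suc n) m → ℤ} → isAlt (suc n) f → ∀ {p} (a : Fin p → ℤ) (u : Mat ℤ p m) t →
              f ((λ j → sumℤ (λ k → a k ℤ.* u k j)) ∷ t) ≡ sumℤ (λ k → a k ℤ.* f (u k ∷ t))
alt-lincomb al {zero} a u t = alt-zero al t
alt-lincomb {f = f} al@(ext , lin , _) {suc p} a u t =
  trans (lin (a zero) (u zero) (λ j → sumℤ (λ k → a (suc k) ℤ.* u (suc k) j)) t)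
        (cong (λ z → a zero ℤ.* f (u zero ∷ t) ℤ.+ z) (alt-lincomb al (a ∘ suc) (u ∘ suc) t))

-- Polarisation: expand `f (z ∷ z ∷ t)`, which vanishes, for z = x + y. The factors 1 appear because
-- linearity is stated for combinations of the form a x + y.
alt-swap : ∀ {m n} {f : Mat ℤ (suc (suc n)) m → ℤ} → isAlt (suc (suc n)) f → ∀ x y t →
           f (x ∷ y ∷ t) ≡ ℤ.- f (y ∷ x ∷ t)
alt-swap {f = f} (ext , lin , tl , alt) x y t = begin
  f (x ∷ y ∷ t)
    ≡⟨ expand (f (x ∷ y ∷ t)) (f (y ∷ x ∷ t)) ⟩
  + 1 ℤ.* (+ 1 ℤ.* + 0 ℤ.+ f (x ∷ y ∷ t)) ℤ.+ (+ 1 ℤ.* f (y ∷ x ∷ t) ℤ.+ + 0) ℤ.- f (y ∷ x ∷ t)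
    ≡⟨ cong₂ (λ a b → + 1 ℤ.* (+ 1 ℤ.* a ℤ.+ f (x ∷ y ∷ t)) ℤ.+ (+ 1 ℤ.* f (y ∷ x ∷ t) ℤ.+ b) ℤ.- f (y ∷ x ∷ t)) (alt x t) (alt y t) ⟨
  + 1 ℤ.* (+ 1 ℤ.* f (x ∷ x ∷ t) ℤ.+ f (x ∷ y ∷ t)) ℤ.+ (+ 1 ℤ.* f (y ∷ x ∷ t) ℤ.+ f (y ∷ y ∷ t)) ℤ.- f (y ∷ x ∷ t)
    ≡⟨ cong₂ (λ a b → + 1 ℤ.* a ℤ.+ b ℤ.- f (y ∷ x ∷ t)) (proj₁ (proj₂ (tl x)) (+ 1) x y t) (proj₁ (proj₂ (tl y)) (+ 1) x y t) ⟨
  + 1 ℤ.* f (x ∷ z ∷ t) ℤ.+ f (y ∷ z ∷ t) ℤ.- f (y ∷ x ∷ t)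
    ≡⟨ cong (ℤ._- f (y ∷ x ∷ t)) (lin (+ 1) x y (z ∷ t)) ⟨
  f (z ∷ z ∷ t) ℤ.- f (y ∷ x ∷ t)
    ≡⟨ cong (ℤ._- f (y ∷ x ∷ t)) (alt z t) ⟩
  + 0 ℤ.- f (y ∷ x ∷ t)
    ≡⟨ ℤₚ.+-identityˡ _ ⟩
  ℤ.- f (y ∷ x ∷ t) ∎
  where
  open ≡-Reasoning
  z = λ j → + 1 ℤ.* x j ℤ.+ y j
  expand : ∀ a b → a ≡ + 1 ℤ.* (+ 1 ℤ.* + 0 ℤ.+ a) ℤ.+ (+ 1 ℤ.* b ℤ.+ + 0) ℤ.- b
  expand = ℤS.solve-∀

-- Only the first two rows are known to alternate. A swap brings the head of `u` to the front, where
-- it is held fixed while the repeated row descends further.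
alt-repeat : ∀ {m n} {f : Mat ℤ (suc n) m → ℤ} → isAlt (suc n) f → ∀ u l → f (u l ∷ u) ≡ + 0
alt-repeat {n = suc n} al@(ext , lin , tl , alt) u zero =
  trans (ext (∷-cong (λ _ → refl) (λ i j → sym (∷-η u i j)))) (alt (u zero) (u ∘ suc))
alt-repeat {n = suc n} {f} al@(ext , lin , tl , alt) u (suc l) = begin
  f (u (suc l) ∷ u)                  ≡⟨ ext (∷-cong (λ _ → refl) (λ i j → sym (∷-η u i j))) ⟩
  f (u (suc l) ∷ u zero ∷ (u ∘ suc)) ≡⟨ alt-swap al (u (suc l)) (u zero) (u ∘ suc) ⟩
  ℤ.- f (u zero ∷ u (suc l) ∷ (u ∘ suc)) ≡⟨ cong ℤ.-_ (alt-repeat (tl (u zero)) (u ∘ suc) l) ⟩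
  + 0 ∎
  where open ≡-Reasoning

-- Row k passes the k rows above it, one swap and one change of sign for each.
alt-move : ∀ {m n} {f : Mat ℤ (suc n) m → ℤ} → isAlt (suc n) f → ∀ B k →
           f (B k ∷ (λ r → B (punchIn k r))) ≡ sign (toℕ k) ℤ.* f B
alt-move al B zero = trans (proj₁ al (∷-η B)) (sym (ℤₚ.*-identityˡ _))
alt-move {n = suc n} {f} al@(ext , lin , tl , alt) B (suc k) = begin
  f (B (suc k) ∷ (λ r → B (punchIn (suc k) r)))
    ≡⟨ ext (∷-cong (λ _ → refl) (λ i j → sym (∷-η (λ r → B (punchIn (suc k) r)) i j))) ⟩
  f (B (suc k) ∷ B zero ∷ (λ r → B (suc (punchIn k r))))
    ≡⟨ alt-swap al _ _ _ ⟩
  ℤ.- f (B zero ∷ B (suc k) ∷ (λ r → B (suc (punchIn k r))))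
    ≡⟨ cong ℤ.-_ (alt-move (tl (B zero)) (B ∘ suc) k) ⟩
  ℤ.- (sign (toℕ k) ℤ.* f (B zero ∷ (B ∘ suc)))
    ≡⟨ ℤₚ.neg-distribˡ-* (sign (toℕ k)) (f (B zero ∷ (B ∘ suc))) ⟩
  ℤ.- sign (toℕ k) ℤ.* f (B zero ∷ (B ∘ suc))
    ≡⟨ cong₂ ℤ._*_ (sym (sign-suc (toℕ k))) (ext (∷-η B)) ⟩
  sign (toℕ (suc k)) ℤ.* f B ∎
  where open ≡-Reasoning

alt-add : ∀ {m n} {f : Mat ℤ (suc n) m → ℤ} → isAlt (suc n) f → ∀ u (α : Fin n → ℤ) v →
          f (u ∷ (λ i j → α i ℤ.* u j ℤ.+ v i j)) ≡ f (u ∷ v)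
alt-add {n = zero} al u α v = proj₁ al (∷-cong (λ _ → refl) (λ ()))
alt-add {n = suc n} {f} al@(ext , lin , tl , alt) u α v = begin
  f (u ∷ w)                         ≡⟨ ext (∷-cong (λ _ → refl) (λ i j → sym (∷-η w i j))) ⟩
  f (u ∷ w zero ∷ (w ∘ suc))        ≡⟨ proj₁ (proj₂ (tl u)) (α zero) u (v zero) (w ∘ suc) ⟩
  α zero ℤ.* f (u ∷ u ∷ (w ∘ suc)) ℤ.+ f (u ∷ v zero ∷ (w ∘ suc))
    ≡⟨ cong (λ z → α zero ℤ.* z ℤ.+ f (u ∷ v zero ∷ (w ∘ suc))) (alt u (w ∘ suc)) ⟩
  α zero ℤ.* + 0 ℤ.+ f (u ∷ v zero ∷ (w ∘ suc))
    ≡⟨ cong (ℤ._+ f (u ∷ v zero ∷ (w ∘ suc))) (ℤₚ.*-zeroʳ (α zero)) ⟩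
  + 0 ℤ.+ f (u ∷ v zero ∷ (w ∘ suc)) ≡⟨ ℤₚ.+-identityˡ _ ⟩
  f (u ∷ v zero ∷ (w ∘ suc))        ≡⟨ alt-swap al _ _ _ ⟩
  ℤ.- f (v zero ∷ u ∷ (w ∘ suc))    ≡⟨ cong ℤ.-_ (alt-add (tl (v zero)) u (α ∘ suc) (v ∘ suc)) ⟩
  ℤ.- f (v zero ∷ u ∷ (v ∘ suc))    ≡⟨ alt-swap al _ _ _ ⟨
  f (u ∷ v zero ∷ (v ∘ suc))        ≡⟨ ext (∷-cong (λ _ → refl) (∷-η v)) ⟩
  f (u ∷ v) ∎
  where
  open ≡-Reasoning
  w : Mat ℤ (suc n) _
  w i j = α i ℤ.* u j ℤ.+ v i j

-- An alternating multilinear function is determined by its value at one point: expand the first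
-- row of A ⊗ B and clear the row B k from all the others.
alt-mul : ∀ {m} n {f : Mat ℤ n m → ℤ} → isAlt n f → ∀ A B → f (A ⊗ B) ≡ det n A ℤ.* f B
alt-mul zero al A B = trans (al (λ ())) (sym (ℤₚ.*-identityˡ _))
alt-mul (suc n) {f} al@(ext , lin , tl , alt) A B = begin
  f (A ⊗ B)
    ≡⟨ ext (λ i j → sym (∷-η (A ⊗ B) i j)) ⟩
  f ((λ j → sumℤ (λ k → A zero k ℤ.* B k j)) ∷ (A' ⊗ B))
    ≡⟨ alt-lincomb al (A zero) B (A' ⊗ B) ⟩
  sumℤ (λ k → A zero k ℤ.* f (B k ∷ (A' ⊗ B)))
    ≡⟨ Zs.S-cong term ⟩
  sumℤ (λ k → sign (toℕ k) ℤ.* (A zero k ℤ.* minor k) ℤ.* f B)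
    ≡⟨ Zs.S-*ʳ (f B) (λ k → sign (toℕ k) ℤ.* (A zero k ℤ.* minor k)) ⟨
  det (suc n) A ℤ.* f B ∎
  where
  open ≡-Reasoning
  A' : Mat ℤ n (suc n)
  A' = A ∘ suc
  minor : Fin (suc n) → ℤ
  minor k = det n (λ r c → A (suc r) (punchIn k c))
  rearrange : ∀ a d s v → a ℤ.* (d ℤ.* (s ℤ.* v)) ≡ s ℤ.* (a ℤ.* d) ℤ.* v
  rearrange = ℤS.solve-∀
  term : ∀ k → A zero k ℤ.* f (B k ∷ (A' ⊗ B)) ≡ sign (toℕ k) ℤ.* (A zero k ℤ.* minor k) ℤ.* f B
  term k = begin
    A zero k ℤ.* f (B k ∷ (A' ⊗ B))
      ≡⟨ cong (A zero k ℤ.*_) (ext (∷-cong (λ _ → refl) (λ i j → Zs.S-remove k (λ l → A' i l ℤ.* B l j)))) ⟩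
    A zero k ℤ.* f (B k ∷ (λ i j → A' i k ℤ.* B k j ℤ.+ ((λ r c → A' r (punchIn k c)) ⊗ (B ∘ punchIn k)) i j))
      ≡⟨ cong (A zero k ℤ.*_) (alt-add al (B k) (λ i → A' i k) _) ⟩
    A zero k ℤ.* f (B k ∷ ((λ r c → A' r (punchIn k c)) ⊗ (B ∘ punchIn k)))
      ≡⟨ cong (A zero k ℤ.*_) (alt-mul n (tl (B k)) (λ r c → A' r (punchIn k c)) (B ∘ punchIn k)) ⟩
    A zero k ℤ.* (minor k ℤ.* f (B k ∷ (B ∘ punchIn k)))
      ≡⟨ cong (λ z → A zero k ℤ.* (minor k ℤ.* z)) (alt-move al B k) ⟩
    A zero k ℤ.* (minor k ℤ.* (sign (toℕ k) ℤ.* f B))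
      ≡⟨ rearrange (A zero k) (minor k) (sign (toℕ k)) (f B) ⟩
    sign (toℕ k) ℤ.* (A zero k ℤ.* minor k) ℤ.* f B ∎

det-⊗ : ∀ n (A B : Mat ℤ n n) → det n (A ⊗ B) ≡ det n A ℤ.* det n B
det-⊗ n = alt-mul n (det-alt n)

det-cong : ∀ n {A B : Mat ℤ n n} → (∀ i j → A i j ≡ B i j) → det n A ≡ det n B
det-cong n = alt-ext n (det-alt n)

δ : ∀ {n} → Mat ℤ n n
δ zero    zero    = + 1
δ zero    (suc j) = + 0
δ (suc i) zero    = + 0
δ (suc i) (suc j) = δ i j

δ-≡ : ∀ {n} (i : Fin n) → δ i i ≡ + 1
δ-≡ zero    = refl
δ-≡ (suc i) = δ-≡ i

δ-≢ : ∀ {n} (i j : Fin n) → i ≢ j → δ i j ≡ + 0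
δ-≢ zero    zero    i≢j = ⊥-elim (i≢j refl)
δ-≢ zero    (suc j) i≢j = refl
δ-≢ (suc i) zero    i≢j = refl
δ-≢ (suc i) (suc j) i≢j = δ-≢ i j (i≢j ∘ cong suc)

⊗-assoc : ∀ {m n p q} (A : Mat ℤ m n) (B : Mat ℤ n p) (C : Mat ℤ p q) →
          ∀ i j → (A ⊗ (B ⊗ C)) i j ≡ ((A ⊗ B) ⊗ C) i j
⊗-assoc A B C i j = Zs.S-assoc (A i) B (λ k → C k j)

⊗-identityʳ : ∀ {m n} (A : Mat ℤ m n) → ∀ i j → (A ⊗ δ) i j ≡ A i j
⊗-identityʳ A i j = trans
  (Zs.S-single j (λ k → A i k ℤ.* δ k j) (λ k k≢j → trans (cong (A i k ℤ.*_) (δ-≢ k j k≢j)) (ℤₚ.*-zeroʳ (A i k))))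
  (trans (cong (A i j ℤ.*_) (δ-≡ j)) (ℤₚ.*-identityʳ _))

⊗-identityˡ : ∀ {m n} (A : Mat ℤ m n) → ∀ i j → (δ ⊗ A) i j ≡ A i j
⊗-identityˡ A i j = trans
  (Zs.S-single i (λ k → δ i k ℤ.* A k j) (λ k k≢i → cong (ℤ._* A k j) (δ-≢ i k (k≢i ∘ sym))))
  (trans (cong (ℤ._* A i j) (δ-≡ i)) (ℤₚ.*-identityˡ _))

⊗-cong : ∀ {m n p} {A A' : Mat ℤ m n} {B B' : Mat ℤ n p} →
         (∀ i j → A i j ≡ A' i j) → (∀ i j → B i j ≡ B' i j) → ∀ i j → (A ⊗ B) i j ≡ (A' ⊗ B') i j
⊗-cong e e' i j = Zs.S-cong (λ k → cong₂ ℤ._*_ (e i k) (e' k j))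

det-head : ∀ n (M : Mat ℤ (suc n) (suc n)) → (∀ j → M zero (suc j) ≡ + 0) →
           det (suc n) M ≡ M zero zero ℤ.* det n (λ r c → M (suc r) (suc c))
det-head n M e = begin
  + 1 ℤ.* (M zero zero ℤ.* D zero) ℤ.+ sumℤ (λ j → sign (toℕ (suc j)) ℤ.* (M zero (suc j) ℤ.* D (suc j)))
    ≡⟨ cong₂ ℤ._+_ (ℤₚ.*-identityˡ (M zero zero ℤ.* D zero)) (Zs.S-0 _ (λ j →
         trans (cong (λ z → sign (toℕ (suc j)) ℤ.* (z ℤ.* D (suc j))) (e j)) (ℤₚ.*-zeroʳ (sign (toℕ (suc j)))))) ⟩
  M zero zero ℤ.* D zero ℤ.+ + 0
    ≡⟨ ℤₚ.+-identityʳ (M zero zero ℤ.* D zero) ⟩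
  M zero zero ℤ.* D zero ∎
  where
  open ≡-Reasoning
  D : Fin (suc n) → ℤ
  D j = det n (λ r c → M (suc r) (punchIn j c))

det-δ : ∀ n → det n δ ≡ + 1
det-δ zero    = refl
det-δ (suc n) = trans (det-head n δ (λ _ → refl)) (trans (ℤₚ.*-identityˡ _) (det-δ n))

-- Invertible integer matrices and the Hermite normal form

mv : ∀ {m n} → Mat ℤ m n → (Fin n → ℤ) → Fin m → ℤ
mv M x i = sumℤ (λ k → M i k ℤ.* x k)

vm : ∀ {m n} → (Fin m → ℤ) → Mat ℤ m n → Fin n → ℤ
vm r W j = sumℤ (λ k → r k ℤ.* W k j)

-- The inverse is carried as data, so that column operations can be undone directly; that the
-- determinant is 1 or -1 is derived from it in `gl-det`.
record GL (n : ℕ) : Set where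
  field
    to   : Mat ℤ n n
    from : Mat ℤ n n
    to-from : ∀ i j → (to ⊗ from) i j ≡ δ i j
    from-to : ∀ i j → (from ⊗ to) i j ≡ δ i j
open GL

gl-inv : ∀ {n} → GL n → GL n
gl-inv W = record { to = from W ; from = to W ; to-from = from-to W ; from-to = to-from W }

gl-id : ∀ {n} → GL n
gl-id = record { to = δ ; from = δ ; to-from = ⊗-identityʳ δ ; from-to = ⊗-identityʳ δ }

⊗-cancel : ∀ {n} (A B C D : Mat ℤ n n) → (∀ i j → (A ⊗ D) i j ≡ δ i j) → (∀ i j → (B ⊗ C) i j ≡ δ i j) →
           ∀ i j → ((A ⊗ B) ⊗ (C ⊗ D)) i j ≡ δ i j
⊗-cancel A B C D AD BC i j = begin
  ((A ⊗ B) ⊗ (C ⊗ D)) i j ≡⟨ ⊗-assoc A B (C ⊗ D) i j ⟨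
  (A ⊗ (B ⊗ (C ⊗ D))) i j ≡⟨ ⊗-cong {A = A} (λ _ _ → refl) (⊗-assoc B C D) i j ⟩
  (A ⊗ ((B ⊗ C) ⊗ D)) i j ≡⟨ ⊗-cong {A = A} (λ _ _ → refl) (⊗-cong {B = D} BC (λ _ _ → refl)) i j ⟩
  (A ⊗ (δ ⊗ D)) i j       ≡⟨ ⊗-cong {A = A} (λ _ _ → refl) (⊗-identityˡ D) i j ⟩
  (A ⊗ D) i j             ≡⟨ AD i j ⟩
  δ i j                   ∎
  where open ≡-Reasoning

gl-comp : ∀ {n} → GL n → GL n → GL n
gl-comp W W' = record
  { to = to W ⊗ to W' ; from = from W' ⊗ from W
  ; to-from = ⊗-cancel (to W) (to W') (from W') (from W) (to-from W) (to-from W')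
  ; from-to = ⊗-cancel (from W') (from W) (to W) (to W') (from-to W') (from-to W) }

gl-det : ∀ {n} (W : GL n) → ∣ det n (to W) ∣ ≡ 1
gl-det {n} W = ℕₚ.m*n≡1⇒m≡1 _ ∣ det n (from W) ∣ (trans (sym (ℤₚ.abs-* (det n (to W)) (det n (from W))))
  (cong ∣_∣ (trans (sym (det-⊗ n (to W) (from W))) (trans (det-cong n (to-from W)) (det-δ n)))))

⊗-δ∘ : ∀ {m n p} (A : Mat ℤ m n) (ρ : Fin p → Fin n) → ∀ i j → (A ⊗ (λ l j → δ l (ρ j))) i j ≡ A i (ρ j)
⊗-δ∘ A ρ i j = ⊗-identityʳ A i (ρ j)

gl-perm : ∀ {n} → Permutation′ n → GL n
gl-perm π = record
  { to = λ l j → δ l (π ⟨$⟩ʳ j) ; from = λ l j → δ l (π ⟨$⟩ˡ j)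
  ; to-from = λ i j → trans (⊗-δ∘ (λ l j → δ l (π ⟨$⟩ʳ j)) (π ⟨$⟩ˡ_) i j) (cong (δ i) (Perm.inverseʳ π))
  ; from-to = λ i j → trans (⊗-δ∘ (λ l j → δ l (π ⟨$⟩ˡ j)) (π ⟨$⟩ʳ_) i j) (cong (δ i) (Perm.inverseˡ π)) }

lowerBlock : ∀ {n} → ℤ → (Fin n → ℤ) → Mat ℤ n n → Mat ℤ (suc n) (suc n)
lowerBlock a z M zero    zero    = a
lowerBlock a z M zero    (suc j) = + 0
lowerBlock a z M (suc i) zero    = z i
lowerBlock a z M (suc i) (suc j) = M i j

mv-δ : ∀ {n} (x : Fin n → ℤ) i → mv δ x i ≡ x i
mv-δ x i = ⊗-identityˡ (λ k (_ : Fin 1) → x k) i zero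

vm-⊗ : ∀ {m n p} (r : Fin m → ℤ) (W : Mat ℤ m n) (W' : Mat ℤ n p) → ∀ j → vm r (W ⊗ W') j ≡ vm (vm r W) W' j
vm-⊗ r W W' j = Zs.S-assoc r W (λ k → W' k j)

vm-lowerBlock : ∀ {n} (r : Fin (suc n) → ℤ) a z (M : Mat ℤ n n) j →
                vm r (lowerBlock a z M) (suc j) ≡ vm (r ∘ suc) M j
vm-lowerBlock r a z M j = trans (cong (ℤ._+ vm (r ∘ suc) M j) (ℤₚ.*-zeroʳ (r zero))) (ℤₚ.+-identityˡ _)

lowerBlock-inverse : ∀ {n} a → a ℤ.* a ≡ + 1 → ∀ (z z' : Fin n → ℤ) (M M' : Mat ℤ n n) →
  (∀ i j → (M ⊗ M') i j ≡ δ i j) → (∀ i → z i ℤ.* a ℤ.+ mv M z' i ≡ + 0) →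
  ∀ i j → (lowerBlock a z M ⊗ lowerBlock a z' M') i j ≡ δ i j
lowerBlock-inverse a a² z z' M M' e e' zero zero =
  trans (cong (λ w → a ℤ.* a ℤ.+ w) (Zs.S-0 (λ k → + 0 ℤ.* z' k) (λ _ → refl))) (trans (ℤₚ.+-identityʳ _) a²)
lowerBlock-inverse a a² z z' M M' e e' zero (suc j) =
  trans (vm-lowerBlock (lowerBlock a z M zero) a z' M' j) (Zs.S-0 (λ k → + 0 ℤ.* M' k j) (λ _ → refl))
lowerBlock-inverse a a² z z' M M' e e' (suc i) zero    = e' i
lowerBlock-inverse a a² z z' M M' e e' (suc i) (suc j) =
  trans (vm-lowerBlock (lowerBlock a z M (suc i)) a z' M' j) (e i j)

-- Since a is its own inverse, the inverse of the block matrix with rows (a, 0) and (z, W) has rows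
-- (a, 0) and (- W⁻¹ z a, W⁻¹).
gl-lowerBlock : ∀ {n} a → a ℤ.* a ≡ + 1 → (Fin n → ℤ) → GL n → GL (suc n)
gl-lowerBlock {n} a a² z W = record
  { to = lowerBlock a z (to W) ; from = lowerBlock a z' (from W)
  ; to-from = lowerBlock-inverse a a² z z' (to W) (from W) (to-from W) col
  ; from-to = lowerBlock-inverse a a² z' z (from W) (to W) (from-to W) col' }
  where
  open ≡-Reasoning
  z' : Fin n → ℤ
  z' i = mv (from W) z i ℤ.* (ℤ.- a)
  cancel : ∀ x y → x ℤ.* y ℤ.+ x ℤ.* ℤ.- y ≡ + 0
  cancel = ℤS.solve-∀
  cancel' : ∀ x y → x ℤ.* ℤ.- y ℤ.* y ℤ.+ x ≡ x ℤ.- x ℤ.* (y ℤ.* y)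
  cancel' = ℤS.solve-∀
  cancel'' : ∀ x → x ℤ.- x ℤ.* + 1 ≡ + 0
  cancel'' = ℤS.solve-∀
  col : ∀ i → z i ℤ.* a ℤ.+ mv (to W) z' i ≡ + 0
  col i = begin
    z i ℤ.* a ℤ.+ mv (to W) z' i
      ≡⟨ cong (λ w → z i ℤ.* a ℤ.+ w) (Zs.S-cong (λ k → sym (ℤₚ.*-assoc (to W i k) (mv (from W) z k) (ℤ.- a)))) ⟩
    z i ℤ.* a ℤ.+ sumℤ (λ k → to W i k ℤ.* mv (from W) z k ℤ.* (ℤ.- a))
      ≡⟨ cong (λ w → z i ℤ.* a ℤ.+ w) (Zs.S-*ʳ (ℤ.- a) (λ k → to W i k ℤ.* mv (from W) z k)) ⟨
    z i ℤ.* a ℤ.+ mv (to W) (mv (from W) z) i ℤ.* (ℤ.- a)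
      ≡⟨ cong (λ w → z i ℤ.* a ℤ.+ w ℤ.* (ℤ.- a)) (Zs.S-assoc (to W i) (from W) z) ⟩
    z i ℤ.* a ℤ.+ mv (to W ⊗ from W) z i ℤ.* (ℤ.- a)
      ≡⟨ cong (λ w → z i ℤ.* a ℤ.+ w ℤ.* (ℤ.- a)) (trans (Zs.S-cong (λ k → cong (ℤ._* z k) (to-from W i k))) (mv-δ z i)) ⟩
    z i ℤ.* a ℤ.+ z i ℤ.* (ℤ.- a)
      ≡⟨ cancel (z i) a ⟩
    + 0 ∎
  col' : ∀ i → z' i ℤ.* a ℤ.+ mv (from W) z i ≡ + 0
  col' i = begin
    mv (from W) z i ℤ.* ℤ.- a ℤ.* a ℤ.+ mv (from W) z i ≡⟨ cancel' (mv (from W) z i) a ⟩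
    mv (from W) z i ℤ.- mv (from W) z i ℤ.* (a ℤ.* a)   ≡⟨ cong (λ w → mv (from W) z i ℤ.- mv (from W) z i ℤ.* w) a² ⟩
    mv (from W) z i ℤ.- mv (from W) z i ℤ.* + 1         ≡⟨ cancel'' (mv (from W) z i) ⟩
    + 0 ∎

RowReduced : ∀ {n} → (Fin (suc n) → ℤ) → Set
RowReduced {n} r = ∃[ W ] (+ 0 ℤ.≤ vm r (to {suc n} W) zero) × (∀ j → vm r (to W) (suc j) ≡ + 0)

rowReduced-after : ∀ {n} (r : Fin (suc n) → ℤ) (W : GL (suc n)) r' → (∀ j → vm r (to W) j ≡ r' j) →
                   RowReduced r' → RowReduced r
rowReduced-after r W r' e (W' , nn , zs) = gl-comp W W' , subst (+ 0 ℤ.≤_) (sym (after zero)) nn , λ j → trans (after (suc j)) (zs j)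
  where
  after : ∀ j → vm r (to W ⊗ to W') j ≡ vm r' (to W') j
  after j = trans (vm-⊗ r (to W) (to W') j) (Zs.S-cong (λ k → cong (ℤ._* to W' k j) (e k)))

vm-perm : ∀ {n} (r : Fin n → ℤ) (π : Permutation′ n) j → vm r (to (gl-perm π)) j ≡ r (π ⟨$⟩ʳ j)
vm-perm r π j = ⊗-identityʳ (λ (_ : Fin 1) → r) zero (π ⟨$⟩ʳ j)

abs-≤ : ∀ x → ∃[ a ] a ℤ.* a ≡ + 1 × + 0 ℤ.≤ x ℤ.* a
abs-≤ (+ n)      = + 1 , refl , subst (+ 0 ℤ.≤_) (sym (ℤₚ.*-identityʳ (+ n))) (ℤ.+≤+ ℕ.z≤n)
abs-≤ ℤ.-[1+ n ] = ℤ.- + 1 , refl , ℤ.+≤+ ℕ.z≤n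

row-sign : ∀ {n} (r : Fin (suc n) → ℤ) → (∀ j → r (suc j) ≡ + 0) → RowReduced r
row-sign r e with abs-≤ (r zero)
... | a , a² , nn = gl-lowerBlock a a² (λ _ → + 0) gl-id ,
  subst (+ 0 ℤ.≤_) (sym (trans (cong (λ w → r zero ℤ.* a ℤ.+ w) (Zs.S-0 (λ k → r (suc k) ℤ.* + 0) (λ k → ℤₚ.*-zeroʳ (r (suc k))))) (ℤₚ.+-identityʳ _))) nn ,
  λ j → trans (vm-lowerBlock r a (λ _ → + 0) δ j) (trans (⊗-identityʳ (λ (_ : Fin 1) → r ∘ suc) zero j) (e j))

-- Euclid's algorithm on the first two entries.
row-euclid : ∀ {n} g → Acc ℕ._<_ g → (r : Fin (suc (suc n)) → ℤ) → r (suc zero) ≡ + g → (∀ j → r (suc (suc j)) ≡ + 0) → RowReduced r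
row-euclid zero _ r e e' = row-sign r (λ { zero → e ; (suc j) → e' j })
row-euclid {n} (suc g) (acc rec) r e e' =
  rowReduced-after r (gl-comp (gl-lowerBlock (+ 1) refl z gl-id) (gl-perm π)) r' step
    (row-euclid (r zero ℤD.%ℕ suc g) (rec (ℤD.n%ℕd<d (r zero) (suc g))) r' refl (λ j → e' j))
  where
  q = r zero ℤD./ℕ suc g
  π : Permutation′ (suc (suc n))
  π = Perm.transpose zero (suc zero)
  z : Fin (suc n) → ℤ
  z zero    = ℤ.- q
  z (suc _) = + 0
  r' : Fin (suc (suc n)) → ℤ
  r' zero          = r (suc zero)
  r' (suc zero)    = + (r zero ℤD.%ℕ suc g)
  r' (suc (suc j)) = r (suc (suc j))
  s : Fin (suc (suc n)) → ℤ
  s = vm r (lowerBlock (+ 1) z δ)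
  cancel : ∀ a q g → (a ℤ.+ q ℤ.* g) ℤ.* + 1 ℤ.+ (g ℤ.* ℤ.- q ℤ.+ + 0) ≡ a
  cancel = ℤS.solve-∀
  s-zero : s zero ≡ + (r zero ℤD.%ℕ suc g)
  s-zero = begin
    r zero ℤ.* + 1 ℤ.+ (r (suc zero) ℤ.* (ℤ.- q) ℤ.+ sumℤ (λ k → r (suc (suc k)) ℤ.* + 0))
      ≡⟨ cong₂ (λ u v → r zero ℤ.* + 1 ℤ.+ (u ℤ.* (ℤ.- q) ℤ.+ v)) e (Zs.S-0 (λ k → r (suc (suc k)) ℤ.* + 0) (λ k → ℤₚ.*-zeroʳ (r (suc (suc k))))) ⟩
    r zero ℤ.* + 1 ℤ.+ (+ suc g ℤ.* (ℤ.- q) ℤ.+ + 0)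
      ≡⟨ cong (λ u → u ℤ.* + 1 ℤ.+ (+ suc g ℤ.* (ℤ.- q) ℤ.+ + 0)) (ℤD.a≡a%ℕn+[a/ℕn]*n (r zero) (suc g)) ⟩
    (+ (r zero ℤD.%ℕ suc g) ℤ.+ q ℤ.* + suc g) ℤ.* + 1 ℤ.+ (+ suc g ℤ.* (ℤ.- q) ℤ.+ + 0)
      ≡⟨ cancel (+ (r zero ℤD.%ℕ suc g)) q (+ suc g) ⟩
    + (r zero ℤD.%ℕ suc g) ∎
    where open ≡-Reasoning
  s-suc : ∀ j → s (suc j) ≡ r (suc j)
  s-suc j = trans (vm-lowerBlock r (+ 1) z δ j) (⊗-identityʳ (λ (_ : Fin 1) → r ∘ suc) zero j)
  s∘π : ∀ j → s (π ⟨$⟩ʳ j) ≡ r' j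
  s∘π zero          = s-suc zero
  s∘π (suc zero)    = s-zero
  s∘π (suc (suc j)) = s-suc (suc j)
  step : ∀ j → vm r (lowerBlock (+ 1) z δ ⊗ to (gl-perm π)) j ≡ r' j
  step j = trans (vm-⊗ r (lowerBlock (+ 1) z δ) (to (gl-perm π)) j) (trans (vm-perm s π j) (s∘π j))

row-reduce : ∀ {n} (r : Fin (suc n) → ℤ) → RowReduced r
row-reduce {zero}  r = row-sign r (λ ())
row-reduce {suc n} r with row-reduce (r ∘ suc)
... | W , nn , zs = rowReduced-after r (gl-lowerBlock (+ 1) refl (λ _ → + 0) W) r' (λ _ → refl)
  (row-euclid ∣ vm (r ∘ suc) (to W) zero ∣ (<-wellFounded _) r'
    (trans (blk zero) (sym (ℤₚ.0≤i⇒+∣i∣≡i nn))) (λ j → trans (blk (suc j)) (zs j)))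
  where
  r' = vm r (lowerBlock (+ 1) (λ _ → + 0) (to W))
  blk : ∀ j → vm r (lowerBlock (+ 1) (λ _ → + 0) (to W)) (suc j) ≡ vm (r ∘ suc) (to W) j
  blk = vm-lowerBlock r (+ 1) (λ _ → + 0) (to W)

InResidue : ℤ → ℤ → Set
InResidue d x = + 0 ℤ.≤ x × x ℤ.< d

-- The lower triangular form reached by column operations: each entry left of the diagonal is a
-- residue modulo the diagonal entry of its own row.
HNF : ∀ n → Mat ℤ n n → Set
HNF zero    L = ⊤
HNF (suc n) L = (∀ j → L zero (suc j) ≡ + 0) × + 0 ℤ.< L zero zero ×
                (∀ i → InResidue (L (suc i) (suc i)) (L (suc i) zero)) × HNF n (λ i j → L (suc i) (suc j))

residue₁ : ∀ d b → + 0 ℤ.< d → ∃[ z ] InResidue d (b ℤ.+ d ℤ.* z)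
residue₁ (+ suc d) b _ = ℤ.- (b ℤD./ℕ suc d) ,
  subst (InResidue (+ suc d)) (sym e) (ℤ.+≤+ ℕ.z≤n , ℤ.+<+ (ℤD.n%ℕd<d b (suc d)))
  where
  cancel : ∀ a q g → (a ℤ.+ q ℤ.* g) ℤ.+ g ℤ.* ℤ.- q ≡ a
  cancel = ℤS.solve-∀
  e : b ℤ.+ + suc d ℤ.* ℤ.- (b ℤD./ℕ suc d) ≡ + (b ℤD.%ℕ suc d)
  e = trans (cong (ℤ._+ + suc d ℤ.* ℤ.- (b ℤD./ℕ suc d)) (ℤD.a≡a%ℕn+[a/ℕn]*n b (suc d))) (cancel (+ (b ℤD.%ℕ suc d)) (b ℤD./ℕ suc d) (+ suc d))
residue₁ (+ zero) b (ℤ.+<+ ())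

-- Triangularity lets the coordinates be treated from the top: `z₀` settles the first one, and its
-- effect on the later ones is absorbed into `b`. The lemma serves twice, for the first column of a
-- Hermite form and for the right-hand sides.
residue : ∀ n (L : Mat ℤ n n) → HNF n L → (b : Fin n → ℤ) → ∃[ z ] ∀ i → InResidue (L i i) (b i ℤ.+ mv L z i)
residue zero L _ b = (λ ()) , (λ ())
residue (suc n) L (row , pos , _ , sub) b with residue₁ (L zero zero) (b zero) pos
... | z₀ , in₀ with residue n (λ i j → L (suc i) (suc j)) sub (λ i → b (suc i) ℤ.+ L (suc i) zero ℤ.* z₀)
... | z , ins = (z₀ ∷ z) , λ
  { zero → subst (λ w → InResidue (L zero zero) (b zero ℤ.+ w)) (sym (trans
       (cong (λ w → L zero zero ℤ.* z₀ ℤ.+ w) (Zs.S-0 (λ k → L zero (suc k) ℤ.* z k) (λ k → cong (ℤ._* z k) (row k)))) (ℤₚ.+-identityʳ _))) in₀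
  ; (suc i) → subst (InResidue (L (suc i) (suc i))) (ℤₚ.+-assoc (b (suc i)) (L (suc i) zero ℤ.* z₀) (mv (λ i j → L (suc i) (suc j)) z i)) (ins i) }

abs-unit : ∀ x y → ∣ y ∣ ≡ 1 → ∣ x ℤ.* y ∣ ≡ ∣ x ∣
abs-unit x y e = trans (ℤₚ.abs-* x y) (trans (cong (∣ x ∣ ℕ.*_) e) (ℕₚ.*-identityʳ _))

det-⊗-GL : ∀ n (A : Mat ℤ n n) (W : GL n) → ∣ det n (A ⊗ to W) ∣ ≡ ∣ det n A ∣
det-⊗-GL n A W = trans (cong ∣_∣ (det-⊗ n A (to W))) (abs-unit (det n A) (det n (to W)) (gl-det W))

hnf-cong : ∀ n {M M' : Mat ℤ n n} → (∀ i j → M i j ≡ M' i j) → HNF n M → HNF n M'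
hnf-cong zero    e _ = tt
hnf-cong (suc n) e (r , p , c , s) =
  (λ j → trans (sym (e zero (suc j))) (r j)) , subst (+ 0 ℤ.<_) (e zero zero) p ,
  (λ i → subst₂ InResidue (e (suc i) (suc i)) (e (suc i) zero) (c i)) , hnf-cong n (λ i j → e (suc i) (suc j)) s

tail² : ∀ {n} → Mat ℤ (suc n) (suc n) → Mat ℤ n n
tail² M r c = M (suc r) (suc c)

-- The column `mv (to W) z` of the block matrix adds to the first column the combination `z` of the
-- columns already in normal form, which is what reduces its entries to residues.
hnf-step : ∀ n (B : Mat ℤ (suc n) (suc n)) → (∀ j → B zero (suc j) ≡ + 0) → + 0 ℤ.< B zero zero →
           ∀ (W : GL n) → HNF n (tail² B ⊗ to W) → ∃[ W₁ ] HNF (suc n) (B ⊗ to W₁)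
hnf-step n B row pos W h = W₁ , row₁ , subst (+ 0 ℤ.<_) (sym L-head) pos , col , hnf-cong n (λ i j → sym (L-suc (suc i) j)) h
  where
  z : Fin n → ℤ
  z = proj₁ (residue n (tail² B ⊗ to W) h (λ i → B (suc i) zero))
  ins : ∀ i → InResidue ((tail² B ⊗ to W) i i) (B (suc i) zero ℤ.+ mv (tail² B ⊗ to W) z i)
  ins = proj₂ (residue n (tail² B ⊗ to W) h (λ i → B (suc i) zero))
  W₁ : GL (suc n)
  W₁ = gl-lowerBlock (+ 1) refl (mv (to W) z) W
  L : Mat ℤ (suc n) (suc n)
  L = B ⊗ to W₁
  L-suc : ∀ i j → L i (suc j) ≡ vm (B i ∘ suc) (to W) j
  L-suc i j = vm-lowerBlock (B i) (+ 1) (mv (to W) z) (to W) j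
  L-zero : ∀ i → L i zero ≡ B i zero ℤ.+ sumℤ (λ k → vm (B i ∘ suc) (to W) k ℤ.* z k)
  L-zero i = cong₂ ℤ._+_ (ℤₚ.*-identityʳ (B i zero)) (Zs.S-assoc (B i ∘ suc) (to W) z)
  rowW : ∀ k → vm (B zero ∘ suc) (to W) k ≡ + 0
  rowW k = Zs.S-0 (λ l → B zero (suc l) ℤ.* to W l k) (λ l → cong (ℤ._* to W l k) (row l))
  row₁ : ∀ j → L zero (suc j) ≡ + 0
  row₁ j = trans (L-suc zero j) (rowW j)
  L-head : L zero zero ≡ B zero zero
  L-head = trans (L-zero zero) (trans (cong (λ w → B zero zero ℤ.+ w) (Zs.S-0 (λ k → vm (B zero ∘ suc) (to W) k ℤ.* z k) (λ k → cong (ℤ._* z k) (rowW k)))) (ℤₚ.+-identityʳ (B zero zero)))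
  col : ∀ i → InResidue (L (suc i) (suc i)) (L (suc i) zero)
  col i = subst₂ InResidue (sym (L-suc (suc i) i)) (sym (L-zero (suc i))) (ins i)

-- The determinant is the pivot times the determinant of the tail, up to sign. As it is nonzero, the
-- pivot is positive and the recursion applies to the tail.
hnf : ∀ n (B : Mat ℤ n n) → ∣ det n B ∣ ≢ 0 → ∃[ W ] HNF n (B ⊗ to W)
hnf zero    B d≢0 = gl-id , tt
hnf (suc n) B d≢0 = gl-comp W₀ (proj₁ rest) , hnf-cong (suc n) (λ i j → sym (⊗-assoc B (to W₀) (to (proj₁ rest)) i j)) (proj₂ rest)
  where
  red : RowReduced (B zero)
  red = row-reduce (B zero)
  W₀ : GL (suc n)
  W₀ = proj₁ red
  B₀ : Mat ℤ (suc n) (suc n)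
  B₀ = B ⊗ to W₀
  g : ℤ
  g = B₀ zero zero
  det-B₀ : ∣ det (suc n) B ∣ ≡ ∣ g ∣ ℕ.* ∣ det n (tail² B₀) ∣
  det-B₀ = trans (sym (det-⊗-GL (suc n) B W₀)) (trans (cong ∣_∣ (det-head n B₀ (proj₂ (proj₂ red)))) (ℤₚ.abs-* g (det n (tail² B₀))))
  d'≢0 : ∣ det n (tail² B₀) ∣ ≢ 0
  d'≢0 e = d≢0 (trans det-B₀ (trans (cong (∣ g ∣ ℕ.*_) e) (ℕₚ.*-zeroʳ ∣ g ∣)))
  g≢0 : g ≢ + 0
  g≢0 e = d≢0 (trans det-B₀ (cong (λ x → ∣ x ∣ ℕ.* ∣ det n (tail² B₀) ∣) e))
  rest : ∃[ W ] HNF (suc n) (B₀ ⊗ to W)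
  rest = hnf-step n B₀ (proj₂ (proj₂ red)) (ℤₚ.≤∧≢⇒< (proj₁ (proj₂ red)) (g≢0 ∘ sym)) (proj₁ (hnf n (tail² B₀) d'≢0)) (proj₂ (hnf n (tail² B₀) d'≢0))

-- Adjugates and Cramer's rule

hnf-det : ∀ n {L : Mat ℤ n n} → HNF n L → + 0 ℤ.< det n L
hnf-det zero h = ℤ.+<+ (ℕ.s≤s ℕ.z≤n)
hnf-det (suc n) {L} (row , pos , _ , h) = subst (+ 0 ℤ.<_) (sym (det-head n L row)) (pos-* pos (hnf-det n h))
  where
  pos-* : ∀ {x y} → + 0 ℤ.< x → + 0 ℤ.< y → + 0 ℤ.< x ℤ.* y
  pos-* {+ suc x} {+ suc y} _ _ = ℤ.+<+ (ℕ.s≤s ℕ.z≤n)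
  pos-* {+ zero} (ℤ.+<+ ()) _
  pos-* {+ suc x} {+ zero} _ (ℤ.+<+ ())

hnf-diagonal : ∀ n {L : Mat ℤ n n} → HNF n L → ∀ i → + 0 ℤ.< L i i
hnf-diagonal (suc n) (_ , pos , _ , h) zero    = pos
hnf-diagonal (suc n) (_ , pos , _ , h) (suc i) = hnf-diagonal n h i

hnf-residue : ∀ n {L : Mat ℤ n n} → HNF n L → ∀ i j → i ≢ j → InResidue (L i i) (L i j)
hnf-residue (suc n) h zero zero i≢j = ⊥-elim (i≢j refl)
hnf-residue (suc n) {L} (row , pos , _ , _) zero (suc j) _ =
  ℤₚ.≤-reflexive (sym (row j)) , subst (ℤ._< L zero zero) (sym (row j)) pos
hnf-residue (suc n) (_ , _ , col , _) (suc i) zero _ = col i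
hnf-residue (suc n) (_ , _ , _ , h) (suc i) (suc j) i≢j = hnf-residue n h i j (i≢j ∘ cong suc)

∏ : ∀ {n} → (Fin n → ℕ) → ℕ
∏ = Product.sum

hnf-∏ : ∀ n {L : Mat ℤ n n} → HNF n L → ∏ (λ i → ∣ L i i ∣) ≡ ∣ det n L ∣
hnf-∏ zero h = refl
hnf-∏ (suc n) {L} (row , _ , _ , h) = trans (cong (∣ L zero zero ∣ ℕ.*_) (hnf-∏ n h))
  (trans (sym (ℤₚ.abs-* (L zero zero) (det n (tail² L)))) (cong ∣_∣ (sym (det-head n L row))))

record Adjugate {n} (B : Mat ℤ n n) (d : ℤ) : Set where
  field
    adj : Mat ℤ n n
    ⊗-adj : ∀ i j → (B ⊗ adj) i j ≡ d ℤ.* δ i j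
    adj-⊗ : ∀ i j → (adj ⊗ B) i j ≡ d ℤ.* δ i j
open Adjugate

mv-⊗ : ∀ {m n p} (A : Mat ℤ m n) (B : Mat ℤ n p) x i → mv A (mv B x) i ≡ mv (A ⊗ B) x i
mv-⊗ A B x i = Zs.S-assoc (A i) B x

mv-scaled : ∀ {n} (M : Mat ℤ n n) d → (∀ i j → M i j ≡ d ℤ.* δ i j) → ∀ x i → mv M x i ≡ d ℤ.* x i
mv-scaled M d e x i = begin
  mv M x i                              ≡⟨ Zs.S-cong (λ k → trans (cong (ℤ._* x k) (e i k)) (ℤₚ.*-assoc d (δ i k) (x k))) ⟩
  sumℤ (λ k → d ℤ.* (δ i k ℤ.* x k))    ≡⟨ Zs.S-*ˡ d (λ k → δ i k ℤ.* x k) ⟨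
  d ℤ.* mv δ x i                        ≡⟨ cong (d ℤ.*_) (mv-δ x i) ⟩
  d ℤ.* x i                             ∎
  where open ≡-Reasoning

-- The inverse of a lower block matrix, cleared of denominators: with corner a, first column v, and
-- adjugate V' and determinant d of the tail, it has rows (d, 0) and (- V' v, a V').
hnf-adjugate : ∀ n {L : Mat ℤ n n} → HNF n L → Adjugate L (det n L)
hnf-adjugate zero h = record { adj = λ () ; ⊗-adj = λ () ; adj-⊗ = λ () }
hnf-adjugate (suc n) {L} (row , pos , _ , h) = record
  { adj = V
  ; ⊗-adj = λ i j → trans (LV i j) (cong (ℤ._* δ i j) (sym (det-head n L row)))
  ; adj-⊗ = λ i j → trans (VL i j) (cong (ℤ._* δ i j) (sym (det-head n L row))) }
  where
  open ≡-Reasoning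
  a d : ℤ
  a = L zero zero
  d = det n (tail² L)
  ih = hnf-adjugate n h
  v : Fin n → ℤ
  v i = L (suc i) zero
  V' : Mat ℤ n n
  V' = adj ih
  V : Mat ℤ (suc n) (suc n)
  V = lowerBlock d (λ i → ℤ.- + 1 ℤ.* mv V' v i) (λ i j → a ℤ.* V' i j)
  row-0 : ∀ (f : Fin n → ℤ) → sumℤ (λ k → L zero (suc k) ℤ.* f k) ≡ + 0
  row-0 f = Zs.S-0 (λ k → L zero (suc k) ℤ.* f k) (λ k → cong (ℤ._* f k) (row k))
  zero-row : ∀ (f : Fin n → ℤ) → sumℤ (λ k → + 0 ℤ.* f k) ≡ + 0
  zero-row f = Zs.S-0 (λ k → + 0 ℤ.* f k) (λ _ → refl)
  ring₁ : ∀ a d → a ℤ.* d ℤ.+ + 0 ≡ a ℤ.* d ℤ.* + 1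
  ring₁ = ℤS.solve-∀
  ring₂ : ∀ a d → a ℤ.* + 0 ℤ.+ + 0 ≡ a ℤ.* d ℤ.* + 0
  ring₂ = ℤS.solve-∀
  ring₃ : ∀ v d a → v ℤ.* d ℤ.+ ℤ.- + 1 ℤ.* (d ℤ.* v) ≡ a ℤ.* d ℤ.* + 0
  ring₃ = ℤS.solve-∀
  ring₄ : ∀ v a d x → v ℤ.* + 0 ℤ.+ a ℤ.* (d ℤ.* x) ≡ a ℤ.* d ℤ.* x
  ring₄ = ℤS.solve-∀
  ring₅ : ∀ x y c → x ℤ.* (c ℤ.* y) ≡ c ℤ.* (x ℤ.* y)
  ring₅ = ℤS.solve-∀
  ring₆ : ∀ w a d → ℤ.- + 1 ℤ.* w ℤ.* a ℤ.+ a ℤ.* w ≡ a ℤ.* d ℤ.* + 0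
  ring₆ = ℤS.solve-∀
  scale-in : ∀ (x y : Fin n → ℤ) c → sumℤ (λ k → x k ℤ.* (c ℤ.* y k)) ≡ c ℤ.* sumℤ (λ k → x k ℤ.* y k)
  scale-in x y c = trans (Zs.S-cong (λ k → ring₅ (x k) (y k) c)) (sym (Zs.S-*ˡ c (λ k → x k ℤ.* y k)))
  scale-out : ∀ (x y : Fin n → ℤ) c → sumℤ (λ k → c ℤ.* x k ℤ.* y k) ≡ c ℤ.* sumℤ (λ k → x k ℤ.* y k)
  scale-out x y c = trans (Zs.S-cong (λ k → ℤₚ.*-assoc c (x k) (y k))) (sym (Zs.S-*ˡ c (λ k → x k ℤ.* y k)))
  LV : ∀ i j → (L ⊗ V) i j ≡ a ℤ.* d ℤ.* δ i j
  LV zero zero = trans (cong (λ w → a ℤ.* d ℤ.+ w) (row-0 (λ k → ℤ.- + 1 ℤ.* mv V' v k))) (ring₁ a d)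
  LV zero (suc j) = trans (cong (λ w → a ℤ.* + 0 ℤ.+ w) (row-0 (λ k → a ℤ.* V' k j))) (ring₂ a d)
  LV (suc i) zero = trans (cong (λ w → v i ℤ.* d ℤ.+ w) (begin
      mv (tail² L) (λ k → ℤ.- + 1 ℤ.* mv V' v k) i ≡⟨ scale-in (tail² L i) (mv V' v) (ℤ.- + 1) ⟩
      ℤ.- + 1 ℤ.* mv (tail² L) (mv V' v) i         ≡⟨ cong (ℤ.- + 1 ℤ.*_) (mv-⊗ (tail² L) V' v i) ⟩
      ℤ.- + 1 ℤ.* mv (tail² L ⊗ V') v i            ≡⟨ cong (ℤ.- + 1 ℤ.*_) (mv-scaled (tail² L ⊗ V') d (⊗-adj ih) v i) ⟩
      ℤ.- + 1 ℤ.* (d ℤ.* v i)                      ∎)) (ring₃ (v i) d a)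
  LV (suc i) (suc j) = trans (cong (λ w → v i ℤ.* + 0 ℤ.+ w) (trans (scale-in (tail² L i) (λ k → V' k j) a) (cong (a ℤ.*_) (⊗-adj ih i j))))
    (ring₄ (v i) a d (δ i j))
  VL : ∀ i j → (V ⊗ L) i j ≡ a ℤ.* d ℤ.* δ i j
  VL zero zero = trans (cong₂ ℤ._+_ (ℤₚ.*-comm d a) (zero-row v)) (ring₁ a d)
  VL zero (suc j) = trans (cong₂ (λ x w → d ℤ.* x ℤ.+ w) (row j) (zero-row (λ k → L (suc k) (suc j)))) (ring₀ a d)
    where
    ring₀ : ∀ a d → d ℤ.* + 0 ℤ.+ + 0 ≡ a ℤ.* d ℤ.* + 0
    ring₀ = ℤS.solve-∀
  VL (suc i) zero = trans (cong (λ w → ℤ.- + 1 ℤ.* mv V' v i ℤ.* a ℤ.+ w) (scale-out (V' i) v a)) (ring₆ (mv V' v i) a d)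
  VL (suc i) (suc j) = trans (cong₂ (λ x w → ℤ.- + 1 ℤ.* mv V' v i ℤ.* x ℤ.+ w) (row j)
      (trans (scale-out (V' i) (λ k → L (suc k) (suc j)) a) (cong (a ℤ.*_) (adj-⊗ ih i j))))
    (ring₄ (ℤ.- + 1 ℤ.* mv V' v i) a d (δ i j))

-- If B W = L is the Hermite form and V its adjugate, then W V is a two-sided adjugate of B, because
-- B = L W⁻¹. The factor is det L, which is positive; hence the absolute value.
adjugate : ∀ {n} (B : Mat ℤ n n) → ∣ det n B ∣ ≢ 0 → Adjugate B (+ ∣ det n B ∣)
adjugate {n} B d≢0 = subst (Adjugate B) det-L record { adj = to W ⊗ V ; ⊗-adj = BWV ; adj-⊗ = WVB }
  where
  open ≡-Reasoning
  W : GL n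
  W = proj₁ (hnf n B d≢0)
  L : Mat ℤ n n
  L = B ⊗ to W
  A = hnf-adjugate n (proj₂ (hnf n B d≢0))
  V : Mat ℤ n n
  V = adj A
  det-L : det n L ≡ + ∣ det n B ∣
  det-L = trans (sym (ℤₚ.0≤i⇒+∣i∣≡i (ℤₚ.<⇒≤ (hnf-det n (proj₂ (hnf n B d≢0)))))) (cong +_ (det-⊗-GL n B W))
  BWV : ∀ i j → (B ⊗ (to W ⊗ V)) i j ≡ det n L ℤ.* δ i j
  BWV i j = trans (⊗-assoc B (to W) V i j) (⊗-adj A i j)
  scaled : ∀ i j → (to W ⊗ (λ k l → det n L ℤ.* δ k l)) i j ≡ det n L ℤ.* to W i j
  scaled i j = begin
    sumℤ (λ k → to W i k ℤ.* (det n L ℤ.* δ k j)) ≡⟨ Zs.S-cong (λ k → ring₅ (to W i k) (δ k j) (det n L)) ⟩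
    sumℤ (λ k → det n L ℤ.* (to W i k ℤ.* δ k j)) ≡⟨ Zs.S-*ˡ (det n L) (λ k → to W i k ℤ.* δ k j) ⟨
    det n L ℤ.* (to W ⊗ δ) i j                    ≡⟨ cong (det n L ℤ.*_) (⊗-identityʳ (to W) i j) ⟩
    det n L ℤ.* to W i j ∎
    where
    ring₅ : ∀ x y c → x ℤ.* (c ℤ.* y) ≡ c ℤ.* (x ℤ.* y)
    ring₅ = ℤS.solve-∀
  WVL : ∀ i j → (to W ⊗ (V ⊗ L)) i j ≡ det n L ℤ.* to W i j
  WVL i j = trans (⊗-cong {A = to W} (λ _ _ → refl) (adj-⊗ A) i j) (scaled i j)
  B≡ : ∀ i j → B i j ≡ (L ⊗ from W) i j
  B≡ i j = sym (begin
    (L ⊗ from W) i j           ≡⟨ ⊗-assoc B (to W) (from W) i j ⟨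
    (B ⊗ (to W ⊗ from W)) i j  ≡⟨ ⊗-cong {A = B} (λ _ _ → refl) (to-from W) i j ⟩
    (B ⊗ δ) i j                ≡⟨ ⊗-identityʳ B i j ⟩
    B i j                      ∎)
  WVB : ∀ i j → ((to W ⊗ V) ⊗ B) i j ≡ det n L ℤ.* δ i j
  WVB i j = begin
    ((to W ⊗ V) ⊗ B) i j                ≡⟨ ⊗-cong {A = to W ⊗ V} (λ _ _ → refl) B≡ i j ⟩
    ((to W ⊗ V) ⊗ (L ⊗ from W)) i j     ≡⟨ ⊗-assoc (to W ⊗ V) L (from W) i j ⟩
    (((to W ⊗ V) ⊗ L) ⊗ from W) i j     ≡⟨ ⊗-cong {B = from W} (λ k l → trans (sym (⊗-assoc (to W) V L k l)) (WVL k l)) (λ _ _ → refl) i j ⟩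
    sumℤ (λ k → det n L ℤ.* to W i k ℤ.* from W k j)   ≡⟨ Zs.S-cong (λ k → ℤₚ.*-assoc (det n L) (to W i k) (from W k j)) ⟩
    sumℤ (λ k → det n L ℤ.* (to W i k ℤ.* from W k j)) ≡⟨ Zs.S-*ˡ (det n L) (λ k → to W i k ℤ.* from W k j) ⟨
    det n L ℤ.* (to W ⊗ from W) i j     ≡⟨ cong (det n L ℤ.*_) (to-from W i j) ⟩
    det n L ℤ.* δ i j                   ∎

-- Deleting row i + 1 of A leaves the first row followed by B without its row i. Once d times the
-- first row is expanded as a combination of rows of B, every term but the i-th repeats a row.
cramer : ∀ {n} (A : Mat ℤ (suc n) n) d (τ : Fin n → ℤ) →
         (∀ j → d ℤ.* A zero j ≡ sumℤ (λ i → τ i ℤ.* A (suc i) j)) → ∀ i →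
         ∣ d ∣ ℕ.* ∣ det n (delRow A (suc i)) ∣ ≡ ∣ τ i ∣ ℕ.* ∣ det n (delRow A zero) ∣
cramer {suc n} A d τ e i = begin
  ∣ d ∣ ℕ.* ∣ det (suc n) (delRow A (suc i)) ∣
    ≡⟨ ℤₚ.abs-* d (det (suc n) (delRow A (suc i))) ⟨
  ∣ d ℤ.* det (suc n) (delRow A (suc i)) ∣
    ≡⟨ cong (λ w → ∣ d ℤ.* w ∣) (det-cong (suc n) (∷-η' (delRow A (suc i)))) ⟩
  ∣ d ℤ.* det (suc n) (A zero ∷ (B ∘ punchIn i)) ∣
    ≡⟨ cong ∣_∣ (trans (sym (ℤₚ.+-identityʳ (d ℤ.* det (suc n) (A zero ∷ (B ∘ punchIn i))))) (cong (λ w → d ℤ.* det (suc n) (A zero ∷ (B ∘ punchIn i)) ℤ.+ w) (sym (alt-zero al (B ∘ punchIn i))))) ⟩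
  ∣ d ℤ.* det (suc n) (A zero ∷ (B ∘ punchIn i)) ℤ.+ det (suc n) ((λ _ → + 0) ∷ (B ∘ punchIn i)) ∣
    ≡⟨ cong ∣_∣ (proj₁ (proj₂ al) d (A zero) (λ _ → + 0) (B ∘ punchIn i)) ⟨
  ∣ det (suc n) ((λ j → d ℤ.* A zero j ℤ.+ + 0) ∷ (B ∘ punchIn i)) ∣
    ≡⟨ cong ∣_∣ (det-cong (suc n) (∷-cong {t = B ∘ punchIn i} (λ j → trans (ℤₚ.+-identityʳ (d ℤ.* A zero j)) (e j)) (λ _ _ → refl))) ⟩
  ∣ det (suc n) ((λ j → sumℤ (λ l → τ l ℤ.* B l j)) ∷ (B ∘ punchIn i)) ∣
    ≡⟨ cong ∣_∣ (alt-lincomb al τ B (B ∘ punchIn i)) ⟩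
  ∣ sumℤ (λ l → τ l ℤ.* det (suc n) (B l ∷ (B ∘ punchIn i))) ∣
    ≡⟨ cong ∣_∣ (Zs.S-single i (λ l → τ l ℤ.* det (suc n) (B l ∷ (B ∘ punchIn i))) other) ⟩
  ∣ τ i ℤ.* det (suc n) (B i ∷ (B ∘ punchIn i)) ∣
    ≡⟨ cong (λ w → ∣ τ i ℤ.* w ∣) (alt-move al B i) ⟩
  ∣ τ i ℤ.* (sign (toℕ i) ℤ.* det (suc n) B) ∣
    ≡⟨ ℤₚ.abs-* (τ i) (sign (toℕ i) ℤ.* det (suc n) B) ⟩
  ∣ τ i ∣ ℕ.* ∣ sign (toℕ i) ℤ.* det (suc n) B ∣
    ≡⟨ cong (∣ τ i ∣ ℕ.*_) (trans (cong ∣_∣ (ℤₚ.*-comm (sign (toℕ i)) (det (suc n) B))) (abs-unit (det (suc n) B) (sign (toℕ i)) (abs-sign (toℕ i)))) ⟩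
  ∣ τ i ∣ ℕ.* ∣ det (suc n) B ∣ ∎
  where
  open ≡-Reasoning
  al = det-alt (suc n)
  B : Mat ℤ (suc n) (suc n)
  B = A ∘ suc
  ∷-η' : ∀ (M : Mat ℤ (suc n) (suc n)) i j → M i j ≡ (M zero ∷ (M ∘ suc)) i j
  ∷-η' M i j = sym (∷-η M i j)
  abs-sign : ∀ k → ∣ sign k ∣ ≡ 1
  abs-sign zero          = refl
  abs-sign (suc zero)    = refl
  abs-sign (suc (suc k)) = abs-sign k
  other : ∀ l → l ≢ i → τ l ℤ.* det (suc n) (B l ∷ (B ∘ punchIn i)) ≡ + 0
  other l l≢i = trans (cong (τ l ℤ.*_) (trans
      (cong (λ w → det (suc n) (B w ∷ (B ∘ punchIn i))) (sym (Finₚ.punchIn-punchOut (l≢i ∘ sym))))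
      (alt-repeat al (B ∘ punchIn i) (Fin.punchOut (l≢i ∘ sym))))) (ℤₚ.*-zeroʳ (τ l))

-- Rational points

module Qs = FinSum.Over (CommutativeRing.commutativeSemiring ℚₚ.+-*-commutativeRing) sumℚ (λ _ → refl) (λ _ → refl)


-- Normalised rationals divide by a gcd, which blocks on variables. The arithmetic of `toℚ` is
-- therefore checked on unnormalised fractions, where `mkℚᵘ z 0` has denominator 1.
toℚᵘ-toℚ : ∀ z → ℚ.toℚᵘ (toℚ z) ℚᵘ.≃ mkℚᵘ z 0
toℚᵘ-toℚ z = ℚₚ.toℚᵘ-fromℚᵘ (mkℚᵘ z 0)

toℚ-+ : ∀ a b → toℚ (a ℤ.+ b) ≡ toℚ a ℚ.+ toℚ b
toℚ-+ a b = ℚₚ.toℚᵘ-injective (begin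
  ℚ.toℚᵘ (toℚ (a ℤ.+ b))                     ≈⟨ toℚᵘ-toℚ (a ℤ.+ b) ⟩
  mkℚᵘ (a ℤ.+ b) 0                           ≈⟨ ℚᵘ.*≡* (ring a b) ⟩
  mkℚᵘ a 0 ℚᵘ.+ mkℚᵘ b 0                     ≈⟨ ℚᵘₚ.+-cong (toℚᵘ-toℚ a) (toℚᵘ-toℚ b) ⟨
  ℚ.toℚᵘ (toℚ a) ℚᵘ.+ ℚ.toℚᵘ (toℚ b)         ≈⟨ ℚₚ.toℚᵘ-homo-+ (toℚ a) (toℚ b) ⟨
  ℚ.toℚᵘ (toℚ a ℚ.+ toℚ b)                   ∎)
  where
  open ℚᵘₚ.≃-Reasoning
  ring : ∀ a b → (a ℤ.+ b) ℤ.* + 1 ≡ (a ℤ.* + 1 ℤ.+ b ℤ.* + 1) ℤ.* + 1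
  ring = ℤS.solve-∀

toℚ-* : ∀ a b → toℚ (a ℤ.* b) ≡ toℚ a ℚ.* toℚ b
toℚ-* a b = ℚₚ.toℚᵘ-injective (begin
  ℚ.toℚᵘ (toℚ (a ℤ.* b))                     ≈⟨ toℚᵘ-toℚ (a ℤ.* b) ⟩
  mkℚᵘ (a ℤ.* b) 0                           ≈⟨ ℚᵘ.*≡* refl ⟩
  mkℚᵘ a 0 ℚᵘ.* mkℚᵘ b 0                     ≈⟨ ℚᵘₚ.*-cong (toℚᵘ-toℚ a) (toℚᵘ-toℚ b) ⟨
  ℚ.toℚᵘ (toℚ a) ℚᵘ.* ℚ.toℚᵘ (toℚ b)         ≈⟨ ℚₚ.toℚᵘ-homo-* (toℚ a) (toℚ b) ⟨
  ℚ.toℚᵘ (toℚ a ℚ.* toℚ b)                   ∎)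
  where open ℚᵘₚ.≃-Reasoning

toℚ-mono-≤ : ∀ {a b} → a ℤ.≤ b → toℚ a ℚ.≤ toℚ b
toℚ-mono-≤ {a} {b} a≤b = ℚₚ.toℚᵘ-cancel-≤ (ℚᵘₚ.≤-respˡ-≃ (ℚᵘₚ.≃-sym (toℚᵘ-toℚ a)) (ℚᵘₚ.≤-respʳ-≃ (ℚᵘₚ.≃-sym (toℚᵘ-toℚ b))
  (ℚᵘ.*≤* (ℤₚ.*-monoʳ-≤-nonNeg (+ 1) a≤b))))

toℚ-mono-< : ∀ {a b} → a ℤ.< b → toℚ a ℚ.< toℚ b
toℚ-mono-< {a} {b} a<b = ℚₚ.toℚᵘ-cancel-< (ℚᵘₚ.<-respˡ-≃ (ℚᵘₚ.≃-sym (toℚᵘ-toℚ a)) (ℚᵘₚ.<-respʳ-≃ (ℚᵘₚ.≃-sym (toℚᵘ-toℚ b))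
  (ℚᵘ.*<* (ℤₚ.*-monoʳ-<-pos (+ 1) a<b))))

toℚ-cancel-≤ : ∀ {a b} → toℚ a ℚ.≤ toℚ b → a ℤ.≤ b
toℚ-cancel-≤ {a} {b} le = ℤₚ.≮⇒≥ (λ b<a → ℚₚ.<-irrefl refl (ℚₚ.<-≤-trans (toℚ-mono-< b<a) le))

toℚ-cancel-< : ∀ {a b} → toℚ a ℚ.< toℚ b → a ℤ.< b
toℚ-cancel-< {a} {b} lt = ℤₚ.≰⇒> (λ b≤a → ℚₚ.<-irrefl refl (ℚₚ.<-≤-trans lt (toℚ-mono-≤ b≤a)))

toℚ-neg : ∀ a → toℚ (ℤ.- a) ≡ ℚ.- toℚ a
toℚ-neg a = trans (cong toℚ (sym (ℤₚ.-1*i≡-i a))) (trans (toℚ-* (ℤ.- + 1) a)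
  (solve 1 (λ x → con (ℚ.- ℚ.1ℚ) :* x := :- x) refl (toℚ a)))

toℚ-sum : ∀ {n} (f : Fin n → ℤ) → toℚ (sumℤ f) ≡ sumℚ (λ i → toℚ (f i))
toℚ-sum {zero}  f = refl
toℚ-sum {suc n} f = trans (toℚ-+ (f zero) (sumℤ (λ i → f (suc i)))) (cong (λ w → toℚ (f zero) ℚ.+ w) (toℚ-sum (λ i → f (suc i))))

sumℚ-mono : ∀ {n} (f g : Fin n → ℚ) → (∀ i → f i ℚ.≤ g i) → sumℚ f ℚ.≤ sumℚ g
sumℚ-mono {zero}  f g e = ℚₚ.≤-refl
sumℚ-mono {suc n} f g e = ℚₚ.+-mono-≤ (e zero) (sumℚ-mono (λ i → f (suc i)) (λ i → g (suc i)) (λ i → e (suc i)))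

sumℚ-abs : ∀ {n} (f : Fin n → ℚ) → ℚ.∣ sumℚ f ∣ ℚ.≤ sumℚ (λ i → ℚ.∣ f i ∣)
sumℚ-abs {zero}  f = ℚₚ.≤-refl
sumℚ-abs {suc n} f = ℚₚ.≤-trans (ℚₚ.∣p+q∣≤∣p∣+∣q∣ (f zero) (sumℚ (λ i → f (suc i)))) (ℚₚ.+-monoʳ-≤ ℚ.∣ f zero ∣ (sumℚ-abs (λ i → f (suc i))))

sumℚ-nonNeg : ∀ {n} (f : Fin n → ℚ) → (∀ i → ℚ.0ℚ ℚ.≤ f i) → ℚ.0ℚ ℚ.≤ sumℚ f
sumℚ-nonNeg {n} f e = ℚₚ.≤-trans (ℚₚ.≤-reflexive (sym (Qs.S-0 {n} (λ _ → ℚ.0ℚ) (λ _ → refl)))) (sumℚ-mono (λ _ → ℚ.0ℚ) f e)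

≤-sumℚ : ∀ {n} (f : Fin n → ℚ) → (∀ i → ℚ.0ℚ ℚ.≤ f i) → ∀ i → f i ℚ.≤ sumℚ f
≤-sumℚ {suc n} f e i = begin
  f i                                  ≡⟨ ℚₚ.+-identityʳ (f i) ⟨
  f i ℚ.+ ℚ.0ℚ                         ≤⟨ ℚₚ.+-monoʳ-≤ (f i) (sumℚ-nonNeg (λ j → f (punchIn i j)) (λ j → e (punchIn i j))) ⟩
  f i ℚ.+ sumℚ (λ j → f (punchIn i j)) ≡⟨ Qs.S-remove i f ⟨
  sumℚ f                               ∎
  where open ℚₚ.≤-Reasoning

p≤∣p∣ : ∀ p → p ℚ.≤ ℚ.∣ p ∣
p≤∣p∣ p with ℚₚ.≤-total ℚ.0ℚ p
... | inj₁ 0≤p = ℚₚ.≤-reflexive (sym (ℚₚ.0≤p⇒∣p∣≡p 0≤p))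
... | inj₂ p≤0 = ℚₚ.≤-trans p≤0 (ℚₚ.0≤∣p∣ p)

-- A bound on coordinates may be a negative number when there are no coordinates; with its absolute
-- value the row bound is non-negative in every case.
rowBound : ∀ {m n} → Mat ℤ m n → ℚ → Fin m → ℚ
rowBound M R i = sumℚ (λ j → ℚ.∣ toℚ (M i j) ∣ ℚ.* ℚ.∣ R ∣)

rowBound-nonNeg : ∀ {m n} (M : Mat ℤ m n) R i → ℚ.0ℚ ℚ.≤ rowBound M R i
rowBound-nonNeg M R i = sumℚ-nonNeg (λ j → ℚ.∣ toℚ (M i j) ∣ ℚ.* ℚ.∣ R ∣)
  (λ j → subst (ℚ.0ℚ ℚ.≤_) (ℚₚ.∣p*q∣≡∣p∣*∣q∣ (toℚ (M i j)) R) (ℚₚ.0≤∣p∣ (toℚ (M i j) ℚ.* R)))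

rowDot-bound : ∀ {m n} (M : Mat ℤ m n) (x : Vect ℚ n) R → (∀ j → ℚ.∣ x j ∣ ℚ.≤ R) → ∀ i →
               ℚ.∣ rowDot M x i ∣ ℚ.≤ rowBound M R i
rowDot-bound M x R e i = ℚₚ.≤-trans (sumℚ-abs (λ j → toℚ (M i j) ℚ.* x j)) (sumℚ-mono (λ j → ℚ.∣ toℚ (M i j) ℚ.* x j ∣) (λ j → ℚ.∣ toℚ (M i j) ∣ ℚ.* ℚ.∣ R ∣) (λ j → begin
  ℚ.∣ toℚ (M i j) ℚ.* x j ∣         ≡⟨ ℚₚ.∣p*q∣≡∣p∣*∣q∣ (toℚ (M i j)) (x j) ⟩
  ℚ.∣ toℚ (M i j) ∣ ℚ.* ℚ.∣ x j ∣   ≤⟨ ℚₚ.*-monoˡ-≤-nonNeg ℚ.∣ toℚ (M i j) ∣ {{ℚₚ.∣-∣-nonNeg (toℚ (M i j))}} (ℚₚ.≤-trans (e j) (p≤∣p∣ R)) ⟩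
  ℚ.∣ toℚ (M i j) ∣ ℚ.* ℚ.∣ R ∣     ∎))
  where open ℚₚ.≤-Reasoning

rowDot-⊗ : ∀ {m n p} (A : Mat ℤ m n) (B : Mat ℤ n p) (x : Vect ℚ p) i → rowDot A (rowDot B x) i ≡ rowDot (A ⊗ B) x i
rowDot-⊗ A B x i = trans (Qs.S-assoc (λ l → toℚ (A i l)) (λ l j → toℚ (B l j)) x)
  (Qs.S-cong (λ j → cong (ℚ._* x j) (trans (Qs.S-cong (λ l → sym (toℚ-* (A i l) (B l j)))) (sym (toℚ-sum (λ l → A i l ℤ.* B l j))))))

rowDot-congˡ : ∀ {m m' n} (A : Mat ℤ m n) (A' : Mat ℤ m' n) (x : Vect ℚ n) i i' → (∀ j → A i j ≡ A' i' j) →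
               rowDot A x i ≡ rowDot A' x i'
rowDot-congˡ A A' x i i' e = Qs.S-cong (λ j → cong (λ a → toℚ a ℚ.* x j) (e j))

rowDot-congʳ : ∀ {m n} (A : Mat ℤ m n) {x x' : Vect ℚ n} i → (∀ j → x j ≡ x' j) → rowDot A x i ≡ rowDot A x' i
rowDot-congʳ A i e = Qs.S-cong (λ j → cong (λ y → toℚ (A i j) ℚ.* y) (e j))

rowDot-+ : ∀ {m n} (A : Mat ℤ m n) (x y : Vect ℚ n) i → rowDot A (λ j → x j ℚ.+ y j) i ≡ rowDot A x i ℚ.+ rowDot A y i
rowDot-+ A x y i = trans (Qs.S-cong (λ j → ℚₚ.*-distribˡ-+ (toℚ (A i j)) (x j) (y j))) (Qs.S-+ (λ j → toℚ (A i j) ℚ.* x j) (λ j → toℚ (A i j) ℚ.* y j))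

rowDot-* : ∀ {m n} (A : Mat ℤ m n) c (x : Vect ℚ n) i → rowDot A (λ j → c ℚ.* x j) i ≡ c ℚ.* rowDot A x i
rowDot-* A c x i = trans (Qs.S-cong (λ j → solve 3 (λ a c x → a :* (c :* x) := c :* (a :* x)) refl (toℚ (A i j)) c (x j)))
  (sym (Qs.S-*ˡ c (λ j → toℚ (A i j) ℚ.* x j)))

rowDot-- : ∀ {m n} (A : Mat ℤ m n) (x y : Vect ℚ n) i → rowDot A (λ j → x j ℚ.- y j) i ≡ rowDot A x i ℚ.- rowDot A y i
rowDot-- A x y i = begin
  rowDot A (λ j → x j ℚ.- y j) i                      ≡⟨ rowDot-congʳ A i (λ j → minus (x j) (y j)) ⟩
  rowDot A (λ j → x j ℚ.+ ℚ.- ℚ.1ℚ ℚ.* y j) i         ≡⟨ rowDot-+ A x (λ j → ℚ.- ℚ.1ℚ ℚ.* y j) i ⟩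
  rowDot A x i ℚ.+ rowDot A (λ j → ℚ.- ℚ.1ℚ ℚ.* y j) i ≡⟨ cong (λ w → rowDot A x i ℚ.+ w) (rowDot-* A (ℚ.- ℚ.1ℚ) y i) ⟩
  rowDot A x i ℚ.+ ℚ.- ℚ.1ℚ ℚ.* rowDot A y i          ≡⟨ minus (rowDot A x i) (rowDot A y i) ⟨
  rowDot A x i ℚ.- rowDot A y i                       ∎
  where
  open ≡-Reasoning
  minus : ∀ a b → a ℚ.- b ≡ a ℚ.+ ℚ.- ℚ.1ℚ ℚ.* b
  minus = solve 2 (λ a b → a :- b := a :+ con (ℚ.- ℚ.1ℚ) :* b) refl

rowDot-toℚ : ∀ {m n} (A : Mat ℤ m n) (z : Vect ℤ n) i → rowDot A (λ j → toℚ (z j)) i ≡ toℚ (mv A z i)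
rowDot-toℚ A z i = trans (Qs.S-cong (λ j → sym (toℚ-* (A i j) (z j)))) (sym (toℚ-sum (λ j → A i j ℤ.* z j)))

rowDot-scaled : ∀ {n} (M : Mat ℤ n n) d → (∀ i j → M i j ≡ d ℤ.* δ i j) → ∀ x i → rowDot M x i ≡ toℚ d ℚ.* x i
rowDot-scaled M d e x i = trans
  (Qs.S-single i (λ j → toℚ (M i j) ℚ.* x j) (λ j j≢i → trans (cong (λ w → toℚ w ℚ.* x j)
    (trans (e i j) (trans (cong (d ℤ.*_) (δ-≢ i j (j≢i ∘ sym))) (ℤₚ.*-zeroʳ d)))) (ℚₚ.*-zeroˡ (x j))))
  (cong (λ w → toℚ w ℚ.* x i) (trans (e i i) (trans (cong (d ℤ.*_) (δ-≡ i)) (ℤₚ.*-identityʳ d))))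

rowDot-δ : ∀ {n} (M : Mat ℤ n n) → (∀ i j → M i j ≡ δ i j) → ∀ x i → rowDot M x i ≡ x i
rowDot-δ M e x i = trans (rowDot-scaled M (+ 1) (λ i j → trans (e i j) (sym (ℤₚ.*-identityˡ (δ i j)))) x i) (ℚₚ.*-identityˡ (x i))

-- Integer equivalence

-- A' x ≤ b' arises from A x ≤ b by permuting the rows and substituting W x - z for x.
record Reach {n} (A : Mat ℤ (suc n) n) (b : Vect ℤ (suc n)) (A' : Mat ℤ (suc n) n) (b' : Vect ℤ (suc n)) : Set where
  field
    W : GL n
    z : Vect ℤ n
    π : Permutation′ (suc n)
    A-eq : ∀ i j → A' i j ≡ (A ⊗ to W) (π ⟨$⟩ʳ i) j
    b-eq : ∀ i → b' i ≡ b (π ⟨$⟩ʳ i) ℤ.+ mv A z (π ⟨$⟩ʳ i)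

reach-trans : ∀ {n} {A : Mat ℤ (suc n) n} {b A' b' A'' b''} → Reach A b A' b' → Reach A' b' A'' b'' → Reach A b A'' b''
reach-trans {n} {A} {b} {A'} {b'} {A''} {b''} r r' = record
  { W = gl-comp R.W R'.W ; z = λ i → R.z i ℤ.+ mv (to R.W) R'.z i ; π = R'.π Perm.∘ₚ R.π
  ; A-eq = λ i j → begin
      A'' i j ≡⟨ R'.A-eq i j ⟩
      (A' ⊗ to R'.W) (R'.π ⟨$⟩ʳ i) j ≡⟨ Zs.S-cong (λ k → cong (ℤ._* to R'.W k j) (R.A-eq (R'.π ⟨$⟩ʳ i) k)) ⟩
      ((A ⊗ to R.W) ⊗ to R'.W) (R.π ⟨$⟩ʳ (R'.π ⟨$⟩ʳ i)) j ≡⟨ ⊗-assoc A (to R.W) (to R'.W) (R.π ⟨$⟩ʳ (R'.π ⟨$⟩ʳ i)) j ⟨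
      (A ⊗ (to R.W ⊗ to R'.W)) (R.π ⟨$⟩ʳ (R'.π ⟨$⟩ʳ i)) j ∎
  ; b-eq = λ i → let p = R'.π ⟨$⟩ʳ i ; q = R.π ⟨$⟩ʳ p in begin
      b'' i ≡⟨ R'.b-eq i ⟩
      b' p ℤ.+ mv A' R'.z p ≡⟨ cong₂ ℤ._+_ (R.b-eq p) (Zs.S-cong (λ k → cong (ℤ._* R'.z k) (R.A-eq p k))) ⟩
      b q ℤ.+ mv A R.z q ℤ.+ mv (A ⊗ to R.W) R'.z q ≡⟨ cong (λ w → b q ℤ.+ mv A R.z q ℤ.+ w) (mv-⊗ A (to R.W) R'.z q) ⟨
      b q ℤ.+ mv A R.z q ℤ.+ mv A (mv (to R.W) R'.z) q ≡⟨ ℤₚ.+-assoc (b q) (mv A R.z q) (mv A (mv (to R.W) R'.z) q) ⟩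
      b q ℤ.+ (mv A R.z q ℤ.+ mv A (mv (to R.W) R'.z) q) ≡⟨ cong (λ w → b q ℤ.+ w) (mv-+ A R.z (mv (to R.W) R'.z) q) ⟨
      b q ℤ.+ mv A (λ i → R.z i ℤ.+ mv (to R.W) R'.z i) q ∎ }
  where
  module R = Reach r
  module R' = Reach r'
  open ≡-Reasoning
  mv-+ : ∀ {m n} (A : Mat ℤ m n) (x y : Vect ℤ n) i → mv A (λ j → x j ℤ.+ y j) i ≡ mv A x i ℤ.+ mv A y i
  mv-+ A x y i = trans (Zs.S-cong (λ j → ℤₚ.*-distribˡ-+ (A i j) (x j) (y j))) (Zs.S-+ (λ j → A i j ℤ.* x j) (λ j → A i j ℤ.* y j))

mv-0 : ∀ {m n} (A : Mat ℤ m n) i → mv A (λ _ → + 0) i ≡ + 0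
mv-0 A i = Zs.S-0 (λ j → A i j ℤ.* + 0) (λ j → ℤₚ.*-zeroʳ (A i j))

reach-cong : ∀ {n} {A A' : Mat ℤ (suc n) n} {b b'} → (∀ i j → A' i j ≡ A i j) → (∀ i → b' i ≡ b i) → Reach A b A' b'
reach-cong {A = A} {b = b} e e' = record
  { W = gl-id ; z = λ _ → + 0 ; π = Perm.id
  ; A-eq = λ i j → trans (e i j) (sym (⊗-identityʳ A i j))
  ; b-eq = λ i → trans (e' i) (sym (trans (cong (λ w → b i ℤ.+ w) (mv-0 A i)) (ℤₚ.+-identityʳ (b i)))) }

reach-rows : ∀ {n} (A : Mat ℤ (suc n) n) b (π : Permutation′ (suc n)) → Reach A b (λ i → A (π ⟨$⟩ʳ i)) (λ i → b (π ⟨$⟩ʳ i))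
reach-rows A b π = record
  { W = gl-id ; z = λ _ → + 0 ; π = π
  ; A-eq = λ i j → sym (⊗-identityʳ A (π ⟨$⟩ʳ i) j)
  ; b-eq = λ i → sym (trans (cong (λ w → b (π ⟨$⟩ʳ i) ℤ.+ w) (mv-0 A (π ⟨$⟩ʳ i))) (ℤₚ.+-identityʳ (b (π ⟨$⟩ʳ i)))) }

reach-columns : ∀ {n} (A : Mat ℤ (suc n) n) b (W : GL n) → Reach A b (A ⊗ to W) b
reach-columns A b W = record
  { W = W ; z = λ _ → + 0 ; π = Perm.id
  ; A-eq = λ i j → refl
  ; b-eq = λ i → sym (trans (cong (λ w → b i ℤ.+ w) (mv-0 A i)) (ℤₚ.+-identityʳ (b i))) }

reach-shift : ∀ {n} (A : Mat ℤ (suc n) n) b z → Reach A b A (λ i → b i ℤ.+ mv A z i)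
reach-shift A b z = record
  { W = gl-id ; z = z ; π = Perm.id ; A-eq = λ i j → sym (⊗-identityʳ A i j) ; b-eq = λ i → refl }

reach-conjugate : ∀ {n} (A : Mat ℤ (suc n) n) b (σ : Permutation′ n) →
  Reach A b (λ i j → A (Perm.lift₀ σ ⟨$⟩ʳ i) (σ ⟨$⟩ʳ j)) (λ i → b (Perm.lift₀ σ ⟨$⟩ʳ i))
reach-conjugate A b σ = reach-trans (reach-rows A b (Perm.lift₀ σ)) (reach-trans (reach-columns A₁ b₁ (gl-perm σ))
  (reach-cong (λ i j → sym (⊗-identityʳ A₁ i (σ ⟨$⟩ʳ j))) (λ i → refl)))
  where
  A₁ = λ i → A (Perm.lift₀ σ ⟨$⟩ʳ i)
  b₁ = λ i → b (Perm.lift₀ σ ⟨$⟩ʳ i)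

gl-rows : ∀ {n} → Permutation′ n → GL n
gl-rows π = record
  { to = λ i j → δ (π ⟨$⟩ʳ i) j ; from = λ i j → δ (π ⟨$⟩ˡ i) j
  ; to-from = λ i j → trans (⊗-identityˡ (λ i j → δ (π ⟨$⟩ˡ i) j) (π ⟨$⟩ʳ i) j) (cong (λ k → δ k j) (Perm.inverseˡ π))
  ; from-to = λ i j → trans (⊗-identityˡ (λ i j → δ (π ⟨$⟩ʳ i) j) (π ⟨$⟩ˡ i) j) (cong (λ k → δ k j) (Perm.inverseʳ π)) }

det-rows : ∀ n (M : Mat ℤ n n) (π : Permutation′ n) → ∣ det n (λ i → M (π ⟨$⟩ʳ i)) ∣ ≡ ∣ det n M ∣
det-rows n M π = trans (cong ∣_∣ (trans (det-cong n (λ i j → sym (⊗-identityˡ M (π ⟨$⟩ʳ i) j)))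
    (trans (det-⊗ n (to (gl-rows π)) M) (ℤₚ.*-comm (det n (to (gl-rows π))) (det n M)))))
  (abs-unit (det n M) (det n (to (gl-rows π))) (gl-det (gl-rows π)))

InP-cong : ∀ {m n} (A : Mat ℤ m n) b {x x'} → (∀ l → x l ≡ x' l) → InP A b x → InP A b x'
InP-cong A b e h i = subst (ℚ._≤ toℚ (b i)) (rowDot-congʳ A i e) (h i)

module _ {n} {A : Mat ℤ (suc n) n} {b A' b'} (r : Reach A b A' b') where
  open Reach r

  -- Deleting row i after permuting by π is deleting row π i and permuting the rest by
  -- `Perm.remove i π`; neither that permutation nor W changes the absolute value.
  reach-minor : ∀ i → ∣ det n (delRow A' i) ∣ ≡ ∣ det n (delRow A (π ⟨$⟩ʳ i)) ∣
  reach-minor i = begin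
    ∣ det n (delRow A' i) ∣
      ≡⟨ cong ∣_∣ (det-cong n (λ r c → trans (A-eq (punchIn i r) c)
           (cong (λ k → (A ⊗ to W) k c) (Perm.punchIn-permute π i r)))) ⟩
    ∣ det n (λ r → (delRow A (π ⟨$⟩ʳ i) ⊗ to W) (Perm.remove i π ⟨$⟩ʳ r)) ∣
      ≡⟨ det-rows n (delRow A (π ⟨$⟩ʳ i) ⊗ to W) (Perm.remove i π) ⟩
    ∣ det n (delRow A (π ⟨$⟩ʳ i) ⊗ to W) ∣
      ≡⟨ det-⊗-GL n (delRow A (π ⟨$⟩ʳ i)) W ⟩
    ∣ det n (delRow A (π ⟨$⟩ʳ i)) ∣ ∎
    where open ≡-Reasoning

  private
    Q = from W

  back : Vect ℚ n → Vect ℚ n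
  back y l = rowDot (to W) y l ℚ.- toℚ (z l)

  -- The inverse of the substitution y ↦ W y - z, in the shape that `IntEquiv` asks for: matrix W⁻¹
  -- and translation W⁻¹ z.
  forth : Vect ℚ n → Vect ℚ n
  forth = applyAff Q (mv Q z)

  back-forth : ∀ x l → back (forth x) l ≡ x l
  back-forth x l = begin
    rowDot (to W) (λ i → rowDot Q x i ℚ.+ toℚ (mv Q z i)) l ℚ.- toℚ (z l)
      ≡⟨ cong (ℚ._- toℚ (z l)) (rowDot-+ (to W) (rowDot Q x) (λ i → toℚ (mv Q z i)) l) ⟩
    rowDot (to W) (rowDot Q x) l ℚ.+ rowDot (to W) (λ i → toℚ (mv Q z i)) l ℚ.- toℚ (z l)
      ≡⟨ cong₂ (λ u v → u ℚ.+ v ℚ.- toℚ (z l)) (trans (rowDot-⊗ (to W) Q x l) (rowDot-δ (to W ⊗ Q) (to-from W) x l))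
           (trans (rowDot-congʳ (to W) l (λ i → sym (rowDot-toℚ Q z i))) (trans (rowDot-⊗ (to W) Q (λ i → toℚ (z i)) l) (rowDot-δ (to W ⊗ Q) (to-from W) (λ i → toℚ (z i)) l))) ⟩
    x l ℚ.+ toℚ (z l) ℚ.- toℚ (z l)
      ≡⟨ solve 2 (λ x z → x :+ z :- z := x) refl (x l) (toℚ (z l)) ⟩
    x l ∎
    where open ≡-Reasoning

  forth-back : ∀ y l → forth (back y) l ≡ y l
  forth-back y l = begin
    rowDot Q (λ i → rowDot (to W) y i ℚ.- toℚ (z i)) l ℚ.+ toℚ (mv Q z l)
      ≡⟨ cong (λ w → w ℚ.+ toℚ (mv Q z l)) (rowDot-- Q (rowDot (to W) y) (λ i → toℚ (z i)) l) ⟩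
    rowDot Q (rowDot (to W) y) l ℚ.- rowDot Q (λ i → toℚ (z i)) l ℚ.+ toℚ (mv Q z l)
      ≡⟨ cong₂ (λ u v → u ℚ.- v ℚ.+ toℚ (mv Q z l)) (trans (rowDot-⊗ Q (to W) y l) (rowDot-δ (Q ⊗ to W) (from-to W) y l)) (rowDot-toℚ Q z l) ⟩
    y l ℚ.- toℚ (mv Q z l) ℚ.+ toℚ (mv Q z l)
      ≡⟨ solve 2 (λ y w → y :- w :+ w := y) refl (y l) (toℚ (mv Q z l)) ⟩
    y l ∎
    where open ≡-Reasoning

  reach-row : ∀ y i → rowDot A (back y) (π ⟨$⟩ʳ i) ≡ rowDot A' y i ℚ.- toℚ (mv A z (π ⟨$⟩ʳ i))
  reach-row y i = trans (rowDot-- A (rowDot (to W) y) (λ l → toℚ (z l)) p)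
    (cong₂ ℚ._-_ (trans (rowDot-⊗ A (to W) y p) (rowDot-congˡ (A ⊗ to W) A' y p i (λ j → sym (A-eq i j)))) (rowDot-toℚ A z p))
    where p = π ⟨$⟩ʳ i

  b-row : ∀ i → toℚ (b (π ⟨$⟩ʳ i)) ≡ toℚ (b' i) ℚ.- toℚ (mv A z (π ⟨$⟩ʳ i))
  b-row i = sym (trans (cong (λ w → w ℚ.- toℚ (mv A z p)) (trans (cong toℚ (b-eq i)) (toℚ-+ (b p) (mv A z p))))
    (solve 2 (λ x z → x :+ z :- z := x) refl (toℚ (b p)) (toℚ (mv A z p))))
    where p = π ⟨$⟩ʳ i

  InP-back : ∀ {y} → InP A' b' y → InP A b (back y)
  InP-back {y} h k = subst (λ k → rowDot A (back y) k ℚ.≤ toℚ (b k)) (Perm.inverseʳ π {k})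
    (subst₂ ℚ._≤_ (sym (reach-row y i)) (sym (b-row i)) (ℚₚ.+-monoˡ-≤ (ℚ.- toℚ (mv A z (π ⟨$⟩ʳ i))) (h i)))
    where i = π ⟨$⟩ˡ k

  private
    shift-row : ∀ i u → u ℚ.- toℚ (mv A z (π ⟨$⟩ʳ i)) ℚ.+ toℚ (mv A z (π ⟨$⟩ʳ i)) ≡ u
    shift-row i u = solve 2 (λ u t → u :- t :+ t := u) refl u (toℚ (mv A z (π ⟨$⟩ʳ i)))

    row-forth : ∀ x i → rowDot A x (π ⟨$⟩ʳ i) ≡ rowDot A' (forth x) i ℚ.- toℚ (mv A z (π ⟨$⟩ʳ i))
    row-forth x i = trans (rowDot-congʳ A (π ⟨$⟩ʳ i) (λ l → sym (back-forth x l))) (reach-row (forth x) i)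

  InP-forth : ∀ {x} → InP A b x → InP A' b' (forth x)
  InP-forth {x} h i = subst₂ ℚ._≤_ (shift-row i (rowDot A' (forth x) i)) (shift-row i (toℚ (b' i)))
    (ℚₚ.+-monoˡ-≤ (toℚ (mv A z (π ⟨$⟩ʳ i))) (subst₂ ℚ._≤_ (row-forth x i) (b-row i) (h (π ⟨$⟩ʳ i))))

  InInt-forth : ∀ {x} → InInt A b x → InInt A' b' (forth x)
  InInt-forth {x} h i = subst₂ ℚ._<_ (shift-row i (rowDot A' (forth x) i)) (shift-row i (toℚ (b' i)))
    (ℚₚ.+-monoˡ-< (toℚ (mv A z (π ⟨$⟩ʳ i))) (subst₂ ℚ._<_ (row-forth x i) (b-row i) (h (π ⟨$⟩ʳ i))))

  unimodular : Unimodular Q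
  unimodular with det n Q in eq | gl-det (gl-inv W)
  ... | + .1          | refl = inj₁ refl
  ... | ℤ.-[1+ .0 ]   | refl = inj₂ refl

  reach-IntEquiv : IntEquiv (A , b) (A' , b')
  reach-IntEquiv = Q , mv Q z , unimodular , λ y → mk⇔
    (λ h → back y , InP-back h , forth-back y)
    (λ { (x , h , e) → InP-cong A' b' e (InP-forth h) })

  reach-IsSimplex : IsSimplex A b → IsSimplex A' b'
  reach-IsSimplex ((x , int) , R , bound) = (forth x , InInt-forth int) , R' , λ y h i → begin
    ℚ.∣ y i ∣
      ≡⟨ cong ℚ.∣_∣ (forth-back y i) ⟨
    ℚ.∣ rowDot Q (back y) i ℚ.+ toℚ (mv Q z i) ∣
      ≤⟨ ℚₚ.∣p+q∣≤∣p∣+∣q∣ (rowDot Q (back y) i) (toℚ (mv Q z i)) ⟩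
    ℚ.∣ rowDot Q (back y) i ∣ ℚ.+ ℚ.∣ toℚ (mv Q z i) ∣
      ≤⟨ ℚₚ.+-monoˡ-≤ ℚ.∣ toℚ (mv Q z i) ∣ (rowDot-bound Q (back y) R (bound (back y) (InP-back h)) i) ⟩
    term i
      ≤⟨ ≤-sumℚ term (λ j → ℚₚ.+-mono-≤ (rowBound-nonNeg Q R j) (ℚₚ.0≤∣p∣ (toℚ (mv Q z j)))) i ⟩
    R' ∎
    where
    open ℚₚ.≤-Reasoning
    term : Fin n → ℚ
    term i = rowBound Q R i ℚ.+ ℚ.∣ toℚ (mv Q z i) ∣
    R' = sumℚ term

  reach-IsEmptyS : IsEmptyS A b → IsEmptyS A' b'
  reach-IsEmptyS em (x , h) = em ((λ l → mv (to W) x l ℤ.- z l) , InP-cong A b e (InP-back h))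
    where
    e : ∀ l → back (λ j → toℚ (x j)) l ≡ toℚ (mv (to W) x l ℤ.- z l)
    e l = trans (cong₂ ℚ._+_ (rowDot-toℚ (to W) x l) (sym (toℚ-neg (z l)))) (sym (toℚ-+ (mv (to W) x l) (ℤ.- z l)))

  reach-EmptyΔModSimplex : ∀ {Δ} → EmptyΔModSimplex n Δ A b → EmptyΔModSimplex n Δ A' b'
  reach-EmptyΔModSimplex ((i , d≢0) , (≤Δ , (k , ≡Δ)) , simp , em) =
    (π ⟨$⟩ˡ i , λ e → d≢0 (ℤₚ.∣i∣≡0⇒i≡0 (trans (sym (minor-back i)) (cong ∣_∣ e)))) ,
    ((λ j → subst (ℕ._≤ _) (sym (reach-minor j)) (≤Δ (π ⟨$⟩ʳ j))) , (π ⟨$⟩ˡ k , trans (minor-back k) ≡Δ)) ,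
    reach-IsSimplex simp , reach-IsEmptyS em
    where
    minor-back : ∀ i → ∣ det n (delRow A' (π ⟨$⟩ˡ i)) ∣ ≡ ∣ det n (delRow A i) ∣
    minor-back i = trans (reach-minor (π ⟨$⟩ˡ i)) (cong (λ k → ∣ det n (delRow A k) ∣) (Perm.inverseʳ π))

-- Decidability through barycentric coordinates

archimedean : ∀ q → ∃[ k ] q ℚ.≤ toℚ (+ k)
archimedean q@(ℚ.mkℚ m d-1 _) = ∣ m ∣ , ℚₚ.toℚᵘ-cancel-≤ (ℚᵘₚ.≤-respʳ-≃ (ℚᵘₚ.≃-sym (toℚᵘ-toℚ (+ ∣ m ∣)))
  (ℚᵘ.*≤* (ℤₚ.≤-trans (ℤₚ.≤-reflexive (ℤₚ.*-identityʳ m)) (ℤₚ.≤-trans (i≤∣i∣ m) (ℤₚ.≤-trans (ℤₚ.≤-reflexive (sym (ℤₚ.*-identityʳ (+ ∣ m ∣))))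
    (ℤₚ.*-monoˡ-≤-nonNeg (+ ∣ m ∣) (ℤ.+≤+ (ℕ.s≤s (ℕ.z≤n {d-1})))))))))
  where
  i≤∣i∣ : ∀ i → i ℤ.≤ + ∣ i ∣
  i≤∣i∣ (+ n)      = ℤₚ.≤-refl
  i≤∣i∣ ℤ.-[1+ n ] = ℤ.-≤+

reciprocal : ∀ m → ∃[ q ] ℚ.0ℚ ℚ.< q × toℚ (+ suc m) ℚ.* q ≡ ℚ.1ℚ
reciprocal m = q , ℚₚ.toℚᵘ-cancel-< (ℚᵘₚ.<-respʳ-≃ (ℚᵘₚ.≃-sym (ℚₚ.toℚᵘ-fromℚᵘ (mkℚᵘ (+ 1) m))) (ℚᵘ.*<* (ℤ.+<+ (ℕ.s≤s ℕ.z≤n)))) ,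
  ℚₚ.toℚᵘ-injective (begin
    ℚ.toℚᵘ (toℚ (+ suc m) ℚ.* q)            ≈⟨ ℚₚ.toℚᵘ-homo-* (toℚ (+ suc m)) q ⟩
    ℚ.toℚᵘ (toℚ (+ suc m)) ℚᵘ.* ℚ.toℚᵘ q    ≈⟨ ℚᵘₚ.*-cong (toℚᵘ-toℚ (+ suc m)) (ℚₚ.toℚᵘ-fromℚᵘ (mkℚᵘ (+ 1) m)) ⟩
    mkℚᵘ (+ suc m) 0 ℚᵘ.* mkℚᵘ (+ 1) m      ≈⟨ ℚᵘ.*≡* (ring (+ suc m)) ⟩
    ℚ.toℚᵘ ℚ.1ℚ                             ∎)
  where
  q = + 1 ℚ./ suc m
  open ℚᵘₚ.≃-Reasoning
  ring : ∀ x → x ℤ.* + 1 ℤ.* + 1 ≡ + 1 ℤ.* (+ 1 ℤ.* x)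
  ring = ℤS.solve-∀

-- Exhaustive search of a box, one coordinate at a time. A vector found elsewhere agrees only
-- pointwise with the one rebuilt as `value k ∷ x`, hence the condition that `P` respects pointwise
-- equality.
search : ∀ n N (P : Vect ℤ n → Set) → (∀ {x y} → (∀ i → x i ≡ y i) → P x → P y) → (∀ x → Dec (P x)) →
         Dec (∃[ x ] (∀ i → ∣ x i ∣ ℕ.≤ N) × P x)
search zero N P resp P? with P? (λ ())
... | yes p = yes ((λ ()) , (λ ()) , p)
... | no ¬p = no (λ { (x , _ , p) → ¬p (resp (λ ()) p) })
search (suc n) N P resp P? = map′ fwd bwd (Finₚ.any? heads)
  where
  N' = N ℕ.+ N
  value : Fin (suc N') → ℤ
  value k = toℕ k ℤ.⊖ N
  heads : ∀ k → Dec (∃[ x ] (∀ i → ∣ x i ∣ ℕ.≤ N) × ∣ value k ∣ ℕ.≤ N × P (value k ∷ x))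
  heads k = search n N (λ x → ∣ value k ∣ ℕ.≤ N × P (value k ∷ x))
    (λ e (le , p) → le , resp (λ { zero → refl ; (suc i) → e i }) p)
    (λ x → (∣ value k ∣ ℕ.≤? N) ×-dec P? (value k ∷ x))
  fwd : (∃[ k ] ∃[ x ] (∀ i → ∣ x i ∣ ℕ.≤ N) × ∣ value k ∣ ℕ.≤ N × P (value k ∷ x)) → ∃[ x ] (∀ i → ∣ x i ∣ ℕ.≤ N) × P x
  fwd (k , x , le , le₀ , p) = value k ∷ x , (λ { zero → le₀ ; (suc i) → le i }) , p
  shift : ∀ z → ∣ z ∣ ℕ.≤ N → ∃[ k ] value k ≡ z
  shift (+ m) le = Fin.fromℕ< (ℕ.s≤s (ℕₚ.+-monoˡ-≤ N le)) , trans (cong (ℤ._⊖ N) (Finₚ.toℕ-fromℕ< _)) (trans (ℤₚ.⊖-≥ (ℕₚ.m≤n+m N m)) (cong +_ (ℕₚ.m+n∸n≡m m N)))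
  shift ℤ.-[1+ m ] le = Fin.fromℕ< (ℕ.s≤s (ℕₚ.≤-trans (ℕₚ.m∸n≤m N (suc m)) (ℕₚ.m≤m+n N N))) , trans (cong (ℤ._⊖ N) (Finₚ.toℕ-fromℕ< _))
    (trans (ℤₚ.⊖-≤ (ℕₚ.m∸n≤m N (suc m))) (cong (λ k → ℤ.- (+ k)) (ℕₚ.m∸[m∸n]≡n le)))
  bwd : (∃[ x ] (∀ i → ∣ x i ∣ ℕ.≤ N) × P x) → ∃[ k ] ∃[ x ] (∀ i → ∣ x i ∣ ℕ.≤ N) × ∣ value k ∣ ℕ.≤ N × P (value k ∷ x)
  bwd (x , le , p) with shift (x zero) (le zero)
  ... | k , e = k , (λ i → x (suc i)) , (λ i → le (suc i)) , subst (λ z → ∣ z ∣ ℕ.≤ N) (sym e) (le zero) ,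
    resp (λ { zero → sym e ; (suc i) → refl }) p

sumℤ-mono : ∀ {n} (f g : Fin n → ℤ) → (∀ i → f i ℤ.≤ g i) → sumℤ f ℤ.≤ sumℤ g
sumℤ-mono {zero}  f g e = ℤₚ.≤-refl
sumℤ-mono {suc n} f g e = ℤₚ.+-mono-≤ (e zero) (sumℤ-mono (λ i → f (suc i)) (λ i → g (suc i)) (λ i → e (suc i)))

-- The simplex is described by the barycentric data τ of the first row: Δ c = - Σ τᵢ Bᵢ where c is the
-- first row of A and B consists of the others.
module Barycentric {n} (A : Mat ℤ (suc n) n) (b : Vect ℤ (suc n)) (Δ : ℕ) (1≤Δ : 1 ℕ.≤ Δ)
  (d≡ : ∣ det n (delRow A zero) ∣ ≡ Δ) where

  B : Mat ℤ n n
  B = delRow A zero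

  d≢0 : ∣ det n B ∣ ≢ 0
  d≢0 e = ℕₚ.1+n≰n (subst (1 ℕ.≤_) (trans (sym d≡) e) 1≤Δ)

  B-adj : Adjugate B (+ Δ)
  B-adj = subst (λ k → Adjugate B (+ k)) d≡ (adjugate B d≢0)

  V : Mat ℤ n n
  V = adj B-adj

  -τ : Vect ℤ n
  -τ = vm (A zero) V

  τ : Vect ℤ n
  τ i = ℤ.- -τ i

  -- The weighted sum Δ (b₀ - c x) + Σ τᵢ (bᵢ - Bᵢ x) of the slacks, which has this value at every
  -- point x because Δ c = - Σ τᵢ Bᵢ.
  gap : ℤ
  gap = + Δ ℤ.* b zero ℤ.+ sumℤ (λ i → τ i ℤ.* b (suc i))

  row-relation : ∀ j → + Δ ℤ.* A zero j ≡ sumℤ (λ i → -τ i ℤ.* B i j)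
  row-relation j = sym (trans (sym (vm-⊗ (A zero) V B j)) (trans (Zs.S-cong (λ k → trans (cong (A zero k ℤ.*_) (adj-⊗ B-adj k j)) (ring (A zero k) (+ Δ) (δ k j))))
    (trans (sym (Zs.S-*ˡ (+ Δ) (λ k → A zero k ℤ.* δ k j))) (cong (+ Δ ℤ.*_) (⊗-identityʳ (λ (_ : Fin 1) → A zero) zero j)))))
    where
    ring : ∀ x d y → x ℤ.* (d ℤ.* y) ≡ d ℤ.* (x ℤ.* y)
    ring = ℤS.solve-∀

  row-relationℚ : ∀ x → toℚ (+ Δ) ℚ.* rowDot A x zero ≡ ℚ.- sumℚ (λ i → toℚ (τ i) ℚ.* rowDot A x (suc i))
  row-relationℚ x = begin
    toℚ (+ Δ) ℚ.* rowDot A x zero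
      ≡⟨ Qs.S-*ˡ (toℚ (+ Δ)) (λ j → toℚ (A zero j) ℚ.* x j) ⟩
    sumℚ (λ j → toℚ (+ Δ) ℚ.* (toℚ (A zero j) ℚ.* x j))
      ≡⟨ Qs.S-cong (λ j → trans (sym (ℚₚ.*-assoc (toℚ (+ Δ)) (toℚ (A zero j)) (x j))) (cong (ℚ._* x j) (trans (sym (toℚ-* (+ Δ) (A zero j))) (cong toℚ (row-relation j))))) ⟩
    rowDot (T ⊗ B) x zero
      ≡⟨ rowDot-⊗ T B x zero ⟨
    rowDot T (rowDot B x) zero
      ≡⟨ Qs.S-cong (λ i → trans (cong (λ w → toℚ w ℚ.* rowDot B x i) (sym (ℤₚ.neg-involutive (-τ i)))) (trans (cong (ℚ._* rowDot B x i) (toℚ-neg (τ i)))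
           (solve 2 (λ t y → :- t :* y := con (ℚ.- ℚ.1ℚ) :* (t :* y)) refl (toℚ (τ i)) (rowDot B x i)))) ⟩
    sumℚ (λ i → ℚ.- ℚ.1ℚ ℚ.* (toℚ (τ i) ℚ.* rowDot A x (suc i)))
      ≡⟨ Qs.S-*ˡ (ℚ.- ℚ.1ℚ) (λ i → toℚ (τ i) ℚ.* rowDot A x (suc i)) ⟨
    ℚ.- ℚ.1ℚ ℚ.* sumℚ (λ i → toℚ (τ i) ℚ.* rowDot A x (suc i))
      ≡⟨ solve 1 (λ y → con (ℚ.- ℚ.1ℚ) :* y := :- y) refl (sumℚ (λ i → toℚ (τ i) ℚ.* rowDot A x (suc i))) ⟩
    ℚ.- sumℚ (λ i → toℚ (τ i) ℚ.* rowDot A x (suc i)) ∎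
    where
    open ≡-Reasoning
    T : Mat ℤ 1 n
    T _ i = -τ i

  gap-toℚ : toℚ gap ≡ toℚ (+ Δ) ℚ.* toℚ (b zero) ℚ.+ sumℚ (λ i → toℚ (τ i) ℚ.* toℚ (b (suc i)))
  gap-toℚ = trans (toℚ-+ (+ Δ ℤ.* b zero) (sumℤ (λ i → τ i ℤ.* b (suc i)))) (cong₂ ℚ._+_ (toℚ-* (+ Δ) (b zero))
    (trans (toℚ-sum (λ i → τ i ℤ.* b (suc i))) (Qs.S-cong (λ i → toℚ-* (τ i) (b (suc i))))))

  V-column : ∀ i k → mv B (λ l → ℤ.- V l i) k ≡ ℤ.- (+ Δ ℤ.* δ k i)
  V-column i k = trans (mv-neg B (λ l → V l i) k) (cong ℤ.-_ (⊗-adj B-adj k i))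
    where
    mv-neg : ∀ {m n} (M : Mat ℤ m n) x i → mv M (λ l → ℤ.- x l) i ≡ ℤ.- mv M x i
    mv-neg M x i = trans (Zs.S-cong (λ l → ring (M i l) (x l))) (trans (sym (Zs.S-*ˡ (ℤ.- + 1) (λ l → M i l ℤ.* x l))) (ℤₚ.-1*i≡-i (mv M x i)))
      where
      ring : ∀ a x → a ℤ.* ℤ.- x ≡ ℤ.- + 1 ℤ.* (a ℤ.* x)
      ring = ℤS.solve-∀

  V-column₀ : ∀ i → mv A (λ l → ℤ.- V l i) zero ≡ τ i
  V-column₀ i = trans (Zs.S-cong (λ l → ring (A zero l) (V l i))) (trans (sym (Zs.S-*ˡ (ℤ.- + 1) (λ l → A zero l ℤ.* V l i))) (ℤₚ.-1*i≡-i (-τ i)))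
    where
    ring : ∀ a x → a ℤ.* ℤ.- x ≡ ℤ.- + 1 ℤ.* (a ℤ.* x)
    ring = ℤS.solve-∀

  -- If τ i ≤ 0 then minus the i-th column of V is a direction of recession.
  simplex⇒0<τ : IsSimplex A b → ∀ i → + 0 ℤ.< τ i
  simplex⇒0<τ ((x₀ , int) , R , bound) i = ℤₚ.≰⇒> λ τ≤0 →
    ℚₚ.<-irrefl refl (ℚₚ.<-≤-trans (toℚ-mono-< (ℤ.+<+ (ℕₚ.n<1+n m))) (ℚₚ.≤-trans (big τ≤0) q≤m))
    where
    open ℚₚ.≤-Reasoning
    v : Vect ℤ n
    v l = ℤ.- V l i
    y = rowDot A x₀ (suc i)
    -- The step k v changes the i-th inequality of B by - k Δ. Boundedness would force k Δ ≤ q, so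
    -- any k larger than q gives the contradiction.
    q = ℚ.∣ y ∣ ℚ.+ rowBound A R (suc i)
    m = proj₁ (archimedean q)
    q≤m = proj₂ (archimedean q)
    k = toℚ (+ suc m)
    x : Vect ℚ n
    x l = x₀ l ℚ.+ k ℚ.* toℚ (v l)
    row : ∀ r → rowDot A x r ≡ rowDot A x₀ r ℚ.+ k ℚ.* toℚ (mv A v r)
    row r = trans (rowDot-+ A x₀ (λ l → k ℚ.* toℚ (v l)) r) (cong (λ w → rowDot A x₀ r ℚ.+ w)
      (trans (rowDot-* A k (λ l → toℚ (v l)) r) (cong (k ℚ.*_) (rowDot-toℚ A v r))))
    recedes : τ i ℤ.≤ + 0 → ∀ r → mv A v r ℤ.≤ + 0
    recedes τ≤0 zero    = ℤₚ.≤-trans (ℤₚ.≤-reflexive (V-column₀ i)) τ≤0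
    recedes τ≤0 (suc r) = ℤₚ.≤-trans (ℤₚ.≤-reflexive (V-column i r)) (ℤₚ.neg-mono-≤ (nn r i))
      where
      nn : ∀ {n} (r i : Fin n) → + 0 ℤ.≤ + Δ ℤ.* δ r i
      nn zero    zero    = subst (+ 0 ℤ.≤_) (sym (ℤₚ.*-identityʳ (+ Δ))) (ℤ.+≤+ ℕ.z≤n)
      nn zero    (suc i) = ℤₚ.≤-reflexive (sym (ℤₚ.*-zeroʳ (+ Δ)))
      nn (suc r) zero    = ℤₚ.≤-reflexive (sym (ℤₚ.*-zeroʳ (+ Δ)))
      nn (suc r) (suc i) = nn r i
    inside : τ i ℤ.≤ + 0 → InP A b x
    inside τ≤0 r = begin
      rowDot A x r                                ≡⟨ row r ⟩
      rowDot A x₀ r ℚ.+ k ℚ.* toℚ (mv A v r)      ≤⟨ ℚₚ.+-mono-≤ (ℚₚ.<⇒≤ (int r)) (ℚₚ.≤-reflexive (sym (toℚ-* (+ suc m) (mv A v r)))) ⟩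
      toℚ (b r) ℚ.+ toℚ (+ suc m ℤ.* mv A v r)    ≤⟨ ℚₚ.+-monoʳ-≤ (toℚ (b r)) (toℚ-mono-≤ (ℤₚ.≤-trans (ℤₚ.*-monoˡ-≤-nonNeg (+ suc m) (recedes τ≤0 r)) (ℤₚ.≤-reflexive (ℤₚ.*-zeroʳ (+ suc m))))) ⟩
      toℚ (b r) ℚ.+ toℚ (+ 0)                     ≡⟨ ℚₚ.+-identityʳ (toℚ (b r)) ⟩
      toℚ (b r)                                   ∎
    big : τ i ℤ.≤ + 0 → k ℚ.≤ q
    big τ≤0 = begin
      toℚ (+ suc m)                                  ≤⟨ toℚ-mono-≤ (ℤ.+≤+ (ℕₚ.m≤m*n (suc m) Δ {{ℕ.>-nonZero 1≤Δ}})) ⟩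
      toℚ (+ (suc m ℕ.* Δ))                          ≡⟨ cong toℚ (ℤₚ.pos-* (suc m) Δ) ⟩
      toℚ (+ suc m ℤ.* + Δ)                          ≡⟨ toℚ-* (+ suc m) (+ Δ) ⟩
      k ℚ.* toℚ (+ Δ)                                ≡⟨ solve 3 (λ y k d → k :* d := y :+ :- (y :+ k :* (:- d))) refl y k (toℚ (+ Δ)) ⟩
      y ℚ.- (y ℚ.+ k ℚ.* (ℚ.- toℚ (+ Δ)))            ≡⟨ cong (λ w → y ℚ.- w) (sym (trans (row (suc i)) (cong (λ w → y ℚ.+ k ℚ.* w) (trans (cong toℚ (trans (V-column i i) (cong (λ w → ℤ.- (+ Δ ℤ.* w)) (δ-≡ i)))) (trans (cong (λ w → toℚ (ℤ.- w)) (ℤₚ.*-identityʳ (+ Δ))) (toℚ-neg (+ Δ))))))) ⟩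
      y ℚ.- rowDot A x (suc i)                       ≤⟨ p≤∣p∣ (y ℚ.- rowDot A x (suc i)) ⟩
      ℚ.∣ y ℚ.- rowDot A x (suc i) ∣                 ≤⟨ ℚₚ.∣p-q∣≤∣p∣+∣q∣ y (rowDot A x (suc i)) ⟩
      ℚ.∣ y ∣ ℚ.+ ℚ.∣ rowDot A x (suc i) ∣           ≤⟨ ℚₚ.+-monoʳ-≤ ℚ.∣ y ∣ (rowDot-bound A x R (bound x (inside τ≤0)) (suc i)) ⟩
      q                                              ∎

  toℚ-nonNeg : ∀ {z} → + 0 ℤ.≤ z → ℚ.NonNegative (toℚ z)
  toℚ-nonNeg le = ℚ.nonNegative (toℚ-mono-≤ le)

  toℚ-pos : ∀ {z} → + 0 ℤ.< z → ℚ.Positive (toℚ z)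
  toℚ-pos lt = ℚ.positive (toℚ-mono-< lt)

  0<Δ : + 0 ℤ.< + Δ
  0<Δ = ℤ.+<+ 1≤Δ

  interior⇒0<gap : (∀ i → + 0 ℤ.< τ i) → ∃[ x ] InInt A b x → + 0 ℤ.< gap
  interior⇒0<gap 0<τ (x , int) = toℚ-cancel-< (begin-strict
    ℚ.0ℚ
      ≡⟨ ℚₚ.+-inverseˡ Y ⟨
    ℚ.- Y ℚ.+ Y
      ≡⟨ cong (ℚ._+ Y) (sym (row-relationℚ x)) ⟩
    toℚ (+ Δ) ℚ.* rowDot A x zero ℚ.+ Y
      <⟨ ℚₚ.+-mono-<-≤ (ℚₚ.*-monoʳ-<-pos (toℚ (+ Δ)) {{toℚ-pos 0<Δ}} (int zero))
           (sumℚ-mono (λ i → toℚ (τ i) ℚ.* rowDot A x (suc i)) (λ i → toℚ (τ i) ℚ.* toℚ (b (suc i)))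
             (λ i → ℚₚ.*-monoˡ-≤-nonNeg (toℚ (τ i)) {{toℚ-nonNeg (ℤₚ.<⇒≤ (0<τ i))}} (ℚₚ.<⇒≤ (int (suc i))))) ⟩
    toℚ (+ Δ) ℚ.* toℚ (b zero) ℚ.+ sumℚ (λ i → toℚ (τ i) ℚ.* toℚ (b (suc i)))
      ≡⟨ gap-toℚ ⟨
    toℚ gap ∎)
    where
    open ℚₚ.≤-Reasoning
    Y = sumℚ (λ i → toℚ (τ i) ℚ.* rowDot A x (suc i))

  -- The interior point is obtained by moving all the inequalities of B inwards by 1 / (1 + Σ τ).
  interior : (∀ i → + 0 ℤ.< τ i) → + 0 ℤ.< gap → ∃[ x ] InInt A b x
  interior 0<τ 0<gap = x , inside
    where
    t N : ℤ
    t = sumℤ τ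
    N = + 1 ℤ.+ t
    0≤t : + 0 ℤ.≤ t
    0≤t = ℤₚ.≤-trans (ℤₚ.≤-reflexive (sym (Zs.S-0 {n} (λ _ → + 0) (λ _ → refl)))) (sumℤ-mono (λ _ → + 0) τ (λ i → ℤₚ.<⇒≤ (0<τ i)))
    0<N : + 0 ℤ.< N
    0<N = ℤₚ.+-mono-<-≤ (ℤ.+<+ (ℕ.s≤s ℕ.z≤n)) 0≤t
    t<N : t ℤ.< N
    t<N = subst (ℤ._< N) (ℤₚ.+-identityˡ t) (ℤₚ.+-monoˡ-< t (ℤ.+<+ (ℕ.s≤s ℕ.z≤n)))
    0<ΔN : + 0 ℤ.< + Δ ℤ.* N
    0<ΔN = subst (ℤ._< + Δ ℤ.* N) (ℤₚ.*-zeroʳ (+ Δ)) (ℤₚ.*-monoˡ-<-pos (+ Δ) {{ℤ.positive 0<Δ}} 0<N)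
    w u : Vect ℤ n
    w i = N ℤ.* b (suc i) ℤ.- + 1
    u = mv V w
    recip : ∀ z → + 0 ℤ.< z → ∃[ q ] ℚ.0ℚ ℚ.< q × toℚ z ℚ.* q ≡ ℚ.1ℚ
    recip (+ suc m) _ = reciprocal m
    recip (+ zero) (ℤ.+<+ ())
    q = proj₁ (recip (+ Δ ℤ.* N) 0<ΔN)
    0<q = proj₁ (proj₂ (recip (+ Δ ℤ.* N) 0<ΔN))
    q-inv = proj₂ (proj₂ (recip (+ Δ ℤ.* N) 0<ΔN))
    x : Vect ℚ n
    x l = q ℚ.* toℚ (u l)
    row-u : ∀ r → mv A u r ℤ.< + Δ ℤ.* N ℤ.* b r
    row-u (suc i) = begin-strict
      mv B (mv V w) i                    ≡⟨ mv-⊗ B V w i ⟩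
      mv (B ⊗ V) w i                     ≡⟨ mv-scaled (B ⊗ V) (+ Δ) (⊗-adj B-adj) w i ⟩
      + Δ ℤ.* (N ℤ.* b (suc i) ℤ.- + 1)  ≡⟨ ring (+ Δ) N (b (suc i)) ⟩
      + Δ ℤ.* N ℤ.* b (suc i) ℤ.- + Δ    <⟨ ℤₚ.+-monoʳ-< (+ Δ ℤ.* N ℤ.* b (suc i)) (ℤₚ.neg-mono-< 0<Δ) ⟩
      + Δ ℤ.* N ℤ.* b (suc i) ℤ.+ + 0    ≡⟨ ℤₚ.+-identityʳ (+ Δ ℤ.* N ℤ.* b (suc i)) ⟩
      + Δ ℤ.* N ℤ.* b (suc i)            ∎
      where
      open ℤₚ.≤-Reasoning
      ring : ∀ d N b → d ℤ.* (N ℤ.* b ℤ.- + 1) ≡ d ℤ.* N ℤ.* b ℤ.- d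
      ring = ℤS.solve-∀
    row-u zero = begin-strict
      mv A (mv V w) zero
        ≡⟨ Zs.S-assoc (A zero) V w ⟩
      sumℤ (λ i → -τ i ℤ.* w i)
        ≡⟨ Zs.S-cong (λ i → ring₁ (-τ i) N (b (suc i))) ⟩
      sumℤ (λ i → τ i ℤ.+ ℤ.- N ℤ.* (τ i ℤ.* b (suc i)))
        ≡⟨ Zs.S-+ τ (λ i → ℤ.- N ℤ.* (τ i ℤ.* b (suc i))) ⟩
      t ℤ.+ sumℤ (λ i → ℤ.- N ℤ.* (τ i ℤ.* b (suc i)))
        ≡⟨ cong (λ y → t ℤ.+ y) (Zs.S-*ˡ (ℤ.- N) (λ i → τ i ℤ.* b (suc i))) ⟨
      t ℤ.+ ℤ.- N ℤ.* S
        -- The gap is a positive integer, hence at least 1, and so t < N ≤ N · gap: the inward move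
        -- costs the first inequality less than the gap provides.
        <⟨ ℤₚ.+-monoˡ-< (ℤ.- N ℤ.* S) (ℤₚ.<-≤-trans (ℤₚ.<-≤-trans t<N (ℤₚ.≤-reflexive (sym (ℤₚ.*-identityʳ N)))) (ℤₚ.*-monoˡ-≤-nonNeg N {{ℤ.nonNegative (ℤₚ.<⇒≤ 0<N)}} (ℤₚ.i<j⇒suc[i]≤j 0<gap))) ⟩
      N ℤ.* gap ℤ.+ ℤ.- N ℤ.* S
        ≡⟨ ring₂ N (+ Δ) (b zero) S ⟩
      + Δ ℤ.* N ℤ.* b zero ∎
      where
      open ℤₚ.≤-Reasoning
      S = sumℤ (λ i → τ i ℤ.* b (suc i))
      ring₁ : ∀ m N b → m ℤ.* (N ℤ.* b ℤ.- + 1) ≡ ℤ.- m ℤ.+ ℤ.- N ℤ.* (ℤ.- m ℤ.* b)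
      ring₁ = ℤS.solve-∀
      ring₂ : ∀ N d b S → N ℤ.* (d ℤ.* b ℤ.+ S) ℤ.+ ℤ.- N ℤ.* S ≡ d ℤ.* N ℤ.* b
      ring₂ = ℤS.solve-∀
    inside : InInt A b x
    inside r = begin-strict
      rowDot A x r                             ≡⟨ rowDot-* A q (λ l → toℚ (u l)) r ⟩
      q ℚ.* rowDot A (λ l → toℚ (u l)) r       ≡⟨ cong (q ℚ.*_) (rowDot-toℚ A u r) ⟩
      q ℚ.* toℚ (mv A u r)                     <⟨ ℚₚ.*-monoʳ-<-pos q {{ℚ.positive 0<q}} (toℚ-mono-< (row-u r)) ⟩
      q ℚ.* toℚ (+ Δ ℤ.* N ℤ.* b r)            ≡⟨ cong (q ℚ.*_) (toℚ-* (+ Δ ℤ.* N) (b r)) ⟩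
      q ℚ.* (toℚ (+ Δ ℤ.* N) ℚ.* toℚ (b r))    ≡⟨ solve 3 (λ q d b → q :* (d :* b) := d :* q :* b) refl q (toℚ (+ Δ ℤ.* N)) (toℚ (b r)) ⟩
      toℚ (+ Δ ℤ.* N) ℚ.* q ℚ.* toℚ (b r)      ≡⟨ cong (ℚ._* toℚ (b r)) q-inv ⟩
      ℚ.1ℚ ℚ.* toℚ (b r)                       ≡⟨ ℚₚ.*-identityˡ (toℚ (b r)) ⟩
      toℚ (b r)                                ∎
      where open ℚₚ.≤-Reasoning

  -- As τᵢ ≥ 1 and no weighted slack is negative, each slack is at most `gap`. This bounds B x, and
  -- Δ x = V B x then bounds x.
  bounded : (∀ i → + 0 ℤ.< τ i) → ∃[ R ] ∀ x → InP A b x → ∀ j → ℚ.∣ x j ∣ ℚ.≤ R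
  bounded 0<τ = sumℚ (rowBound V Y) , λ x h l → begin
      ℚ.∣ x l ∣                            ≤⟨ scale x l ⟩
      ℚ.∣ rowDot V (rowDot B x) l ∣        ≤⟨ rowDot-bound V (rowDot B x) Y (row-bound x h) l ⟩
      rowBound V Y l                       ≤⟨ ≤-sumℚ (rowBound V Y) (rowBound-nonNeg V Y) l ⟩
      sumℚ (rowBound V Y)                  ∎
    where
    open ℚₚ.≤-Reasoning
    β : Fin n → ℚ
    β i = ℚ.∣ toℚ (b (suc i)) ∣
    Y = sumℚ β ℚ.+ toℚ gap
    scale : ∀ x l → ℚ.∣ x l ∣ ℚ.≤ ℚ.∣ rowDot V (rowDot B x) l ∣
    scale x l = begin
      ℚ.∣ x l ∣                            ≡⟨ ℚₚ.*-identityˡ ℚ.∣ x l ∣ ⟨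
      toℚ (+ 1) ℚ.* ℚ.∣ x l ∣              ≤⟨ ℚₚ.*-monoʳ-≤-nonNeg ℚ.∣ x l ∣ {{ℚₚ.∣-∣-nonNeg (x l)}} (ℚₚ.≤-trans (toℚ-mono-≤ (ℤ.+≤+ 1≤Δ)) (p≤∣p∣ (toℚ (+ Δ)))) ⟩
      ℚ.∣ toℚ (+ Δ) ∣ ℚ.* ℚ.∣ x l ∣        ≡⟨ ℚₚ.∣p*q∣≡∣p∣*∣q∣ (toℚ (+ Δ)) (x l) ⟨
      ℚ.∣ toℚ (+ Δ) ℚ.* x l ∣              ≡⟨ cong ℚ.∣_∣ (trans (rowDot-⊗ V B x l) (rowDot-scaled (V ⊗ B) (+ Δ) (adj-⊗ B-adj) x l)) ⟨
      ℚ.∣ rowDot V (rowDot B x) l ∣        ∎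
    module _ (x : Vect ℚ n) (h : InP A b x) where
      s : Fin n → ℚ
      s i = toℚ (b (suc i)) ℚ.- rowDot A x (suc i)
      0≤s : ∀ i → ℚ.0ℚ ℚ.≤ s i
      0≤s i = subst (ℚ._≤ s i) (ℚₚ.+-inverseʳ (rowDot A x (suc i))) (ℚₚ.+-monoˡ-≤ (ℚ.- rowDot A x (suc i)) (h (suc i)))
      τs : Fin n → ℚ
      τs i = toℚ (τ i) ℚ.* s i
      s≤τs : ∀ i → s i ℚ.≤ τs i
      s≤τs i = ℚₚ.≤-trans (ℚₚ.≤-reflexive (sym (ℚₚ.*-identityˡ (s i))))
        (ℚₚ.*-monoʳ-≤-nonNeg (s i) {{ℚ.nonNegative (0≤s i)}} (toℚ-mono-≤ (ℤₚ.i<j⇒suc[i]≤j (0<τ i))))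
      sum-τs : sumℚ τs ℚ.≤ toℚ gap
      sum-τs = begin
        sumℚ τs
          ≡⟨ Qs.S-cong (λ i → solve 3 (λ t b y → t :* (b :- y) := con (ℚ.- ℚ.1ℚ) :* (t :* y) :+ t :* b) refl (toℚ (τ i)) (toℚ (b (suc i))) (rowDot A x (suc i))) ⟩
        sumℚ (λ i → ℚ.- ℚ.1ℚ ℚ.* (toℚ (τ i) ℚ.* rowDot A x (suc i)) ℚ.+ toℚ (τ i) ℚ.* toℚ (b (suc i)))
          ≡⟨ Qs.S-+ (λ i → ℚ.- ℚ.1ℚ ℚ.* (toℚ (τ i) ℚ.* rowDot A x (suc i))) (λ i → toℚ (τ i) ℚ.* toℚ (b (suc i))) ⟩
        sumℚ (λ i → ℚ.- ℚ.1ℚ ℚ.* (toℚ (τ i) ℚ.* rowDot A x (suc i))) ℚ.+ T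
          ≡⟨ cong (ℚ._+ T) (trans (sym (Qs.S-*ˡ (ℚ.- ℚ.1ℚ) (λ i → toℚ (τ i) ℚ.* rowDot A x (suc i)))) (solve 1 (λ y → con (ℚ.- ℚ.1ℚ) :* y := :- y) refl (sumℚ (λ i → toℚ (τ i) ℚ.* rowDot A x (suc i))))) ⟩
        ℚ.- sumℚ (λ i → toℚ (τ i) ℚ.* rowDot A x (suc i)) ℚ.+ T
          ≡⟨ cong (ℚ._+ T) (row-relationℚ x) ⟨
        toℚ (+ Δ) ℚ.* rowDot A x zero ℚ.+ T
          ≤⟨ ℚₚ.+-monoˡ-≤ T (ℚₚ.*-monoˡ-≤-nonNeg (toℚ (+ Δ)) {{toℚ-nonNeg (ℤₚ.<⇒≤ 0<Δ)}} (h zero)) ⟩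
        toℚ (+ Δ) ℚ.* toℚ (b zero) ℚ.+ T
          ≡⟨ gap-toℚ ⟨
        toℚ gap ∎
        where T = sumℚ (λ i → toℚ (τ i) ℚ.* toℚ (b (suc i)))
      row-bound : ∀ i → ℚ.∣ rowDot B x i ∣ ℚ.≤ Y
      row-bound i = begin
        ℚ.∣ rowDot B x i ∣              ≡⟨ cong ℚ.∣_∣ (solve 2 (λ y b → y := b :- (b :- y)) refl (rowDot B x i) (toℚ (b (suc i)))) ⟩
        ℚ.∣ toℚ (b (suc i)) ℚ.- s i ∣   ≤⟨ ℚₚ.∣p-q∣≤∣p∣+∣q∣ (toℚ (b (suc i))) (s i) ⟩
        β i ℚ.+ ℚ.∣ s i ∣               ≡⟨ cong (β i ℚ.+_) (ℚₚ.0≤p⇒∣p∣≡p (0≤s i)) ⟩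
        β i ℚ.+ s i                     ≤⟨ ℚₚ.+-mono-≤ (≤-sumℚ β (λ j → ℚₚ.0≤∣p∣ (toℚ (b (suc j)))) i)
                                             (ℚₚ.≤-trans (ℚₚ.≤-trans (s≤τs i) (≤-sumℚ τs (λ j → ℚₚ.≤-trans (0≤s j) (s≤τs j)) i)) sum-τs) ⟩
        Y                               ∎

  -- Every integer point of the bounded polyhedron lies in a box of known size, and membership of a
  -- single integer point is decidable.
  isEmptyS? : (∃[ R ] ∀ x → InP A b x → ∀ j → ℚ.∣ x j ∣ ℚ.≤ R) → Dec (IsEmptyS A b)
  isEmptyS? (R , bound) = map′ nowhere inBox (¬? (search n N P
      (λ e h i → subst (ℚ._≤ toℚ (b i)) (rowDot-congʳ A i (λ j → cong toℚ (e j))) (h i))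
      (λ z → Finₚ.all? (λ i → rowDot A (λ j → toℚ (z j)) i ℚ.≤? toℚ (b i)))))
    where
    N = proj₁ (archimedean R)
    P : Vect ℤ n → Set
    P z = InP A b (λ j → toℚ (z j))
    abs-toℚ : ∀ z → toℚ (+ ∣ z ∣) ℚ.≤ ℚ.∣ toℚ z ∣
    abs-toℚ (+ m)      = p≤∣p∣ (toℚ (+ m))
    abs-toℚ ℤ.-[1+ m ] = ℚₚ.≤-trans (p≤∣p∣ (toℚ (+ suc m))) (ℚₚ.≤-reflexive (trans (sym (ℚₚ.∣-p∣≡∣p∣ (toℚ (+ suc m)))) (cong ℚ.∣_∣ (sym (toℚ-neg (+ suc m))))))
    abs-bound : ∀ z → InP A b (λ j → toℚ (z j)) → ∀ i → ∣ z i ∣ ℕ.≤ N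
    abs-bound z h i = ℤₚ.drop‿+≤+ (toℚ-cancel-≤ (ℚₚ.≤-trans (ℚₚ.≤-trans (abs-toℚ (z i)) (bound (λ j → toℚ (z j)) h i)) (proj₂ (archimedean R))))
    nowhere : ¬ (∃[ z ] (∀ i → ∣ z i ∣ ℕ.≤ N) × P z) → IsEmptyS A b
    nowhere none (z , h) = none (z , abs-bound z h , h)
    inBox : IsEmptyS A b → ¬ (∃[ z ] (∀ i → ∣ z i ∣ ℕ.≤ N) × P z)
    inBox em (z , _ , h) = em (z , h)

  -- Given the minor Δ, being a simplex is equivalent to positivity of all τᵢ and of `gap`: finitely
  -- many comparisons of integers. Emptiness is tested last because its search needs the bound that
  -- these signs provide.
  emptyΔModSimplex? : Dec (EmptyΔModSimplex n Δ A b)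
  emptyΔModSimplex? = decide (Finₚ.all? (λ i → ∣ det n (delRow A i) ∣ ℕ.≤? Δ)) (Finₚ.all? (λ i → + 0 ℤ.<? τ i)) (+ 0 ℤ.<? gap)
    where
    MinorsBounded : Set
    MinorsBounded = ∀ i → ∣ det n (delRow A i) ∣ ℕ.≤ Δ
    decideEmpty : MinorsBounded → (∀ i → + 0 ℤ.< τ i) → + 0 ℤ.< gap → Dec (IsEmptyS A b) → Dec (EmptyΔModSimplex n Δ A b)
    decideEmpty mm 0<τ 0<gap (yes em) = yes ((zero , λ e → d≢0 (cong ∣_∣ e)) , (mm , zero , d≡) , (interior 0<τ 0<gap , bounded 0<τ) , em)
    decideEmpty mm 0<τ 0<gap (no ¬em) = no (λ s → ¬em (proj₂ (proj₂ (proj₂ s))))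
    decide : Dec MinorsBounded → Dec (∀ i → + 0 ℤ.< τ i) → Dec (+ 0 ℤ.< gap) → Dec (EmptyΔModSimplex n Δ A b)
    decide (no ¬mm) _ _ = no (λ s → ¬mm (proj₁ (proj₁ (proj₂ s))))
    decide (yes _) (no ¬0<τ) _ = no (λ s → ¬0<τ (simplex⇒0<τ (proj₁ (proj₂ (proj₂ s)))))
    decide (yes _) (yes 0<τ) (no ¬0<gap) = no (λ s → ¬0<gap (interior⇒0<gap 0<τ (proj₁ (proj₁ (proj₂ (proj₂ s))))))
    decide (yes mm) (yes 0<τ) (yes 0<gap) = decideEmpty mm 0<τ 0<gap (isEmptyS? (bounded 0<τ))

  τ≤Δ : MaxMinor A Δ → ∀ i → ∣ τ i ∣ ℕ.≤ Δ
  τ≤Δ (mm , _) i = subst (ℕ._≤ Δ) (sym eq) (mm (suc i))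
    where
    eq : ∣ τ i ∣ ≡ ∣ det n (delRow A (suc i)) ∣
    eq = sym (ℕₚ.*-cancelˡ-≡ ∣ det n (delRow A (suc i)) ∣ ∣ τ i ∣ Δ {{ℕ.>-nonZero 1≤Δ}}
      (trans (cramer A (+ Δ) -τ row-relation i) (trans (cong₂ ℕ._*_ (sym (ℤₚ.∣-i∣≡∣i∣ (-τ i))) d≡) (ℕₚ.*-comm ∣ τ i ∣ Δ))))

-- Normal forms

-- The part of the Hermite normal form that is invariant under simultaneous permutations of rows and
-- columns, together with the reduced right-hand sides.
record Reduced {n} (Δ : ℕ) (A : Mat ℤ (suc n) n) (b : Vect ℤ (suc n)) : Set where
  field
    offDiagonal : ∀ i j → i ≢ j → InResidue (A (suc i) i) (A (suc i) j)
    rightHandSide : ∀ i → InResidue (A (suc i) i) (b (suc i))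
    diagonal-∏ : ∏ (λ i → ∣ A (suc i) i ∣) ≡ Δ

  -- A modulus that has a residue at all is positive.
  diagonal-pos : ∀ i → + 0 ℤ.< A (suc i) i
  diagonal-pos i = ℤₚ.≤-<-trans (proj₁ (rightHandSide i)) (proj₂ (rightHandSide i))

  diagonal-≥1 : ∀ i → 1 ℕ.≤ ∣ A (suc i) i ∣
  diagonal-≥1 i = ℤₚ.drop‿+<+ (subst (+ 0 ℤ.<_) (sym (ℤₚ.0≤i⇒+∣i∣≡i (ℤₚ.<⇒≤ (diagonal-pos i)))) (diagonal-pos i))

residue-abs : ∀ {d x} → InResidue d x → x ≡ + ∣ x ∣ × ∣ x ∣ ℕ.< ∣ d ∣
residue-abs {+ d} {+ x} (_ , ℤ.+<+ lt) = refl , lt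

residue-1 : ∀ {d x} → InResidue d x → ∣ d ∣ ≡ 1 → x ≡ + 0
residue-1 {d} {x} h e with residue-abs {d} {x} h
... | x≡ , lt = trans x≡ (cong +_ (ℕₚ.n<1⇒n≡0 (subst (∣ x ∣ ℕ.<_) e lt)))

reduce : ∀ {n Δ} (A : Mat ℤ (suc n) n) b → 1 ℕ.≤ Δ → EmptyΔModSimplex n Δ A b →
         ∃[ A' ] ∃[ b' ] Reach A b A' b' × Reduced Δ A' b' × ∣ det n (delRow A' zero) ∣ ≡ Δ
reduce {n} {Δ} A b 1≤Δ (_ , (_ , (i₀ , e₀)) , _) = A₂ , b₃ , reach , reduced , det₂
  where
  π = Perm.transpose zero i₀
  A₁ : Mat ℤ (suc n) n
  A₁ i = A (π ⟨$⟩ʳ i)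
  b₁ : Vect ℤ (suc n)
  b₁ i = b (π ⟨$⟩ʳ i)
  det₁ : ∣ det n (delRow A₁ zero) ∣ ≡ Δ
  det₁ = trans (reach-minor (reach-rows A b π) zero) e₀
  h : ∃[ W ] HNF n (delRow A₁ zero ⊗ to W)
  h = hnf n (delRow A₁ zero) (λ e → ℕₚ.1+n≰n (subst (1 ℕ.≤_) (trans (sym det₁) e) 1≤Δ))
  W = proj₁ h
  A₂ : Mat ℤ (suc n) n
  A₂ = A₁ ⊗ to W
  det₂ : ∣ det n (delRow A₂ zero) ∣ ≡ Δ
  det₂ = trans (reach-minor (reach-columns A₁ b₁ W) zero) det₁
  z : Vect ℤ n
  z = proj₁ (residue n (delRow A₂ zero) (proj₂ h) (λ i → b₁ (suc i)))
  b₃ : Vect ℤ (suc n)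
  b₃ i = b₁ i ℤ.+ mv A₂ z i
  reach : Reach A b A₂ b₃
  reach = reach-trans (reach-rows A b π) (reach-trans (reach-columns A₁ b₁ W) (reach-shift A₂ b₁ z))
  reduced : Reduced Δ A₂ b₃
  reduced = record
    { offDiagonal = hnf-residue n (proj₂ h)
    ; rightHandSide = proj₂ (residue n (delRow A₂ zero) (proj₂ h) (λ i → b₁ (suc i)))
    ; diagonal-∏ = trans (hnf-∏ n (proj₂ h)) det₂ }

-- Using the same σ for rows and columns keeps the diagonal of B on the diagonal, and `lift₀` keeps
-- the first row in its place.
conjugate : ∀ {n} → Permutation′ n → Mat ℤ (suc n) n → Mat ℤ (suc n) n
conjugate σ A i j = A (Perm.lift₀ σ ⟨$⟩ʳ i) (σ ⟨$⟩ʳ j)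

reduced-conjugate : ∀ {n Δ} {A : Mat ℤ (suc n) n} {b} (σ : Permutation′ n) → Reduced Δ A b →
                    Reduced Δ (conjugate σ A) (λ i → b (Perm.lift₀ σ ⟨$⟩ʳ i))
reduced-conjugate {A = A} σ r = record
  { offDiagonal = λ i j i≢j → offDiagonal (σ ⟨$⟩ʳ i) (σ ⟨$⟩ʳ j) (λ e → i≢j (trans (sym (Perm.inverseˡ σ)) (trans (cong (σ ⟨$⟩ˡ_) e) (Perm.inverseˡ σ))))
  ; rightHandSide = λ i → rightHandSide (σ ⟨$⟩ʳ i)
  ; diagonal-∏ = trans (sym (Product.sum-permute (λ i → ∣ A (suc i) i ∣) σ)) diagonal-∏ }
  where open Reduced r

-- Sorting, and products of positive integers

argmax : ∀ {n} (f : Fin (suc n) → ℕ) → ∃[ i ] ∀ j → f j ℕ.≤ f i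
argmax {zero}  f = zero , λ { zero → ℕₚ.≤-refl }
argmax {suc n} f with argmax (f ∘ suc)
... | i , max with ℕₚ.≤-total (f zero) (f (suc i))
... | inj₁ le = suc i , λ { zero → le ; (suc j) → max j }
... | inj₂ ge = zero , λ { zero → ℕₚ.≤-refl ; (suc j) → ℕₚ.≤-trans (max j) ge }

Descending : ∀ {n} → (Fin n → ℕ) → Set
Descending f = ∀ i j → toℕ i ℕ.≤ toℕ j → f j ℕ.≤ f i

sort : ∀ {n} (f : Fin n → ℕ) → Σ (Permutation′ n) λ σ → Descending (λ i → f (σ ⟨$⟩ʳ i))
sort {zero}  f = Perm.id , λ ()
sort {suc n} f with argmax f
... | i₀ , max with sort (λ j → f (punchIn i₀ j))
... | σ , desc = σ' , desc'
  where
  σ' = Perm.insert zero i₀ σ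
  at-suc : ∀ j → f (σ' ⟨$⟩ʳ suc j) ≡ f (punchIn i₀ (σ ⟨$⟩ʳ j))
  at-suc j = cong f (Perm.insert-punchIn zero i₀ σ j)
  desc' : Descending (λ i → f (σ' ⟨$⟩ʳ i))
  desc' zero    j       _          = max (σ' ⟨$⟩ʳ j)
  desc' (suc i) (suc j) (ℕ.s≤s le) = subst₂ ℕ._≤_ (sym (at-suc j)) (sym (at-suc i)) (desc i j le)

∏-≥1 : ∀ {n} (d : Fin n → ℕ) → (∀ i → 1 ℕ.≤ d i) → 1 ℕ.≤ ∏ d
∏-≥1 {zero}  d 1≤d = ℕₚ.≤-refl
∏-≥1 {suc n} d 1≤d = ℕₚ.*-mono-≤ (1≤d zero) (∏-≥1 (d ∘ suc) (1≤d ∘ suc))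

≤∏ : ∀ {n} (d : Fin n → ℕ) → (∀ i → 1 ℕ.≤ d i) → ∀ i → d i ℕ.≤ ∏ d
≤∏ {suc n} d 1≤d i = ℕₚ.≤-trans (ℕₚ.≤-reflexive (sym (ℕₚ.*-identityʳ (d i))))
  (ℕₚ.≤-trans (ℕₚ.*-monoʳ-≤ (d i) (∏-≥1 (λ j → d (punchIn i j)) (λ j → 1≤d (punchIn i j)))) (ℕₚ.≤-reflexive (sym (Product.sum-remove {i = i} d))))

-- The factors before i are at least 1, and each of the n - i factors from i on contributes at least
-- 2.
∏-suffix : ∀ {n} (d : Fin n → ℕ) → (∀ i → 1 ℕ.≤ d i) → ∀ (i : Fin n) → (∀ (j : Fin n) → toℕ i ℕ.≤ toℕ j → 2 ℕ.≤ d j) →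
           2 ℕ.^ (n ℕ.∸ toℕ i) ℕ.≤ ∏ d
∏-suffix {suc n} d 1≤d zero 2≤d = all-≥2 (suc n) d (λ j → 2≤d j ℕ.z≤n)
  where
  all-≥2 : ∀ n (d : Fin n → ℕ) → (∀ j → 2 ℕ.≤ d j) → 2 ℕ.^ n ℕ.≤ ∏ d
  all-≥2 zero    d 2≤d = ℕₚ.≤-refl
  all-≥2 (suc n) d 2≤d = ℕₚ.*-mono-≤ (2≤d zero) (all-≥2 n (d ∘ suc) (2≤d ∘ suc))
∏-suffix {suc n} d 1≤d (suc i) 2≤d = ℕₚ.≤-trans (∏-suffix (d ∘ suc) (1≤d ∘ suc) i (λ j le → 2≤d (suc j) (ℕ.s≤s le)))
  (ℕₚ.≤-trans (ℕₚ.≤-reflexive (sym (ℕₚ.*-identityˡ (∏ (d ∘ suc))))) (ℕₚ.*-monoˡ-≤ (∏ (d ∘ suc)) (1≤d zero)))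

∏-units : ∀ m {k} (d : Fin (m ℕ.+ k) → ℕ) → (∀ i → d (i ↑ˡ k) ≡ 1) → ∏ d ≡ ∏ (λ r → d (m ↑ʳ r))
∏-units zero    d e = refl
∏-units (suc m) d e = trans (cong₂ ℕ._*_ (e zero) (∏-units m (d ∘ suc) (e ∘ suc))) (ℕₚ.*-identityˡ _)

-- Fewer than K + 1 of the numbers can exceed 1, so sorting moves all of these to the last K places.
units-first : ∀ m K (d : Fin (m ℕ.+ K) → ℕ) → (∀ i → 1 ℕ.≤ d i) → ∏ d ℕ.< 2 ℕ.^ suc K →
              Σ (Permutation′ (m ℕ.+ K)) λ σ → ∀ i → d (σ ⟨$⟩ʳ (i ↑ˡ K)) ≡ 1
units-first m K d 1≤d small = σ , λ i → decide i (d (σ ⟨$⟩ʳ (i ↑ˡ K)) ℕ.≟ 1)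
  where
  -- Units get the larger key, so a descending sort puts them in front.
  key : ℕ → ℕ
  key 1 = 1
  key _ = 0
  key-≥2 : ∀ k → 1 ℕ.≤ k → key k ℕ.≤ 0 → 2 ℕ.≤ k
  key-≥2 (suc (suc k)) _ _ = ℕ.s≤s (ℕ.s≤s ℕ.z≤n)
  key-≢1 : ∀ k → k ≢ 1 → key k ≡ 0
  key-≢1 zero          _   = refl
  key-≢1 (suc zero)    k≢1 = ⊥-elim (k≢1 refl)
  key-≢1 (suc (suc k)) _   = refl
  σ = proj₁ (sort (key ∘ d))
  desc = proj₂ (sort (key ∘ d))
  decide : ∀ i → Dec (d (σ ⟨$⟩ʳ (i ↑ˡ K)) ≡ 1) → d (σ ⟨$⟩ʳ (i ↑ˡ K)) ≡ 1
  decide i (yes e) = e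
  decide i (no ≢1) = ⊥-elim (ℕₚ.<⇒≱ small (begin
    2 ℕ.^ suc K                                 ≤⟨ ℕₚ.^-monoʳ-≤ 2 (begin
      suc K                                       ≡⟨ ℕₚ.m+n∸n≡m (suc K) (toℕ i) ⟨
      suc K ℕ.+ toℕ i ℕ.∸ toℕ i                   ≡⟨ cong (ℕ._∸ toℕ i) (trans (ℕₚ.+-comm (suc K) (toℕ i)) (ℕₚ.+-suc (toℕ i) K)) ⟩
      suc (toℕ i) ℕ.+ K ℕ.∸ toℕ i                 ≤⟨ ℕₚ.∸-monoˡ-≤ (toℕ i) (ℕₚ.+-monoˡ-≤ K (Finₚ.toℕ<n i)) ⟩
      m ℕ.+ K ℕ.∸ toℕ i                           ≡⟨ cong (m ℕ.+ K ℕ.∸_) (Finₚ.toℕ-↑ˡ i K) ⟨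
      m ℕ.+ K ℕ.∸ toℕ (i ↑ˡ K)                    ∎) ⟩
    2 ℕ.^ (m ℕ.+ K ℕ.∸ toℕ (i ↑ˡ K))            ≤⟨ ∏-suffix (λ j → d (σ ⟨$⟩ʳ j)) (λ j → 1≤d (σ ⟨$⟩ʳ j)) (i ↑ˡ K)
                                                     (λ j le → key-≥2 (d (σ ⟨$⟩ʳ j)) (1≤d (σ ⟨$⟩ʳ j)) (ℕₚ.≤-trans (desc (i ↑ˡ K) j le) (ℕₚ.≤-reflexive (key-≢1 (d (σ ⟨$⟩ʳ (i ↑ˡ K))) ≢1)))) ⟩
    ∏ (λ j → d (σ ⟨$⟩ʳ j))                      ≡⟨ Product.sum-permute d σ ⟨
    ∏ d                                         ∎))
    where open ℕₚ.≤-Reasoning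

-- Mixed radix notation with radices d; the value 0 of a radix only serves to make decode total.
encode : ∀ {K} → (Fin K → ℕ) → (Fin K → ℕ) → ℕ
encode {zero}  d h = 0
encode {suc K} d h = h zero ℕ.+ encode (d ∘ suc) (h ∘ suc) ℕ.* d zero

modulo quotient : ℕ → ℕ → ℕ
modulo x zero    = 0
modulo x (suc d) = x ℕD.% suc d
quotient x zero    = 0
quotient x (suc d) = x ℕD./ suc d

decode : ∀ {K} → (Fin K → ℕ) → ℕ → Fin K → ℕ
decode d w zero    = modulo w (d zero)
decode d w (suc r) = decode (d ∘ suc) (quotient w (d zero)) r

modulo-+* : ∀ {x d} k → x ℕ.< d → modulo (x ℕ.+ k ℕ.* d) d ≡ x
modulo-+* {x} {suc d} k lt = trans (ℕD.[m+kn]%n≡m%n x k (suc d)) (ℕD.m<n⇒m%n≡m lt)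

quotient-+* : ∀ {x d} k → x ℕ.< d → quotient (x ℕ.+ k ℕ.* d) d ≡ k
quotient-+* {x} {suc d} k lt = trans (ℕD.+-distrib-/-∣ʳ x (divides k refl))
  (cong₂ ℕ._+_ (ℕD.m<n⇒m/n≡0 lt) (ℕD.m*n/n≡m k (suc d)))

decode-cong : ∀ {K} {d d' : Fin K → ℕ} w → (∀ r → d r ≡ d' r) → ∀ r → decode d w r ≡ decode d' w r
decode-cong w e zero    = cong (modulo w) (e zero)
decode-cong {d' = d'} w e (suc r) = trans (decode-cong _ (e ∘ suc) r) (cong (λ k → decode (d' ∘ suc) (quotient w k) r) (e zero))

decode-encode : ∀ {K} (d h : Fin K → ℕ) → (∀ r → h r ℕ.< d r) → ∀ r → decode d (encode d h) r ≡ h r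
decode-encode d h lt zero    = modulo-+* (encode (d ∘ suc) (h ∘ suc)) (lt zero)
decode-encode d h lt (suc r) = trans (cong (λ w → decode (d ∘ suc) w r) (quotient-+* (encode (d ∘ suc) (h ∘ suc)) (lt zero)))
  (decode-encode (d ∘ suc) (h ∘ suc) (lt ∘ suc) r)

encode-< : ∀ {K} (d h : Fin K → ℕ) → (∀ r → h r ℕ.< d r) → encode d h ℕ.< ∏ d
encode-< {zero}  d h lt = ℕₚ.≤-refl
encode-< {suc K} d h lt = begin-strict
  h zero ℕ.+ e ℕ.* d zero          <⟨ ℕₚ.+-monoˡ-< (e ℕ.* d zero) (lt zero) ⟩
  suc e ℕ.* d zero                 ≤⟨ ℕₚ.*-monoˡ-≤ (d zero) (encode-< (d ∘ suc) (h ∘ suc) (lt ∘ suc)) ⟩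
  ∏ (d ∘ suc) ℕ.* d zero           ≡⟨ ℕₚ.*-comm (∏ (d ∘ suc)) (d zero) ⟩
  ∏ d                              ∎
  where
  open ℕₚ.≤-Reasoning
  e = encode (d ∘ suc) (h ∘ suc)

extend : ∀ m K → Permutation′ m → Permutation′ (m ℕ.+ K)
extend m K σ = Perm.permutation (act (σ ⟨$⟩ʳ_)) (act (σ ⟨$⟩ˡ_))
  (act-inverse (σ ⟨$⟩ʳ_) (σ ⟨$⟩ˡ_) (λ i → Perm.inverseʳ σ)) (act-inverse (σ ⟨$⟩ˡ_) (σ ⟨$⟩ʳ_) (λ i → Perm.inverseˡ σ))
  where
  act : (Fin m → Fin m) → Fin (m ℕ.+ K) → Fin (m ℕ.+ K)
  act f k = Fin.join m K (Sum.map₁ f (Fin.splitAt m k))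
  act-inverse : ∀ f g → (∀ i → f (g i) ≡ i) → ∀ k → act f (act g k) ≡ k
  act-inverse f g fg k = trans (cong (λ s → Fin.join m K (Sum.map₁ f s)) (Finₚ.splitAt-join m K (Sum.map₁ g (Fin.splitAt m k))))
    (trans (cong (Fin.join m K) (map-inverse (Fin.splitAt m k))) (Finₚ.join-splitAt m K k))
    where
    map-inverse : ∀ s → Sum.map₁ f (Sum.map₁ g s) ≡ s
    map-inverse (inj₁ i) = cong inj₁ (fg i)
    map-inverse (inj₂ r) = refl

extend-↑ˡ : ∀ m K σ i → extend m K σ ⟨$⟩ʳ (i ↑ˡ K) ≡ (σ ⟨$⟩ʳ i) ↑ˡ K
extend-↑ˡ m K σ i = cong (λ s → Fin.join m K (Sum.map₁ (σ ⟨$⟩ʳ_) s)) (Finₚ.splitAt-↑ˡ m i K)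

extend-↑ʳ : ∀ m K σ r → extend m K σ ⟨$⟩ʳ (m ↑ʳ r) ≡ m ↑ʳ r
extend-↑ʳ m K σ r = cong (λ s → Fin.join m K (Sum.map₁ (σ ⟨$⟩ʳ_) s)) (Finₚ.splitAt-↑ʳ m K r)

module _ {m K : ℕ} (A : Mat ℤ (suc (m ℕ.+ K)) (m ℕ.+ K)) where
  radix : Fin K → ℕ
  radix r = ∣ A (suc (m ↑ʳ r)) (m ↑ʳ r) ∣

  column : Fin m → Fin K → ℕ
  column j r = ∣ A (suc (m ↑ʳ r)) (j ↑ˡ K) ∣

  letter : Fin m → ℕ
  letter j = encode radix (column j)

record NormalForm m K (Δ : ℕ) (A : Mat ℤ (suc (m ℕ.+ K)) (m ℕ.+ K)) (b : Vect ℤ (suc (m ℕ.+ K))) : Set where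
  field
    reduced : Reduced Δ A b
    units : ∀ i → ∣ A (suc (i ↑ˡ K)) (i ↑ˡ K) ∣ ≡ 1
    sorted : Descending (letter {m} {K} A)

encode-cong : ∀ {K} {d d' h h' : Fin K → ℕ} → (∀ r → d r ≡ d' r) → (∀ r → h r ≡ h' r) → encode d h ≡ encode d' h'
encode-cong {zero}  e e' = refl
encode-cong {suc K} e e' = cong₂ ℕ._+_ (e' zero) (cong₂ ℕ._*_ (encode-cong (e ∘ suc) (e' ∘ suc)) (e zero))

-- Two conjugations are needed. The first brings the unit rows to the front; the second sorts the
-- first m columns and fixes the last K indices, so that the radices stay and the letters are merely
-- permuted.
normalize : ∀ m K {Δ} (A : Mat ℤ (suc (m ℕ.+ K)) (m ℕ.+ K)) b → Δ ℕ.< 2 ℕ.^ suc K → 1 ℕ.≤ Δ →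
  EmptyΔModSimplex (m ℕ.+ K) Δ A b →
  ∃[ A' ] ∃[ b' ] Reach A b A' b' × NormalForm m K Δ A' b' × ∣ det (m ℕ.+ K) (delRow A' zero) ∣ ≡ Δ
normalize m K {Δ} A b Δ<2^K 1≤Δ s = A₃ , b₃ , reach , nf , det₃
  where
  n = m ℕ.+ K
  red = reduce A b 1≤Δ s
  A₁ : Mat ℤ (suc n) n
  A₁ = proj₁ red
  b₁ : Vect ℤ (suc n)
  b₁ = proj₁ (proj₂ red)
  reduced₁ : Reduced Δ A₁ b₁
  reduced₁ = proj₁ (proj₂ (proj₂ (proj₂ red)))
  first : Σ (Permutation′ n) λ σ → ∀ i → ∣ A₁ (suc (σ ⟨$⟩ʳ (i ↑ˡ K))) (σ ⟨$⟩ʳ (i ↑ˡ K)) ∣ ≡ 1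
  first = units-first m K (λ i → ∣ A₁ (suc i) i ∣) (Reduced.diagonal-≥1 reduced₁)
    (subst (ℕ._< 2 ℕ.^ suc K) (sym (Reduced.diagonal-∏ reduced₁)) Δ<2^K)
  σ₁ : Permutation′ n
  σ₁ = proj₁ first
  A₂ : Mat ℤ (suc n) n
  A₂ = conjugate σ₁ A₁
  b₂ : Vect ℤ (suc n)
  b₂ i = b₁ (Perm.lift₀ σ₁ ⟨$⟩ʳ i)
  second : Σ (Permutation′ m) λ σ → Descending (λ i → letter {m} {K} A₂ (σ ⟨$⟩ʳ i))
  second = sort (letter {m} {K} A₂)
  σ₂ : Permutation′ m
  σ₂ = proj₁ second
  σ₃ : Permutation′ n
  σ₃ = extend m K σ₂
  A₃ : Mat ℤ (suc n) n
  A₃ = conjugate σ₃ A₂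
  b₃ : Vect ℤ (suc n)
  b₃ i = b₂ (Perm.lift₀ σ₃ ⟨$⟩ʳ i)
  reach₁₃ : Reach A₁ b₁ A₃ b₃
  reach₁₃ = reach-trans (reach-conjugate A₁ b₁ σ₁) (reach-conjugate A₂ b₂ σ₃)
  reach : Reach A b A₃ b₃
  reach = reach-trans (proj₁ (proj₂ (proj₂ red))) reach₁₃
  det₃ : ∣ det n (delRow A₃ zero) ∣ ≡ Δ
  det₃ = trans (reach-minor (reach-conjugate A₂ b₂ σ₃) zero) (trans (reach-minor (reach-conjugate A₁ b₁ σ₁) zero) (proj₂ (proj₂ (proj₂ (proj₂ red)))))
  entry : ∀ {i i' j j'} → σ₃ ⟨$⟩ʳ i ≡ i' → σ₃ ⟨$⟩ʳ j ≡ j' → ∣ A₃ (suc i) j ∣ ≡ ∣ A₂ (suc i') j' ∣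
  entry e e' = cong₂ (λ i j → ∣ A₂ (suc i) j ∣) e e'
  letter₃ : ∀ j → letter {m} {K} A₃ j ≡ letter {m} {K} A₂ (σ₂ ⟨$⟩ʳ j)
  letter₃ j = encode-cong (λ r → entry (extend-↑ʳ m K σ₂ r) (extend-↑ʳ m K σ₂ r)) (λ r → entry (extend-↑ʳ m K σ₂ r) (extend-↑ˡ m K σ₂ j))
  nf : NormalForm m K Δ A₃ b₃
  nf = record
    { reduced = reduced-conjugate {A = A₂} {b = b₂} σ₃ (reduced-conjugate {A = A₁} {b = b₁} σ₁ reduced₁)
    ; units = λ i → trans (entry (extend-↑ˡ m K σ₂ i) (extend-↑ˡ m K σ₂ i)) (proj₂ first (σ₂ ⟨$⟩ʳ i))
    ; sorted = λ i j le → subst₂ ℕ._≤_ (sym (letter₃ j)) (sym (letter₃ i)) (proj₂ second i j le) }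

-- The simplices in normal form, with T and the decoded letters of w as the last K rows of B and t as the
-- last K of the barycentric coordinates. The other coordinates lie between 1 and Δ and are determined modulo Δ
-- by the requirement that Δ divides Σ τᵢ Bᵢ; this is what the rounded quotients in top solve.
module Candidate (m K Δ : ℕ) (T : Fin K → Fin K → ℕ) (w : Fin m → ℕ) (t β : Fin K → ℕ) (g : ℕ) where
  bottom : Fin K → Fin m ⊎ Fin K → ℕ
  bottom r (inj₁ j) = decode (λ s → T s s) (w j) r
  bottom r (inj₂ s) = T r s

  weight : Fin m ⊎ Fin K → ℕ
  weight k = ∣ sumℤ (λ r → + t r ℤ.* + bottom r k) ∣

  top : Fin m ⊎ Fin K → ℕ
  -- Here Δ · `top` has to equal τⱼ + `weight` with 1 ≤ τⱼ ≤ Δ, so it is the next multiple of Δ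
  -- strictly above `weight`. In the last K columns no such τⱼ enters and the division is exact.
  top (inj₁ j) = suc (quotient (weight (inj₁ j)) Δ)
  top (inj₂ s) = quotient (weight (inj₂ s)) Δ

  row : Fin m ⊎ Fin K → Fin (m ℕ.+ K) → Fin (m ℕ.+ K) → ℤ
  row (inj₁ _) i j = δ i j
  row (inj₂ r) i j = + bottom r (Fin.splitAt m j)

  side : Fin m ⊎ Fin K → ℤ
  side (inj₁ _) = + 0
  side (inj₂ r) = + β r

  matrix : Mat ℤ (suc (m ℕ.+ K)) (m ℕ.+ K)
  matrix zero    j = ℤ.- + top (Fin.splitAt m j)
  matrix (suc i) j = row (Fin.splitAt m i) i j

  rhs : Vect ℤ (suc (m ℕ.+ K))
  rhs zero    = ℤ.-[1+ g ]
  rhs (suc i) = side (Fin.splitAt m i)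

by-split : ∀ m {K} (P : Fin (m ℕ.+ K) → Set) → (∀ i → P (i ↑ˡ K)) → (∀ r → P (m ↑ʳ r)) → ∀ k → P k
by-split m {K} P l r k = subst P (Finₚ.join-splitAt m K k) (cases (Fin.splitAt m k))
  where
  cases : ∀ s → P (Fin.join m K s)
  cases (inj₁ i) = l i
  cases (inj₂ s) = r s

top-exact : ∀ {Δ x} z → 1 ℕ.≤ Δ → + Δ ℤ.* z ≡ ℤ.- + x → z ≡ ℤ.- + quotient x Δ
top-exact {Δ} {x} z 1≤Δ e = nonPos z (negated)
  where
  negated : + Δ ℤ.* ℤ.- z ≡ + x
  negated = trans (sym (ℤₚ.neg-distribʳ-* (+ Δ) z)) (trans (cong ℤ.-_ e) (ℤₚ.neg-involutive (+ x)))
  quotient≡ : ∀ k → + Δ ℤ.* + k ≡ + x → quotient x Δ ≡ k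
  quotient≡ k e = trans (cong (λ y → quotient y Δ) (trans (sym (ℤₚ.+-injective (trans (ℤₚ.pos-* Δ k) e))) (ℕₚ.*-comm Δ k))) (quotient-+* k 1≤Δ)
  nonPos : ∀ z → + Δ ℤ.* ℤ.- z ≡ + x → z ≡ ℤ.- + quotient x Δ
  nonPos (+ zero)     e = cong (λ k → ℤ.- + k) (sym (quotient≡ 0 e))
  nonPos (+ suc k)    e = ⊥-elim (absurd Δ 1≤Δ e)
    where
    absurd : ∀ Δ → 1 ℕ.≤ Δ → + Δ ℤ.* ℤ.-[1+ k ] ≢ + x
    absurd (suc Δ) _ ()
  nonPos ℤ.-[1+ k ]   e = cong (λ k → ℤ.- + k) (sym (quotient≡ (suc k) e))

top-unit : ∀ {Δ x y} z → 1 ℕ.≤ y → y ℕ.≤ Δ → + Δ ℤ.* z ≡ ℤ.- (+ y ℤ.+ + x) → z ≡ ℤ.- + suc (quotient x Δ)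
top-unit {Δ} {x} {y} z 1≤y y≤Δ e = trans (sym (ring z)) (trans (cong (ℤ._- + 1) (below z e)) (sub-1 (quotient x Δ)))
  where
  ring : ∀ z → z ℤ.+ + 1 ℤ.- + 1 ≡ z
  ring = ℤS.solve-∀
  sub-1 : ∀ k → ℤ.- + k ℤ.- + 1 ≡ ℤ.- + suc k
  sub-1 zero    = refl
  sub-1 (suc k) = cong ℤ.-[1+_] (cong suc (ℕₚ.+-identityʳ k))
  -- With z = - (k + 1) the equation reads x = k Δ + (Δ - y), where 0 ≤ Δ - y < Δ.
  below : ∀ z → + Δ ℤ.* z ≡ ℤ.- (+ y ℤ.+ + x) → z ℤ.+ + 1 ≡ ℤ.- + quotient x Δ
  below (+ k) e = ⊥-elim (absurd (ℤₚ.pos-* Δ k) y 1≤y e)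
    where
    absurd : ∀ {u} → + (Δ ℕ.* k) ≡ u → ∀ y → 1 ℕ.≤ y → u ≢ ℤ.- (+ y ℤ.+ + x)
    absurd refl (suc y) _ ()
  below ℤ.-[1+ k ] e = trans (sym-1 k) (cong (λ q → ℤ.- + q) (sym (trans (cong (λ u → quotient u Δ) x≡) (quotient-+* k (ℕₚ.∸-monoʳ-< 1≤y y≤Δ)))))
    where
    sym-1 : ∀ k → ℤ.-[1+ k ] ℤ.+ + 1 ≡ ℤ.- + k
    sym-1 zero    = refl
    sym-1 (suc k) = refl
    product : Δ ℕ.* suc k ≡ y ℕ.+ x
    product = ℤₚ.+-injective (trans (ℤₚ.pos-* Δ (suc k)) (ℤₚ.neg-injective (trans (ℤₚ.neg-distribʳ-* (+ Δ) (+ suc k)) e)))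
    x≡ : x ≡ (Δ ℕ.∸ y) ℕ.+ k ℕ.* Δ
    x≡ = begin
      x                           ≡⟨ ℕₚ.m+n∸m≡n y x ⟨
      y ℕ.+ x ℕ.∸ y               ≡⟨ cong (ℕ._∸ y) product ⟨
      Δ ℕ.* suc k ℕ.∸ y           ≡⟨ cong (ℕ._∸ y) (trans (ℕₚ.*-suc Δ k) (cong (Δ ℕ.+_) (ℕₚ.*-comm Δ k))) ⟩
      Δ ℕ.+ k ℕ.* Δ ℕ.∸ y         ≡⟨ ℕₚ.+-∸-comm (k ℕ.* Δ) y≤Δ ⟩
      (Δ ℕ.∸ y) ℕ.+ k ℕ.* Δ       ∎
      where open ≡-Reasoning

sumℤ-≤-const : ∀ {n} (f : Fin n → ℤ) c → (∀ i → f i ℤ.≤ + c) → sumℤ f ℤ.≤ + (n ℕ.* c)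
sumℤ-≤-const {zero}  f c le = ℤₚ.≤-refl
sumℤ-≤-const {suc n} f c le = ℤₚ.+-mono-≤ (le zero) (sumℤ-≤-const (λ i → f (suc i)) c (λ i → le (suc i)))

-- Recovering a simplex in normal form from its parameters

module Recover m K Δ (A : Mat ℤ (suc (m ℕ.+ K)) (m ℕ.+ K)) b (1≤Δ : 1 ℕ.≤ Δ)
  (nf : NormalForm m K Δ A b) (d≡ : ∣ det (m ℕ.+ K) (delRow A zero) ∣ ≡ Δ) (s : EmptyΔModSimplex (m ℕ.+ K) Δ A b) where

  open NormalForm nf
  open Reduced reduced
  open Barycentric A b Δ 1≤Δ d≡ using (τ; -τ; gap; row-relation; simplex⇒0<τ; interior⇒0<gap; τ≤Δ)

  0<τ : ∀ i → + 0 ℤ.< τ i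
  0<τ = simplex⇒0<τ (proj₁ (proj₂ (proj₂ s)))

  τ-abs : ∀ i → τ i ≡ + ∣ τ i ∣
  τ-abs i = sym (ℤₚ.0≤i⇒+∣i∣≡i (ℤₚ.<⇒≤ (0<τ i)))

  unit-diagonal : ∀ i → A (suc (i ↑ˡ K)) (i ↑ˡ K) ≡ + 1
  unit-diagonal i = trans (sym (ℤₚ.0≤i⇒+∣i∣≡i (ℤₚ.<⇒≤ (diagonal-pos (i ↑ˡ K))))) (cong +_ (units i))

  -- The off-diagonal entries are residues modulo the diagonal entry 1, hence 0.
  unit-row : ∀ i k → A (suc (i ↑ˡ K)) k ≡ δ (i ↑ˡ K) k
  unit-row i k = decide (i ↑ˡ K Fin.≟ k)
    where
    decide : Dec (i ↑ˡ K ≡ k) → A (suc (i ↑ˡ K)) k ≡ δ (i ↑ˡ K) k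
    decide (yes refl) = trans (unit-diagonal i) (sym (δ-≡ (i ↑ˡ K)))
    decide (no  i≢k)  = trans (residue-1 (offDiagonal (i ↑ˡ K) k i≢k) (units i)) (sym (δ-≢ (i ↑ˡ K) k i≢k))

  unit-side : ∀ i → b (suc (i ↑ˡ K)) ≡ + 0
  unit-side i = residue-1 (rightHandSide (i ↑ˡ K)) (units i)

  row-nonNeg : ∀ r k → A (suc (m ↑ʳ r)) k ≡ + ∣ A (suc (m ↑ʳ r)) k ∣
  row-nonNeg r k = decide (m ↑ʳ r Fin.≟ k)
    where
    decide : Dec (m ↑ʳ r ≡ k) → A (suc (m ↑ʳ r)) k ≡ + ∣ A (suc (m ↑ʳ r)) k ∣
    decide (yes refl) = sym (ℤₚ.0≤i⇒+∣i∣≡i (ℤₚ.<⇒≤ (diagonal-pos (m ↑ʳ r))))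
    decide (no  r≢k)  = proj₁ (residue-abs (offDiagonal (m ↑ʳ r) k r≢k))

  T : Fin K → Fin K → ℕ
  T r s = ∣ A (suc (m ↑ʳ r)) (m ↑ʳ s) ∣
  w : Fin m → ℕ
  w = letter {m} {K} A
  t β : Fin K → ℕ
  t r = ∣ τ (m ↑ʳ r) ∣
  β r = ∣ b (suc (m ↑ʳ r)) ∣

  -- The leading m diagonal entries are 1, so the last K carry the whole product. This is what keeps
  -- the letters below Δ.
  radix-∏ : ∏ (radix {m} {K} A) ≡ Δ
  radix-∏ = trans (sym (∏-units m (λ i → ∣ A (suc i) i ∣) units)) diagonal-∏

  column-< : ∀ j r → column {m} {K} A j r ℕ.< radix {m} {K} A r
  column-< j r = proj₂ (residue-abs (offDiagonal (m ↑ʳ r) (j ↑ˡ K) ↑ʳ≢↑ˡ))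
    where
    ↑ʳ≢↑ˡ : m ↑ʳ r ≢ j ↑ˡ K
    ↑ʳ≢↑ˡ e = inj₂≢inj₁ (trans (sym (Finₚ.splitAt-↑ʳ m K r)) (trans (cong (Fin.splitAt m) e) (Finₚ.splitAt-↑ˡ m j K)))
      where
      inj₂≢inj₁ : inj₂ r ≢ inj₁ j
      inj₂≢inj₁ ()

  radix-≤ : ∀ r → radix {m} {K} A r ℕ.≤ Δ
  radix-≤ r = subst (radix {m} {K} A r ℕ.≤_) diagonal-∏ (≤∏ (λ i → ∣ A (suc i) i ∣) diagonal-≥1 (m ↑ʳ r))

  w-< : ∀ j → w j ℕ.< Δ
  w-< j = subst (w j ℕ.<_) radix-∏ (encode-< (radix {m} {K} A) (column {m} {K} A j) (column-< j))

  T-≤ : ∀ r s → T r s ℕ.≤ Δ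
  T-≤ r s = decide (m ↑ʳ r Fin.≟ m ↑ʳ s)
    where
    decide : Dec (m ↑ʳ r ≡ m ↑ʳ s) → T r s ℕ.≤ Δ
    decide (yes e)  = subst (λ k → ∣ A (suc (m ↑ʳ r)) k ∣ ℕ.≤ Δ) e (radix-≤ r)
    decide (no r≢s) = ℕₚ.≤-trans (ℕₚ.<⇒≤ (proj₂ (residue-abs (offDiagonal (m ↑ʳ r) (m ↑ʳ s) r≢s)))) (radix-≤ r)

  t-≤ : ∀ r → t r ℕ.≤ Δ
  t-≤ r = τ≤Δ (proj₁ (proj₂ s)) (m ↑ʳ r)

  β-≤ : ∀ r → β r ℕ.≤ Δ
  β-≤ r = ℕₚ.≤-trans (ℕₚ.<⇒≤ (proj₂ (residue-abs (rightHandSide (m ↑ʳ r))))) (radix-≤ r)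

  -- The origin satisfies all the inequalities but the first, so the first must exclude it.
  b₀<0 : b zero ℤ.< + 0
  b₀<0 = ℤₚ.≰⇒> (λ 0≤b₀ → proj₂ (proj₂ (proj₂ s)) ((λ _ → + 0) , λ i →
    subst (ℚ._≤ toℚ (b i)) (sym (trans (rowDot-toℚ A (λ _ → + 0) i) (cong toℚ (mv-0 A i)))) (toℚ-mono-≤ (nonNeg 0≤b₀ i))))
    where
    nonNeg : + 0 ℤ.≤ b zero → ∀ i → + 0 ℤ.≤ b i
    nonNeg 0≤b₀ zero    = 0≤b₀
    nonNeg 0≤b₀ (suc i) = proj₁ (rightHandSide i)

  g : ℕ
  g = ℕ.pred ∣ b zero ∣

  b₀≡ : b zero ≡ ℤ.-[1+ g ]
  b₀≡ = neg (b zero) b₀<0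
    where
    neg : ∀ z → z ℤ.< + 0 → z ≡ ℤ.-[1+ ℕ.pred ∣ z ∣ ]
    neg ℤ.-[1+ k ] _ = refl
    neg (+ k) (ℤ.+<+ ())

  -- Positivity of `gap` says Δ (g + 1) < Σ τᵢ bᵢ. Only the last K right-hand sides can be nonzero,
  -- and each product there is at most Δ². For K = 0 no g remains: a simplex with Δ = 1 is never
  -- empty.
  g-< : g ℕ.< K ℕ.* Δ
  g-< = ℕₚ.<-trans (ℕₚ.n<1+n g) (ℕₚ.*-cancelˡ-< Δ (suc g) (K ℕ.* Δ) (ℤₚ.drop‿+<+ (begin-strict
    + (Δ ℕ.* suc g)                                   ≡⟨ ℤₚ.pos-* Δ (suc g) ⟩
    + Δ ℤ.* + suc g                                   ≡⟨ ring (+ Δ ℤ.* + suc g) ⟩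
    + Δ ℤ.* + suc g ℤ.+ + 0                           <⟨ ℤₚ.+-monoʳ-< (+ Δ ℤ.* + suc g) (interior⇒0<gap 0<τ (proj₁ (proj₁ (proj₂ (proj₂ s))))) ⟩
    + Δ ℤ.* + suc g ℤ.+ gap                           ≡⟨ cong (λ z → + Δ ℤ.* + suc g ℤ.+ (+ Δ ℤ.* z ℤ.+ S)) b₀≡ ⟩
    + Δ ℤ.* + suc g ℤ.+ (+ Δ ℤ.* ℤ.- + suc g ℤ.+ S)   ≡⟨ cancel (+ Δ) (+ suc g) S ⟩
    S                                                 ≡⟨ Zs.S-split m (λ i → τ i ℤ.* b (suc i)) ⟩
    sumℤ (λ i → τ (i ↑ˡ K) ℤ.* b (suc (i ↑ˡ K))) ℤ.+ S'
                                                      ≡⟨ cong (ℤ._+ S') (Zs.S-0 (λ i → τ (i ↑ˡ K) ℤ.* b (suc (i ↑ˡ K))) (λ i → trans (cong (τ (i ↑ˡ K) ℤ.*_) (unit-side i)) (ℤₚ.*-zeroʳ (τ (i ↑ˡ K))))) ⟩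
    + 0 ℤ.+ S'                                        ≡⟨ ℤₚ.+-identityˡ S' ⟩
    S'                                                ≤⟨ sumℤ-≤-const (λ r → τ (m ↑ʳ r) ℤ.* b (suc (m ↑ʳ r))) (Δ ℕ.* Δ) term ⟩
    + (K ℕ.* (Δ ℕ.* Δ))                               ≡⟨ cong +_ (trans (sym (ℕₚ.*-assoc K Δ Δ)) (ℕₚ.*-comm (K ℕ.* Δ) Δ)) ⟩
    + (Δ ℕ.* (K ℕ.* Δ))                               ∎)))
    where
    open ℤₚ.≤-Reasoning
    S S' : ℤ
    S = sumℤ (λ i → τ i ℤ.* b (suc i))
    S' = sumℤ (λ r → τ (m ↑ʳ r) ℤ.* b (suc (m ↑ʳ r)))
    ring : ∀ x → x ≡ x ℤ.+ + 0
    ring = ℤS.solve-∀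
    cancel : ∀ d g S → d ℤ.* g ℤ.+ (d ℤ.* ℤ.- g ℤ.+ S) ≡ S
    cancel = ℤS.solve-∀
    term : ∀ r → τ (m ↑ʳ r) ℤ.* b (suc (m ↑ʳ r)) ℤ.≤ + (Δ ℕ.* Δ)
    term r = subst (ℤ._≤ + (Δ ℕ.* Δ)) (trans (ℤₚ.pos-* (t r) (β r)) (sym (cong₂ ℤ._*_ (τ-abs (m ↑ʳ r)) (proj₁ (residue-abs (rightHandSide (m ↑ʳ r)))))))
      (ℤ.+≤+ (ℕₚ.*-mono-≤ (t-≤ r) (β-≤ r)))

  open Candidate m K Δ T w t β g

  bottom≡ : ∀ r k → bottom r (Fin.splitAt m k) ≡ ∣ A (suc (m ↑ʳ r)) k ∣
  bottom≡ r = by-split m _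
    (λ j → trans (cong (bottom r) (Finₚ.splitAt-↑ˡ m j K)) (decode-encode (radix {m} {K} A) (column {m} {K} A j) (column-< j) r))
    (λ s → cong (bottom r) (Finₚ.splitAt-↑ʳ m K s))

  weight-nonNeg : ∀ k → + weight k ≡ sumℤ (λ r → + t r ℤ.* + bottom r k)
  weight-nonNeg k = ℤₚ.0≤i⇒+∣i∣≡i (ℤₚ.≤-trans (ℤₚ.≤-reflexive (sym (Zs.S-0 {K} (λ _ → + 0) (λ _ → refl))))
    (sumℤ-mono (λ _ → + 0) (λ r → + t r ℤ.* + bottom r k) (λ r → subst (+ 0 ℤ.≤_) (ℤₚ.pos-* (t r) (bottom r k)) (ℤ.+≤+ ℕ.z≤n))))

  -- This is `row-relation` with the unit rows written as δ. The first sum collapses to one - τ in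
  -- the first m columns and to 0 in the last K.
  top-relation : ∀ k → + Δ ℤ.* A zero k ≡ sumℤ (λ i → -τ (i ↑ˡ K) ℤ.* δ (i ↑ˡ K) k) ℤ.+ ℤ.- + weight (Fin.splitAt m k)
  top-relation k = trans (row-relation k) (trans (Zs.S-split m (λ i → -τ i ℤ.* A (suc i) k))
    (cong₂ ℤ._+_ (Zs.S-cong (λ i → cong (-τ (i ↑ˡ K) ℤ.*_) (unit-row i k))) lower))
    where
    open ≡-Reasoning
    lower : sumℤ (λ r → -τ (m ↑ʳ r) ℤ.* A (suc (m ↑ʳ r)) k) ≡ ℤ.- + weight (Fin.splitAt m k)
    lower = begin
      sumℤ (λ r → -τ (m ↑ʳ r) ℤ.* A (suc (m ↑ʳ r)) k)
        ≡⟨ Zs.S-cong (λ r → cong₂ ℤ._*_ (trans (sym (ℤₚ.neg-involutive (-τ (m ↑ʳ r)))) (cong ℤ.-_ (τ-abs (m ↑ʳ r))))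
             (trans (row-nonNeg r k) (cong +_ (sym (bottom≡ r k))))) ⟩
      sumℤ (λ r → ℤ.- + t r ℤ.* + bottom r (Fin.splitAt m k))
        ≡⟨ Zs.S-cong (λ r → ring (+ t r) (+ bottom r (Fin.splitAt m k))) ⟩
      sumℤ (λ r → ℤ.- + 1 ℤ.* (+ t r ℤ.* + bottom r (Fin.splitAt m k)))
        ≡⟨ Zs.S-*ˡ (ℤ.- + 1) (λ r → + t r ℤ.* + bottom r (Fin.splitAt m k)) ⟨
      ℤ.- + 1 ℤ.* sumℤ (λ r → + t r ℤ.* + bottom r (Fin.splitAt m k))
        ≡⟨ cong (ℤ.- + 1 ℤ.*_) (weight-nonNeg (Fin.splitAt m k)) ⟨
      ℤ.- + 1 ℤ.* + weight (Fin.splitAt m k)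
        ≡⟨ ℤₚ.-1*i≡-i (+ weight (Fin.splitAt m k)) ⟩
      ℤ.- + weight (Fin.splitAt m k) ∎
      where
      ring : ∀ a x → ℤ.- a ℤ.* x ≡ ℤ.- + 1 ℤ.* (a ℤ.* x)
      ring = ℤS.solve-∀

  top≡ : ∀ k → matrix zero k ≡ A zero k
  top≡ = by-split m _ left right
    where
    open ≡-Reasoning
    left : ∀ j → matrix zero (j ↑ˡ K) ≡ A zero (j ↑ˡ K)
    left j = trans (cong (λ k → ℤ.- + top k) (Finₚ.splitAt-↑ˡ m j K)) (sym (top-unit (A zero (j ↑ˡ K)) (ℤₚ.drop‿+<+ (subst (+ 0 ℤ.<_) (τ-abs (j ↑ˡ K)) (0<τ (j ↑ˡ K))))
      (τ≤Δ (proj₁ (proj₂ s)) (j ↑ˡ K)) (begin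
        + Δ ℤ.* A zero (j ↑ˡ K)
          ≡⟨ top-relation (j ↑ˡ K) ⟩
        sumℤ (λ i → -τ (i ↑ˡ K) ℤ.* δ (i ↑ˡ K) (j ↑ˡ K)) ℤ.+ ℤ.- + weight (Fin.splitAt m (j ↑ˡ K))
          ≡⟨ cong₂ ℤ._+_ (Zs.S-single j (λ i → -τ (i ↑ˡ K) ℤ.* δ (i ↑ˡ K) (j ↑ˡ K)) (λ i i≢j → trans (cong (-τ (i ↑ˡ K) ℤ.*_) (δ-≢ (i ↑ˡ K) (j ↑ˡ K) (λ e → i≢j (Finₚ.↑ˡ-injective K i j e)))) (ℤₚ.*-zeroʳ (-τ (i ↑ˡ K)))))
               (cong (λ k → ℤ.- + weight k) (Finₚ.splitAt-↑ˡ m j K)) ⟩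
        -τ (j ↑ˡ K) ℤ.* δ (j ↑ˡ K) (j ↑ˡ K) ℤ.+ ℤ.- + weight (inj₁ j)
          ≡⟨ cong (ℤ._+ ℤ.- + weight (inj₁ j)) (trans (cong (-τ (j ↑ˡ K) ℤ.*_) (δ-≡ (j ↑ˡ K))) (trans (ℤₚ.*-identityʳ (-τ (j ↑ˡ K))) (trans (sym (ℤₚ.neg-involutive (-τ (j ↑ˡ K)))) (cong ℤ.-_ (τ-abs (j ↑ˡ K)))))) ⟩
        ℤ.- + ∣ τ (j ↑ˡ K) ∣ ℤ.+ ℤ.- + weight (inj₁ j)
          ≡⟨ ℤₚ.neg-distrib-+ (+ ∣ τ (j ↑ˡ K) ∣) (+ weight (inj₁ j)) ⟨
        ℤ.- (+ ∣ τ (j ↑ˡ K) ∣ ℤ.+ + weight (inj₁ j)) ∎)))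
    right : ∀ r → matrix zero (m ↑ʳ r) ≡ A zero (m ↑ʳ r)
    right r = trans (cong (λ k → ℤ.- + top k) (Finₚ.splitAt-↑ʳ m K r)) (sym (top-exact (A zero (m ↑ʳ r)) 1≤Δ (begin
        + Δ ℤ.* A zero (m ↑ʳ r)
          ≡⟨ top-relation (m ↑ʳ r) ⟩
        sumℤ (λ i → -τ (i ↑ˡ K) ℤ.* δ (i ↑ˡ K) (m ↑ʳ r)) ℤ.+ ℤ.- + weight (Fin.splitAt m (m ↑ʳ r))
          ≡⟨ cong₂ ℤ._+_ (Zs.S-0 (λ i → -τ (i ↑ˡ K) ℤ.* δ (i ↑ˡ K) (m ↑ʳ r)) (λ i → trans (cong (-τ (i ↑ˡ K) ℤ.*_) (δ-≢ (i ↑ˡ K) (m ↑ʳ r) (↑ˡ≢↑ʳ i))) (ℤₚ.*-zeroʳ (-τ (i ↑ˡ K)))))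
               (cong (λ k → ℤ.- + weight k) (Finₚ.splitAt-↑ʳ m K r)) ⟩
        + 0 ℤ.+ ℤ.- + weight (inj₂ r)
          ≡⟨ ℤₚ.+-identityˡ (ℤ.- + weight (inj₂ r)) ⟩
        ℤ.- + weight (inj₂ r) ∎)))
      where
      ↑ˡ≢↑ʳ : ∀ i → i ↑ˡ K ≢ m ↑ʳ r
      ↑ˡ≢↑ʳ i e = inj₁≢inj₂ (trans (sym (Finₚ.splitAt-↑ˡ m i K)) (trans (cong (Fin.splitAt m) e) (Finₚ.splitAt-↑ʳ m K r)))
        where
        inj₁≢inj₂ : inj₁ i ≢ inj₂ r
        inj₁≢inj₂ ()

  matrix≡ : ∀ i k → matrix i k ≡ A i k
  matrix≡ zero    k = top≡ k
  matrix≡ (suc i) k = by-split m (λ i → matrix (suc i) k ≡ A (suc i) k)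
    (λ i → trans (cong (λ c → row c (i ↑ˡ K) k) (Finₚ.splitAt-↑ˡ m i K)) (sym (unit-row i k)))
    (λ r → trans (cong (λ c → row c (m ↑ʳ r) k) (Finₚ.splitAt-↑ʳ m K r)) (trans (cong +_ (bottom≡ r k)) (sym (row-nonNeg r k)))) i

  rhs≡ : ∀ i → rhs i ≡ b i
  rhs≡ zero    = sym b₀≡
  rhs≡ (suc i) = by-split m (λ i → rhs (suc i) ≡ b (suc i))
    (λ i → trans (cong side (Finₚ.splitAt-↑ˡ m i K)) (sym (unit-side i)))
    (λ r → trans (cong side (Finₚ.splitAt-↑ʳ m K r)) (sym (proj₁ (residue-abs (rightHandSide (m ↑ʳ r)))))) i

-- Counting

length-cartesianProductWith : ∀ {A B C : Set} (f : A → B → C) as bs → length (List.cartesianProductWith f as bs) ≡ length as ℕ.* length bs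
length-cartesianProductWith f List.[]        bs = refl
length-cartesianProductWith f (a List.∷ as) bs = trans (Listₚ.length-++ (List.map (f a) bs))
  (cong₂ ℕ._+_ (Listₚ.length-map (f a) bs) (length-cartesianProductWith f as bs))

^-distribʳ-* : ∀ r a b → (a ℕ.* b) ℕ.^ r ≡ a ℕ.^ r ℕ.* b ℕ.^ r
^-distribʳ-* zero    a b = refl
^-distribʳ-* (suc r) a b = trans (cong (a ℕ.* b ℕ.*_) (^-distribʳ-* r a b)) (ring a b (a ℕ.^ r) (b ℕ.^ r))
  where
  ring : ∀ a b p q → a ℕ.* b ℕ.* (p ℕ.* q) ≡ a ℕ.* p ℕ.* (b ℕ.* q)
  ring = ℕS.solve-∀

vectors : ∀ {A : Set} → List A → ∀ k → List (Vec A k)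
vectors as zero    = Vec.[] List.∷ List.[]
vectors as (suc k) = List.cartesianProductWith Vec._∷_ as (vectors as k)

length-vectors : ∀ {A : Set} (as : List A) k → length (vectors as k) ≡ length as ℕ.^ k
length-vectors as zero    = refl
length-vectors as (suc k) = trans (length-cartesianProductWith Vec._∷_ as (vectors as k)) (cong (length as ℕ.*_) (length-vectors as k))

∈-vectors : ∀ {A : Set} (as : List A) {k} (f : Fin k → A) → (∀ i → f i ∈ as) → Vec.tabulate f ∈ vectors as k
∈-vectors as {zero}  f h = Any.here refl
∈-vectors as {suc k} f h = ∈ₚ.∈-cartesianProductWith⁺ Vec._∷_ (h zero) (∈-vectors as (f ∘ suc) (h ∘ suc))

-- A nonempty word either starts with the largest admissible letter or avoids it altogether, so the
-- lengths obey Pascal's rule.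
descendingWords : ℕ → ∀ m → List (Vec ℕ m)
descendingWords s       zero    = Vec.[] List.∷ List.[]
descendingWords zero    (suc m) = List.[]
descendingWords (suc s) (suc m) = List.map (s Vec.∷_) (descendingWords (suc s) m) List.++ descendingWords s (suc m)

∈-descendingWords : ∀ s {m} (f : Fin m → ℕ) → Descending f → (∀ i → f i ℕ.< s) → Vec.tabulate f ∈ descendingWords s m
∈-descendingWords s {zero} f desc f< = Any.here refl
∈-descendingWords zero {suc m} f desc f< = ⊥-elim (ℕₚ.n≮0 (f< zero))
∈-descendingWords (suc s) {suc m} f desc f< with f zero ℕ.≟ s
... | yes e = ∈ₚ.∈-++⁺ˡ (subst (λ x → (x Vec.∷ Vec.tabulate (f ∘ suc)) ∈ List.map (s Vec.∷_) (descendingWords (suc s) m)) (sym e)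
  (∈ₚ.∈-map⁺ (s Vec.∷_) (∈-descendingWords (suc s) (f ∘ suc) (λ i j le → desc (suc i) (suc j) (ℕ.s≤s le)) (f< ∘ suc))))
... | no f₀≢s = ∈ₚ.∈-++⁺ʳ (List.map (s Vec.∷_) (descendingWords (suc s) m)) (∈-descendingWords s f desc (λ i → ℕₚ.≤-<-trans (desc zero i ℕ.z≤n) (ℕₚ.≤∧≢⇒< (ℕ.s≤s⁻¹ (f< zero)) f₀≢s)))

-- Estimates for the number of sorted words and for powers

wordCount : ℕ → ℕ → ℕ
wordCount s m = length (descendingWords s m)

wordCount-suc : ∀ s m → wordCount (suc s) (suc m) ≡ wordCount (suc s) m ℕ.+ wordCount s (suc m)
wordCount-suc s m = trans (Listₚ.length-++ (List.map (s Vec.∷_) (descendingWords (suc s) m)))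
  (cong (ℕ._+ wordCount s (suc m)) (Listₚ.length-map (s Vec.∷_) (descendingWords (suc s) m)))

-- The first two terms of the binomial expansion of (x + 1)^(k + 1), in the form that Pascal's rule
-- calls for in `wordCount-!`.
^-bernoulli : ∀ x k → x ℕ.^ suc k ℕ.+ suc k ℕ.* x ℕ.^ k ℕ.≤ suc x ℕ.^ suc k
^-bernoulli x zero    = ℕₚ.≤-reflexive (ring x)
  where
  ring : ∀ x → x ℕ.* 1 ℕ.+ 1 ≡ suc x ℕ.* 1
  ring = ℕS.solve-∀
^-bernoulli x (suc k) = begin
  x ℕ.* (x ℕ.* p) ℕ.+ suc (suc k) ℕ.* (x ℕ.* p)                        ≤⟨ ℕₚ.m≤m+n _ (suc k ℕ.* p) ⟩
  x ℕ.* (x ℕ.* p) ℕ.+ suc (suc k) ℕ.* (x ℕ.* p) ℕ.+ suc k ℕ.* p        ≡⟨ ring x k p ⟩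
  suc x ℕ.* (x ℕ.* p ℕ.+ suc k ℕ.* p)                                  ≤⟨ ℕₚ.*-monoʳ-≤ (suc x) (^-bernoulli x k) ⟩
  suc x ℕ.* suc x ℕ.^ suc k                                            ∎
  where
  open ℕₚ.≤-Reasoning
  p = x ℕ.^ k
  ring : ∀ x k p → x ℕ.* (x ℕ.* p) ℕ.+ suc (suc k) ℕ.* (x ℕ.* p) ℕ.+ suc k ℕ.* p ≡ suc x ℕ.* (x ℕ.* p ℕ.+ suc k ℕ.* p)
  ring = ℕS.solve-∀

!≤^ : ∀ r → r ! ℕ.≤ r ℕ.^ r
!≤^ zero    = ℕₚ.≤-refl
!≤^ (suc r) = ℕₚ.*-monoʳ-≤ (suc r) (ℕₚ.≤-trans (!≤^ r) (ℕₚ.^-monoˡ-≤ r (ℕₚ.n≤1+n r)))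

-- The count is the binomial coefficient of m + r over r; Pascal's rule and Bernoulli's inequality
-- give the estimate without a closed formula.
wordCount-! : ∀ r m → wordCount (suc r) m ℕ.* r ! ℕ.≤ (m ℕ.+ r) ℕ.^ r
wordCount-! r       zero    = ℕₚ.≤-trans (ℕₚ.≤-reflexive (ℕₚ.*-identityˡ (r !))) (!≤^ r)
wordCount-! zero    (suc m) = begin
  wordCount 1 (suc m) ℕ.* 1      ≡⟨ cong (ℕ._* 1) (trans (wordCount-suc 0 m) (ℕₚ.+-identityʳ (wordCount 1 m))) ⟩
  wordCount 1 m ℕ.* 1            ≤⟨ wordCount-! zero m ⟩
  1                              ∎
  where open ℕₚ.≤-Reasoning
wordCount-! (suc r) (suc m) = begin
  wordCount (suc (suc r)) (suc m) ℕ.* (suc r ℕ.* r !)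
    ≡⟨ cong (ℕ._* (suc r ℕ.* r !)) (wordCount-suc (suc r) m) ⟩
  (wordCount (suc (suc r)) m ℕ.+ wordCount (suc r) (suc m)) ℕ.* (suc r ℕ.* r !)
    ≡⟨ ring (wordCount (suc (suc r)) m) (wordCount (suc r) (suc m)) r (r !) ⟩
  wordCount (suc (suc r)) m ℕ.* (suc r ℕ.* r !) ℕ.+ suc r ℕ.* (wordCount (suc r) (suc m) ℕ.* r !)
    ≤⟨ ℕₚ.+-mono-≤ (wordCount-! (suc r) m) (ℕₚ.*-monoʳ-≤ (suc r) (wordCount-! r (suc m))) ⟩
  (m ℕ.+ suc r) ℕ.^ suc r ℕ.+ suc r ℕ.* (suc m ℕ.+ r) ℕ.^ r
    ≡⟨ cong (λ x → (m ℕ.+ suc r) ℕ.^ suc r ℕ.+ suc r ℕ.* x ℕ.^ r) (sym (ℕₚ.+-suc m r)) ⟩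
  (m ℕ.+ suc r) ℕ.^ suc r ℕ.+ suc r ℕ.* (m ℕ.+ suc r) ℕ.^ r
    ≤⟨ ^-bernoulli (m ℕ.+ suc r) r ⟩
  (suc m ℕ.+ suc r) ℕ.^ suc r ∎
  where
  open ℕₚ.≤-Reasoning
  ring : ∀ a b r f → (a ℕ.+ b) ℕ.* (suc r ℕ.* f) ≡ a ℕ.* (suc r ℕ.* f) ℕ.+ suc r ℕ.* (b ℕ.* f)
  ring = ℕS.solve-∀

-- Bernoulli's inequality (1 - 1/(s+1))^i ≥ 1 - i/(s+1) for s = i + k, cleared of denominators.
bernoulli-reciprocal : ∀ i k → suc (i ℕ.+ k) ℕ.^ i ℕ.* suc k ℕ.≤ suc (i ℕ.+ k) ℕ.* (i ℕ.+ k) ℕ.^ i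
bernoulli-reciprocal zero    k = ℕₚ.≤-reflexive (ring k)
  where
  ring : ∀ k → 1 ℕ.* suc k ≡ suc k ℕ.* 1
  ring = ℕS.solve-∀
bernoulli-reciprocal (suc i) k = begin
  suc s ℕ.* p ℕ.* suc k                    ≡⟨ ring₁ s p k ⟩
  p ℕ.* (s ℕ.* suc k ℕ.+ suc k)            ≤⟨ ℕₚ.*-monoʳ-≤ p (ℕₚ.+-monoʳ-≤ (s ℕ.* suc k) (ℕ.s≤s (ℕₚ.m≤n+m k i))) ⟩
  p ℕ.* (s ℕ.* suc k ℕ.+ s)                ≡⟨ ring₂ s p k ⟩
  s ℕ.* (p ℕ.* suc (suc k))                ≤⟨ ℕₚ.*-monoʳ-≤ s (subst (λ s → suc s ℕ.^ i ℕ.* suc (suc k) ℕ.≤ suc s ℕ.* s ℕ.^ i) (ℕₚ.+-suc i k) (bernoulli-reciprocal i (suc k))) ⟩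
  s ℕ.* (suc s ℕ.* s ℕ.^ i)                ≡⟨ ring₃ s (s ℕ.^ i) ⟩
  suc s ℕ.* (s ℕ.* s ℕ.^ i)                ∎
  where
  open ℕₚ.≤-Reasoning
  s = suc (i ℕ.+ k)
  p = suc s ℕ.^ i
  ring₁ : ∀ s p k → suc s ℕ.* p ℕ.* suc k ≡ p ℕ.* (s ℕ.* suc k ℕ.+ suc k)
  ring₁ = ℕS.solve-∀
  ring₂ : ∀ s p k → p ℕ.* (s ℕ.* suc k ℕ.+ s) ≡ s ℕ.* (p ℕ.* suc (suc k))
  ring₂ = ℕS.solve-∀
  ring₃ : ∀ s q → s ℕ.* (suc s ℕ.* q) ≡ suc s ℕ.* (s ℕ.* q)
  ring₃ = ℕS.solve-∀

-- Bernoulli gives (1 + 1/s)^i ≤ (s + 1)/(k + 1) for s = i + k, and i ≤ k + 1 makes this ratio at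
-- most 2.
half-power : ∀ i k → i ℕ.≤ suc k → suc (i ℕ.+ k) ℕ.^ i ℕ.≤ 2 ℕ.* (i ℕ.+ k) ℕ.^ i
half-power i k le = ℕₚ.*-cancelʳ-≤ (suc (i ℕ.+ k) ℕ.^ i) (2 ℕ.* (i ℕ.+ k) ℕ.^ i) (suc k) (begin
  suc (i ℕ.+ k) ℕ.^ i ℕ.* suc k                  ≤⟨ bernoulli-reciprocal i k ⟩
  suc (i ℕ.+ k) ℕ.* (i ℕ.+ k) ℕ.^ i              ≤⟨ ℕₚ.*-monoˡ-≤ ((i ℕ.+ k) ℕ.^ i) (ℕₚ.≤-trans (ℕₚ.≤-reflexive (sym (ℕₚ.+-suc i k))) (ℕₚ.+-monoˡ-≤ (suc k) le)) ⟩
  (suc k ℕ.+ suc k) ℕ.* (i ℕ.+ k) ℕ.^ i          ≡⟨ ring k ((i ℕ.+ k) ℕ.^ i) ⟩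
  2 ℕ.* (i ℕ.+ k) ℕ.^ i ℕ.* suc k                ∎)
  where
  open ℕₚ.≤-Reasoning
  ring : ∀ k q → (suc k ℕ.+ suc k) ℕ.* q ≡ 2 ℕ.* q ℕ.* suc k
  ring = ℕS.solve-∀

-- An integer substitute for (1 + 1/s)^s ≤ e: each half of the exponent contributes a factor of at
-- most 2.
suc-^ : ∀ s → suc s ℕ.^ s ℕ.≤ 4 ℕ.* s ℕ.^ s
suc-^ s = begin
  suc s ℕ.^ s                                   ≡⟨ cong (suc s ℕ.^_) (ℕₚ.⌊n/2⌋+⌈n/2⌉≡n s) ⟨
  suc s ℕ.^ (i ℕ.+ k)                           ≡⟨ ℕₚ.^-distribˡ-+-* (suc s) i k ⟩
  suc s ℕ.^ i ℕ.* suc s ℕ.^ k                   ≤⟨ ℕₚ.*-mono-≤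
    (subst (λ s → suc s ℕ.^ i ℕ.≤ 2 ℕ.* s ℕ.^ i) (ℕₚ.⌊n/2⌋+⌈n/2⌉≡n s) (half-power i k (ℕₚ.≤-trans (ℕₚ.⌊n/2⌋≤⌈n/2⌉ s) (ℕₚ.n≤1+n k))))
    (subst (λ s → suc s ℕ.^ k ℕ.≤ 2 ℕ.* s ℕ.^ k) (trans (ℕₚ.+-comm k i) (ℕₚ.⌊n/2⌋+⌈n/2⌉≡n s)) (half-power k i (ℕₚ.⌊n/2⌋-mono (ℕₚ.n≤1+n (suc s))))) ⟩
  2 ℕ.* s ℕ.^ i ℕ.* (2 ℕ.* s ℕ.^ k)             ≡⟨ ring (s ℕ.^ i) (s ℕ.^ k) ⟩
  4 ℕ.* (s ℕ.^ i ℕ.* s ℕ.^ k)                   ≡⟨ cong (4 ℕ.*_) (trans (sym (ℕₚ.^-distribˡ-+-* s i k)) (cong (s ℕ.^_) (ℕₚ.⌊n/2⌋+⌈n/2⌉≡n s))) ⟩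
  4 ℕ.* s ℕ.^ s                                 ∎
  where
  open ℕₚ.≤-Reasoning
  i = ℕ.⌊ s /2⌋
  k = ℕ.⌈ s /2⌉
  ring : ∀ a b → 2 ℕ.* a ℕ.* (2 ℕ.* b) ≡ 4 ℕ.* (a ℕ.* b)
  ring = ℕS.solve-∀

-- Passing from r to r + 1 multiplies (r + 1)^r / r! by ((r + 2)/(r + 1))^(r + 1), which is at most
-- 4.
suc-^-! : ∀ r → suc r ℕ.^ r ℕ.≤ 4 ℕ.^ r ℕ.* r !
suc-^-! zero    = ℕₚ.≤-refl
suc-^-! (suc r) = begin
  suc (suc r) ℕ.^ suc r                    ≤⟨ suc-^ (suc r) ⟩
  4 ℕ.* (suc r ℕ.* suc r ℕ.^ r)            ≤⟨ ℕₚ.*-monoʳ-≤ 4 (ℕₚ.*-monoʳ-≤ (suc r) (suc-^-! r)) ⟩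
  4 ℕ.* (suc r ℕ.* (4 ℕ.^ r ℕ.* r !))      ≡⟨ ring r (4 ℕ.^ r) (r !) ⟩
  4 ℕ.* 4 ℕ.^ r ℕ.* (suc r ℕ.* r !)        ∎
  where
  open ℕₚ.≤-Reasoning
  ring : ∀ r p f → 4 ℕ.* (suc r ℕ.* (p ℕ.* f)) ≡ 4 ℕ.* p ℕ.* (suc r ℕ.* f)
  ring = ℕS.solve-∀

-- The binomial estimate divides by r!, whereas the claim divides by Δ^(Δ-1). Trading one for the
-- other costs 4^r, and m + r ≤ 2 n costs 2^r.
wordCount-bound : ∀ r m n → m ℕ.≤ n → r ℕ.≤ n → wordCount (suc r) m ℕ.* suc r ℕ.^ r ℕ.≤ 8 ℕ.^ r ℕ.* n ℕ.^ r
wordCount-bound r m n m≤n r≤n = begin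
  wordCount (suc r) m ℕ.* suc r ℕ.^ r              ≤⟨ ℕₚ.*-monoʳ-≤ (wordCount (suc r) m) (suc-^-! r) ⟩
  wordCount (suc r) m ℕ.* (4 ℕ.^ r ℕ.* r !)        ≡⟨ ring (wordCount (suc r) m) (4 ℕ.^ r) (r !) ⟩
  4 ℕ.^ r ℕ.* (wordCount (suc r) m ℕ.* r !)        ≤⟨ ℕₚ.*-monoʳ-≤ (4 ℕ.^ r) (wordCount-! r m) ⟩
  4 ℕ.^ r ℕ.* (m ℕ.+ r) ℕ.^ r                      ≤⟨ ℕₚ.*-monoʳ-≤ (4 ℕ.^ r) (ℕₚ.^-monoˡ-≤ r (ℕₚ.≤-trans (ℕₚ.+-mono-≤ m≤n r≤n) (ℕₚ.≤-reflexive (double n)))) ⟩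
  4 ℕ.^ r ℕ.* (2 ℕ.* n) ℕ.^ r                      ≡⟨ cong (4 ℕ.^ r ℕ.*_) (^-distribʳ-* r 2 n) ⟩
  4 ℕ.^ r ℕ.* (2 ℕ.^ r ℕ.* n ℕ.^ r)                ≡⟨ ℕₚ.*-assoc (4 ℕ.^ r) (2 ℕ.^ r) (n ℕ.^ r) ⟨
  4 ℕ.^ r ℕ.* 2 ℕ.^ r ℕ.* n ℕ.^ r                  ≡⟨ cong (ℕ._* n ℕ.^ r) (^-distribʳ-* r 4 2) ⟨
  8 ℕ.^ r ℕ.* n ℕ.^ r                              ∎
  where
  open ℕₚ.≤-Reasoning
  double : ∀ n → n ℕ.+ n ≡ 2 ℕ.* n
  double = ℕS.solve-∀
  ring : ∀ w p f → w ℕ.* (p ℕ.* f) ≡ p ℕ.* (w ℕ.* f)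
  ring = ℕS.solve-∀

log₂ : ∀ Δ → 1 ℕ.≤ Δ → ∃[ K ] 2 ℕ.^ K ℕ.≤ Δ × Δ ℕ.< 2 ℕ.^ suc K
log₂ (suc zero)    _ = 0 , ℕₚ.≤-refl , ℕₚ.≤-refl
log₂ (suc (suc Δ)) _ with log₂ (suc Δ) (ℕ.s≤s ℕ.z≤n)
... | K , lower , upper with suc (suc Δ) ℕ.<? 2 ℕ.^ suc K
... | yes lt = K , ℕₚ.≤-trans lower (ℕₚ.n≤1+n (suc Δ)) , lt
... | no ≮   = suc K , ℕₚ.≮⇒≥ ≮ , ℕₚ.≤-<-trans upper (ℕₚ.^-monoʳ-< 2 (ℕₚ.≤-refl {2}) (ℕₚ.n<1+n (suc K)))

exponent : ℕ → ℕ
exponent K = suc K ℕ.* (K ℕ.* K ℕ.+ (K ℕ.+ K))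

-- A cubic against an exponential. The summand 13 on the left is what turns 2^K ≤ r + 1 into
-- `exponent K` ≤ 13 r. From K = 3 on, a step at most doubles the left-hand side; the values up to 3
-- are evaluated.
exponent-bound : ∀ K → exponent K ℕ.+ 13 ℕ.≤ 13 ℕ.* 2 ℕ.^ K
exponent-bound 0 = ℕₚ.≤-refl
exponent-bound 1 = ℕₚ.≤ᵇ⇒≤ 19 26 tt
exponent-bound 2 = ℕₚ.≤ᵇ⇒≤ 37 52 tt
exponent-bound 3 = ℕₚ.≤ᵇ⇒≤ 73 104 tt
exponent-bound (suc (suc (suc (suc j)))) = begin
  -- The cubic added here is exactly the amount by which twice the previous left-hand side exceeds
  -- the present one.
  exponent (4 ℕ.+ j) ℕ.+ 13                  ≤⟨ ℕₚ.m≤m+n _ (13 ℕ.+ 20 ℕ.* j ℕ.+ 9 ℕ.* (j ℕ.* j) ℕ.+ j ℕ.* (j ℕ.* j)) ⟩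
  exponent (4 ℕ.+ j) ℕ.+ 13 ℕ.+ (13 ℕ.+ 20 ℕ.* j ℕ.+ 9 ℕ.* (j ℕ.* j) ℕ.+ j ℕ.* (j ℕ.* j)) ≡⟨ ring j ⟩
  2 ℕ.* (exponent (3 ℕ.+ j) ℕ.+ 13)          ≤⟨ ℕₚ.*-monoʳ-≤ 2 (exponent-bound (suc (suc (suc j)))) ⟩
  2 ℕ.* (13 ℕ.* 2 ℕ.^ (3 ℕ.+ j))             ≡⟨ swap (2 ℕ.^ (3 ℕ.+ j)) ⟩
  13 ℕ.* (2 ℕ.* 2 ℕ.^ (3 ℕ.+ j))             ∎
  where
  open ℕₚ.≤-Reasoning
  ring : ∀ j → (5 ℕ.+ j) ℕ.* ((4 ℕ.+ j) ℕ.* (4 ℕ.+ j) ℕ.+ ((4 ℕ.+ j) ℕ.+ (4 ℕ.+ j))) ℕ.+ 13 ℕ.+ (13 ℕ.+ 20 ℕ.* j ℕ.+ 9 ℕ.* (j ℕ.* j) ℕ.+ j ℕ.* (j ℕ.* j))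
           ≡ 2 ℕ.* ((4 ℕ.+ j) ℕ.* ((3 ℕ.+ j) ℕ.* (3 ℕ.+ j) ℕ.+ ((3 ℕ.+ j) ℕ.+ (3 ℕ.+ j))) ℕ.+ 13)
  ring = ℕS.solve-∀
  swap : ∀ x → 2 ℕ.* (13 ℕ.* x) ≡ 13 ℕ.* (2 ℕ.* x)
  swap = ℕS.solve-∀

-- Bounding Δ + 1 by 2^(K + 1) leaves a power of 2 whose exponent is cubic in K, while r is at least
-- 2^K - 1.
suc-Δ-power : ∀ K r → 2 ℕ.^ K ℕ.≤ suc r → suc r ℕ.< 2 ℕ.^ suc K →
              suc (suc r) ℕ.^ (K ℕ.* K ℕ.+ (K ℕ.+ K)) ℕ.≤ (2 ℕ.^ 13) ℕ.^ r
suc-Δ-power K r lower upper = begin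
  suc (suc r) ℕ.^ E               ≤⟨ ℕₚ.^-monoˡ-≤ E upper ⟩
  (2 ℕ.^ suc K) ℕ.^ E             ≡⟨ ℕₚ.^-*-assoc 2 (suc K) E ⟩
  2 ℕ.^ exponent K                ≤⟨ ℕₚ.^-monoʳ-≤ 2 (ℕₚ.+-cancelʳ-≤ 13 (exponent K) (13 ℕ.* r)
                                       (ℕₚ.≤-trans (exponent-bound K) (ℕₚ.≤-trans (ℕₚ.*-monoʳ-≤ 13 lower) (ℕₚ.≤-reflexive (ring r))))) ⟩
  2 ℕ.^ (13 ℕ.* r)                ≡⟨ ℕₚ.^-*-assoc 2 13 r ⟨
  (2 ℕ.^ 13) ℕ.^ r                ∎
  where
  open ℕₚ.≤-Reasoning
  E = K ℕ.* K ℕ.+ (K ℕ.+ K)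
  ring : ∀ r → 13 ℕ.* suc r ≡ 13 ℕ.* r ℕ.+ 13
  ring = ℕS.solve-∀

n≤2^n : ∀ n → n ℕ.≤ 2 ℕ.^ n
n≤2^n zero    = ℕ.z≤n
n≤2^n (suc n) = ℕₚ.≤-trans (ℕₚ.+-mono-≤ (ℕₚ.m^n>0 2 n) (n≤2^n n)) (ℕₚ.≤-reflexive (cong (2 ℕ.^ n ℕ.+_) (sym (ℕₚ.+-identityʳ (2 ℕ.^ n)))))

-- Codes store vectors, and looking up a tabulated vector returns the original function only
-- pointwise; candidates therefore have to be compared entry by entry.
module _ {m K Δ : ℕ} {T T' : Fin K → Fin K → ℕ} {w w' : Fin m → ℕ} {t t' β β' : Fin K → ℕ} {g : ℕ}
  (T≡ : ∀ r s → T r s ≡ T' r s) (w≡ : ∀ j → w j ≡ w' j) (t≡ : ∀ r → t r ≡ t' r) (β≡ : ∀ r → β r ≡ β' r) where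
  private
    module C  = Candidate m K Δ T w t β g
    module C' = Candidate m K Δ T' w' t' β' g

  bottom-cong : ∀ r k → C.bottom r k ≡ C'.bottom r k
  bottom-cong r (inj₁ j) = trans (decode-cong (w j) (λ s → T≡ s s) r) (cong (λ x → decode (λ s → T' s s) x r) (w≡ j))
  bottom-cong r (inj₂ s) = T≡ r s

  weight-cong : ∀ k → C.weight k ≡ C'.weight k
  weight-cong k = cong ∣_∣ (Zs.S-cong (λ r → cong₂ (λ a b → + a ℤ.* + b) (t≡ r) (bottom-cong r k)))

  matrix-cong : ∀ i j → C.matrix i j ≡ C'.matrix i j
  matrix-cong zero j = cong (λ a → ℤ.- + a) (top-cong (Fin.splitAt m j))
    where
    top-cong : ∀ k → C.top k ≡ C'.top k
    top-cong (inj₁ j) = cong (λ a → suc (quotient a Δ)) (weight-cong (inj₁ j))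
    top-cong (inj₂ s) = cong (λ a → quotient a Δ) (weight-cong (inj₂ s))
  matrix-cong (suc i) j = row-cong (Fin.splitAt m i)
    where
    row-cong : ∀ k → C.row k i j ≡ C'.row k i j
    row-cong (inj₁ _) = refl
    row-cong (inj₂ r) = cong +_ (bottom-cong r (Fin.splitAt m j))

  rhs-cong : ∀ i → C.rhs i ≡ C'.rhs i
  rhs-cong zero = refl
  rhs-cong (suc i) = side-cong (Fin.splitAt m i)
    where
    side-cong : ∀ k → C.side k ≡ C'.side k
    side-cong (inj₁ _) = refl
    side-cong (inj₂ r) = cong +_ (β≡ r)

-- Enumeration of the candidates

module Enumerate (m K Δ : ℕ) where
  n = m ℕ.+ K

  Simplex : Set
  Simplex = Mat ℤ (suc n) n × Vect ℤ (suc n)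

  Code : Set
  Code = Vec (Vec ℕ K) K × Vec ℕ m × Vec ℕ K × Vec ℕ K × ℕ

  digits : List ℕ
  digits = List.upTo (suc Δ)

  codes : List Code
  codes = List.cartesianProductWith _,_ (vectors (vectors digits K) K)
    (List.cartesianProductWith _,_ (descendingWords Δ m)
      (List.cartesianProductWith _,_ (vectors digits K)
        (List.cartesianProductWith _,_ (vectors digits K) (List.upTo (K ℕ.* Δ)))))

  simplex : Code → Simplex
  simplex (T , w , t , β , g) = C.matrix , C.rhs
    where module C = Candidate m K Δ (λ r s → Vec.lookup (Vec.lookup T r) s) (Vec.lookup w) (Vec.lookup t) (Vec.lookup β) g

  length-codes : length codes ≡ suc Δ ℕ.^ (K ℕ.* K ℕ.+ (K ℕ.+ K)) ℕ.* (wordCount Δ m ℕ.* (K ℕ.* Δ))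
  length-codes = begin
    length codes
      ≡⟨ length-cartesianProductWith _,_ (vectors (vectors digits K) K) _ ⟩
    length (vectors (vectors digits K) K) ℕ.* _
      ≡⟨ cong₂ ℕ._*_ (trans (length-vectors (vectors digits K) K) (trans (cong (ℕ._^ K) length-digits) (ℕₚ.^-*-assoc (suc Δ) K K)))
           (trans (length-cartesianProductWith _,_ (descendingWords Δ m) _) (cong (wordCount Δ m ℕ.*_)
             (trans (length-cartesianProductWith _,_ (vectors digits K) _) (cong₂ ℕ._*_ length-digits
               (trans (length-cartesianProductWith _,_ (vectors digits K) _) (cong₂ ℕ._*_ length-digits (Listₚ.length-upTo (K ℕ.* Δ)))))))) ⟩
    suc Δ ℕ.^ (K ℕ.* K) ℕ.* (wordCount Δ m ℕ.* (suc Δ ℕ.^ K ℕ.* (suc Δ ℕ.^ K ℕ.* (K ℕ.* Δ))))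
      ≡⟨ ring (suc Δ ℕ.^ (K ℕ.* K)) (wordCount Δ m) (suc Δ ℕ.^ K) (K ℕ.* Δ) ⟩
    suc Δ ℕ.^ (K ℕ.* K) ℕ.* (suc Δ ℕ.^ K ℕ.* suc Δ ℕ.^ K) ℕ.* (wordCount Δ m ℕ.* (K ℕ.* Δ))
      ≡⟨ cong (ℕ._* (wordCount Δ m ℕ.* (K ℕ.* Δ))) (trans (cong (suc Δ ℕ.^ (K ℕ.* K) ℕ.*_) (sym (ℕₚ.^-distribˡ-+-* (suc Δ) K K))) (sym (ℕₚ.^-distribˡ-+-* (suc Δ) (K ℕ.* K) (K ℕ.+ K)))) ⟩
    suc Δ ℕ.^ (K ℕ.* K ℕ.+ (K ℕ.+ K)) ℕ.* (wordCount Δ m ℕ.* (K ℕ.* Δ)) ∎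
    where
    open ≡-Reasoning
    length-digits : length (vectors digits K) ≡ suc Δ ℕ.^ K
    length-digits = trans (length-vectors digits K) (cong (ℕ._^ K) (Listₚ.length-upTo (suc Δ)))
    ring : ∀ a w p k → a ℕ.* (w ℕ.* (p ℕ.* (p ℕ.* k))) ≡ a ℕ.* (p ℕ.* p) ℕ.* (w ℕ.* k)
    ring = ℕS.solve-∀

  -- The minor omitting the first row is required to be Δ, since the decision procedure works with
  -- the τ defined from that minor.
  Good : Simplex → Set
  Good (A , b) = ∣ det n (delRow A zero) ∣ ≡ Δ × EmptyΔModSimplex n Δ A b

  good? : 1 ℕ.≤ Δ → ∀ p → Dec (Good p)
  good? 1≤Δ (A , b) = decide (∣ det n (delRow A zero) ∣ ℕ.≟ Δ)
    where
    decide : Dec (∣ det n (delRow A zero) ∣ ≡ Δ) → Dec (Good (A , b))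
    decide (no d≢)  = no (λ g → d≢ (proj₁ g))
    decide (yes d≡) = map′ (d≡ ,_) proj₂ (Barycentric.emptyΔModSimplex? A b Δ 1≤Δ d≡)

  module _ (1≤Δ : 1 ℕ.≤ Δ) (Δ<2^K : Δ ℕ.< 2 ℕ.^ suc K) where

    reps : List Simplex
    reps = List.filter (good? 1≤Δ) (List.map simplex codes)

    length-reps : length reps ℕ.≤ length codes
    length-reps = ℕₚ.≤-trans (Listₚ.length-filter (good? 1≤Δ) (List.map simplex codes)) (ℕₚ.≤-reflexive (Listₚ.length-map simplex codes))

    reps-good : ∀ {p} → p ∈ reps → EmptyΔModSimplex n Δ (proj₁ p) (proj₂ p)
    reps-good p∈ = proj₂ (proj₂ (∈ₚ.∈-filter⁻ (good? 1≤Δ) {xs = List.map simplex codes} p∈))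

    -- The candidate decoded from the parameters of a normal form has the same entries as that form.
    -- All tested properties travel along `Reach`, so the filter keeps it.
    represented : ∀ A b → EmptyΔModSimplex n Δ A b → ∃[ p ] p ∈ reps × IntEquiv {n} (A , b) p
    represented A b s = simplex code ,
      ∈ₚ.∈-filter⁺ (good? 1≤Δ) (∈ₚ.∈-map⁺ simplex code∈) (trans (reach-minor reach″ zero) d≡ , reach-EmptyΔModSimplex reach″ s') ,
      reach-IntEquiv (reach-trans reach′ reach″)
      where
      norm = normalize m K A b Δ<2^K 1≤Δ s
      A' : Mat ℤ (suc n) n
      A' = proj₁ norm
      b' : Vect ℤ (suc n)
      b' = proj₁ (proj₂ norm)
      reach′ : Reach A b A' b'
      reach′ = proj₁ (proj₂ (proj₂ norm))
      nf : NormalForm m K Δ A' b'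
      nf = proj₁ (proj₂ (proj₂ (proj₂ norm)))
      d≡ : ∣ det n (delRow A' zero) ∣ ≡ Δ
      d≡ = proj₂ (proj₂ (proj₂ (proj₂ norm)))
      s' : EmptyΔModSimplex n Δ A' b'
      s' = reach-EmptyΔModSimplex reach′ s
      module R = Recover m K Δ A' b' 1≤Δ nf d≡ s'
      code : Code
      code = Vec.tabulate (λ r → Vec.tabulate (R.T r)) , Vec.tabulate R.w , Vec.tabulate R.t , Vec.tabulate R.β , R.g
      digit∈ : ∀ {x} → x ℕ.≤ Δ → x ∈ digits
      digit∈ le = ∈ₚ.∈-upTo⁺ (ℕ.s≤s le)
      code∈ : code ∈ codes
      code∈ = ∈ₚ.∈-cartesianProductWith⁺ _,_ (∈-vectors (vectors digits K) (λ r → Vec.tabulate (R.T r)) (λ r → ∈-vectors digits (R.T r) (λ s → digit∈ (R.T-≤ r s))))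
        (∈ₚ.∈-cartesianProductWith⁺ _,_ (∈-descendingWords Δ R.w (NormalForm.sorted nf) R.w-<)
          (∈ₚ.∈-cartesianProductWith⁺ _,_ (∈-vectors digits R.t (λ r → digit∈ (R.t-≤ r)))
            (∈ₚ.∈-cartesianProductWith⁺ _,_ (∈-vectors digits R.β (λ r → digit∈ (R.β-≤ r))) (∈ₚ.∈-upTo⁺ R.g-<))))
      T≡ : ∀ r s → Vec.lookup (Vec.lookup (proj₁ code) r) s ≡ R.T r s
      T≡ r s = trans (cong (λ v → Vec.lookup v s) (Vecₚ.lookup∘tabulate (λ r → Vec.tabulate (R.T r)) r)) (Vecₚ.lookup∘tabulate (R.T r) s)
      reach″ : Reach A' b' (proj₁ (simplex code)) (proj₂ (simplex code))
      reach″ = reach-cong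
        (λ i j → trans (matrix-cong {Δ = Δ} {g = R.g} T≡ (Vecₚ.lookup∘tabulate R.w) (Vecₚ.lookup∘tabulate R.t) (Vecₚ.lookup∘tabulate R.β) i j) (R.matrix≡ i j))
        (λ i → trans (rhs-cong {Δ = Δ} {g = R.g} T≡ (Vecₚ.lookup∘tabulate R.w) (Vecₚ.lookup∘tabulate R.t) (Vecₚ.lookup∘tabulate R.β) i) (R.rhs≡ i))

-- The factor Δ² pays for the K Δ values of g, because K ≤ 2^K ≤ Δ; the powers (2^13)^r and 8^r
-- combine to (2^16)^r.
codes-bound : ∀ m K r → suc r ℕ.≤ m ℕ.+ K → 2 ℕ.^ K ℕ.≤ suc r → suc r ℕ.< 2 ℕ.^ suc K →
  length (Enumerate.codes m K (suc r)) ℕ.* suc r ℕ.^ r ℕ.≤ (2 ℕ.^ 16) ℕ.^ r ℕ.* (m ℕ.+ K) ℕ.^ r ℕ.* suc r ℕ.^ 2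
codes-bound m K r Δ≤n lower upper = begin
  length (Enumerate.codes m K (suc r)) ℕ.* suc r ℕ.^ r
    ≡⟨ cong (ℕ._* suc r ℕ.^ r) (Enumerate.length-codes m K (suc r)) ⟩
  P ℕ.* (W ℕ.* (K ℕ.* suc r)) ℕ.* suc r ℕ.^ r
    ≡⟨ ring P W (K ℕ.* suc r) (suc r ℕ.^ r) ⟩
  P ℕ.* (W ℕ.* suc r ℕ.^ r) ℕ.* (K ℕ.* suc r)
    ≤⟨ ℕₚ.*-mono-≤ (ℕₚ.*-mono-≤ (suc-Δ-power K r lower upper) (wordCount-bound r m (m ℕ.+ K) (ℕₚ.m≤m+n m K) (ℕₚ.≤-trans (ℕₚ.n≤1+n r) Δ≤n)))
         (ℕₚ.*-mono-≤ (ℕₚ.≤-trans (n≤2^n K) lower) (ℕₚ.≤-reflexive (sym (ℕₚ.*-identityʳ (suc r))))) ⟩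
  (2 ℕ.^ 13) ℕ.^ r ℕ.* (8 ℕ.^ r ℕ.* (m ℕ.+ K) ℕ.^ r) ℕ.* suc r ℕ.^ 2
    ≡⟨ cong (ℕ._* suc r ℕ.^ 2) (trans (sym (ℕₚ.*-assoc ((2 ℕ.^ 13) ℕ.^ r) (8 ℕ.^ r) ((m ℕ.+ K) ℕ.^ r))) (cong (ℕ._* (m ℕ.+ K) ℕ.^ r) (sym (^-distribʳ-* r (2 ℕ.^ 13) 8)))) ⟩
  (2 ℕ.^ 16) ℕ.^ r ℕ.* (m ℕ.+ K) ℕ.^ r ℕ.* suc r ℕ.^ 2 ∎
  where
  open ℕₚ.≤-Reasoning
  P = suc (suc r) ℕ.^ (K ℕ.* K ℕ.+ (K ℕ.+ K))
  W = wordCount (suc r) m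
  ring : ∀ p w k d → p ℕ.* (w ℕ.* k) ℕ.* d ≡ p ℕ.* (w ℕ.* d) ℕ.* k
  ring = ℕS.solve-∀

-- Multiplying through by Δ^(Δ-1) avoids the fraction n/Δ. The inequality K ≤ 2^K ≤ Δ ≤ n is what
-- allows n to be split as m + K.
count : ∀ n Δ → 1 ℕ.≤ Δ → Δ ℕ.≤ n →
        ClassCountLe n Δ (λ N → N ℕ.* Δ ℕ.^ (Δ ℕ.∸ 1) ℕ.≤ (2 ℕ.^ 16) ℕ.^ (Δ ℕ.∸ 1) ℕ.* n ℕ.^ (Δ ℕ.∸ 1) ℕ.* Δ ℕ.^ 2)
count n Δ@(suc r) 1≤Δ Δ≤n = subst Claim (ℕₚ.m∸n+n≡m K≤n) (claim (n ℕ.∸ K) (subst (Δ ℕ.≤_) (sym (ℕₚ.m∸n+n≡m K≤n)) Δ≤n))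
  where
  Claim : ℕ → Set
  Claim n = ClassCountLe n Δ (λ N → N ℕ.* Δ ℕ.^ r ℕ.≤ (2 ℕ.^ 16) ℕ.^ r ℕ.* n ℕ.^ r ℕ.* Δ ℕ.^ 2)
  K = proj₁ (log₂ Δ 1≤Δ)
  lower = proj₁ (proj₂ (log₂ Δ 1≤Δ))
  upper = proj₂ (proj₂ (log₂ Δ 1≤Δ))
  K≤n : K ℕ.≤ n
  K≤n = ℕₚ.≤-trans (n≤2^n K) (ℕₚ.≤-trans lower Δ≤n)
  claim : ∀ m → Δ ℕ.≤ m ℕ.+ K → Claim (m ℕ.+ K)
  claim m le = E.reps 1≤Δ upper ,
    ℕₚ.≤-trans (ℕₚ.*-monoˡ-≤ (Δ ℕ.^ r) (E.length-reps 1≤Δ upper)) (codes-bound m K r le lower upper) ,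
    E.reps-good 1≤Δ upper , E.represented 1≤Δ upper
    where module E = Enumerate m K Δ

ClassCountLe-mono : ∀ {n Δ} {P Q : ℕ → Set} → (∀ N → P N → Q N) → ClassCountLe n Δ P → ClassCountLe n Δ Q
ClassCountLe-mono P⇒Q (reps , p , rest) = reps , P⇒Q (length reps) p , rest

-- Since 2^a ≥ 1, the premise 2^a K^b < M^b contradicts M ≤ K, so no u and v have to be produced.
≤⇒LeMulPowLog2 : ∀ {M K} D → M ℕ.≤ K → LeMulPowLog2 M K D
≤⇒LeMulPowLog2 {M} {K} D M≤K a b 0<b lt = ⊥-elim (ℕₚ.<⇒≱ lt (begin
  M ℕ.^ b                     ≤⟨ ℕₚ.^-monoˡ-≤ b M≤K ⟩
  K ℕ.^ b                     ≡⟨ ℕₚ.*-identityˡ (K ℕ.^ b) ⟨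
  1 ℕ.* K ℕ.^ b               ≤⟨ ℕₚ.*-monoˡ-≤ (K ℕ.^ b) (ℕₚ.m^n>0 2 a) ⟩
  2 ℕ.^ a ℕ.* K ℕ.^ b         ∎))
  where open ℕₚ.≤-Reasoning

open import Data.Nat using (ℕ; _≤_; _*_; _^_; _∸_)

theorem16 : (∃[ C ] ∀ n Δ → 1 ≤ Δ → Δ ≤ n →
    ClassCountLe n Δ (λ N →
    LeMulPowLog2 (N * Δ ^ (Δ ∸ 1)) ((C ^ (Δ ∸ 1)) * (n ^ (Δ ∸ 1)) * (Δ ^ 2)) Δ))
    × (∀ Δ → 1 ≤ Δ → ∃[ D ] ∀ n → Δ ≤ n →
    ClassCountLe n Δ (λ N → N ≤ D * n ^ (Δ ∸ 1)))
theorem16 = (2 ^ 16 , λ n Δ 1≤Δ Δ≤n → ClassCountLe-mono (λ N → ≤⇒LeMulPowLog2 {N * Δ ^ (Δ ∸ 1)} {(2 ^ 16) ^ (Δ ∸ 1) * n ^ (Δ ∸ 1) * Δ ^ 2} Δ) (count n Δ 1≤Δ Δ≤n)) ,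
  λ Δ 1≤Δ → (2 ^ 16) ^ (Δ ∸ 1) * Δ ^ 2 , λ n Δ≤n → ClassCountLe-mono (weaken Δ 1≤Δ n) (count n Δ 1≤Δ Δ≤n)
  where
  weaken : ∀ Δ → 1 ≤ Δ → ∀ n N → N * Δ ^ (Δ ∸ 1) ≤ (2 ^ 16) ^ (Δ ∸ 1) * n ^ (Δ ∸ 1) * Δ ^ 2 →
           N ≤ (2 ^ 16) ^ (Δ ∸ 1) * Δ ^ 2 * n ^ (Δ ∸ 1)
  weaken Δ@(suc r) _ n N le = begin
    N                                   ≤⟨ ℕₚ.m≤m*n N (Δ ^ r) {{ℕₚ.m^n≢0 Δ r}} ⟩
    N * Δ ^ r                           ≤⟨ le ⟩
    (2 ^ 16) ^ r * n ^ r * Δ ^ 2        ≡⟨ ring ((2 ^ 16) ^ r) (n ^ r) (Δ ^ 2) ⟩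
    (2 ^ 16) ^ r * Δ ^ 2 * n ^ r        ∎
    where
    open ℕₚ.≤-Reasoning
    ring : ∀ a b c → a * b * c ≡ a * c * b
    ring = ℕS.solve-∀
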